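{- Let $Q_{12}=\langle a,b : a^6=1,\ b^2=a^3,\ ab=ba^{ -1}\rangle$ be the dicyclic group of order $12$. Then $\mathcal S(Q_{12})$ is exactly the set of integers of the following forms, where $m$ ranges over all integers coprime to $6$: (i) $2^a3^bm$ with $a\in\{0,4\}$ or $a\ge 6$, and $b=0$ or $b\ge 3$; (ii) $2^5 3^b m$ with $b=4$ or $b\ge 6$; (iii) $2^5 3^b m k$ with $b\in\{0,3,5\}$, where $k$ is either a prime $p\equiv 5\pmod{12}$ or the square $p^2$ of a prime $p\equiv 5 \pmod 6$.
   Context: For a finite group $G=\{g_1,\dots,g_n\}$, assign an independent variable $x_g$ to each $g\in G$; the group determinant $\mathscr D_G(x_{g_1},\dots,x_{g_n})$ is the determinant of the $n\times n$ matrix whose $(i,j)$ entry is $x_{g_ig_j^{ -1}}$. Define $\mathcal S(G)=\{\mathscr D_G(x_{g_1},\dots,x_{g_n}) : x_{g_i}\in\mathbb Z\}$.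
   Formalization: The formal theorem describes only the nonzero elements of S(Q12): 0 lies in S(Q12) (take all variables 0) but has none of the forms (i)–(iii), since m coprime to 6 is nonzero, so the hypothesis n ≠ 0 is added. -}

module Defs where

open import Data.Nat as ℕ using (ℕ; zero; suc)
open import Data.Nat.DivMod using (_mod_; _/_)
open import Data.Nat.Coprimality using (Coprime)
open import Data.Nat.Primality using (Prime)
open import Data.Fin as Fin using (Fin; toℕ; punchIn)
open import Data.Integer as ℤ using (ℤ; +_; -_; ∣_∣)
open import Data.Product using (_×_; _,_; ∃-syntax)
open import Data.Sum using (_⊎_)
open import Relation.Binary.PropositionalEquality using (_≡_)

sumFin : ∀ n → (Fin n → ℤ) → ℤ
sumFin zero    f = + 0
sumFin (suc n) f = f Fin.zero ℤ.+ sumFin n (λ i → f (Fin.suc i))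

sign : ℕ → ℤ
sign zero    = + 1
sign (suc k) = - sign k

det : ∀ n → (Fin n → Fin n → ℤ) → ℤ
det zero    M = + 1
det (suc n) M =
  sumFin (suc n) (λ j → sign (toℕ j) ℤ.* M Fin.zero j
                        ℤ.* det n (λ r c → M (Fin.suc r) (punchIn j c)))

-- Group determinant of a finite group given by an enumeration g : Fin n → G
-- (assumed bijective), multiplication and inversion:
-- det of the matrix (x_{g_i g_j^{-1}})_{i,j}.
groupDet : ∀ {G : Set} n → (Fin n → G) → (G → G → G) → (G → G) → (G → ℤ) → ℤ
groupDet n g _∙_ inv x = det n (λ i j → x (g i ∙ inv (g j)))

-- The dicyclic group Q12 = ⟨a,b : a^6 = 1, b^2 = a^3, ab = ba^{-1}⟩.
-- The pair (i , j) represents a^i b^j  (i ∈ Z/6, j ∈ {0,1}).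

Q12 : Set
Q12 = Fin 6 × Fin 2

Q12-mul : Q12 → Q12 → Q12
Q12-mul (i , Fin.zero)     (k , l)              = ((toℕ i ℕ.+ toℕ k) mod 6 , l)
Q12-mul (i , Fin.suc _)    (k , Fin.zero)       = ((toℕ i ℕ.+ (6 ℕ.∸ toℕ k)) mod 6 , Fin.suc Fin.zero)
Q12-mul (i , Fin.suc _)    (k , Fin.suc _)      = ((toℕ i ℕ.+ (6 ℕ.∸ toℕ k) ℕ.+ 3) mod 6 , Fin.zero)

Q12-inv : Q12 → Q12
Q12-inv (i , Fin.zero)  = ((6 ℕ.∸ toℕ i) mod 6 , Fin.zero)
Q12-inv (i , Fin.suc _) = ((toℕ i ℕ.+ 3) mod 6 , Fin.suc Fin.zero)

Q12-enum : Fin 12 → Q12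
Q12-enum k = (toℕ k mod 6 , (toℕ k / 6) mod 2)

InS-Q12 : ℤ → Set
InS-Q12 n = ∃[ x ] (groupDet 12 Q12-enum Q12-mul Q12-inv x ≡ n)

CoprimeTo6 : ℤ → Set
CoprimeTo6 m = Coprime ∣ m ∣ 6

pow : ℕ → ℕ → ℤ
pow p e = + (p ℕ.^ e)

FormI : ℤ → Set
FormI n = ∃[ m ] ∃[ a ] ∃[ b ] (CoprimeTo6 m
  × (a ≡ 0 ⊎ a ≡ 4 ⊎ 6 ℕ.≤ a)
  × (b ≡ 0 ⊎ 3 ℕ.≤ b)
  × n ≡ pow 2 a ℤ.* pow 3 b ℤ.* m)

FormII : ℤ → Set
FormII n = ∃[ m ] ∃[ b ] (CoprimeTo6 m
  × (b ≡ 4 ⊎ 6 ℕ.≤ b)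
  × n ≡ pow 2 5 ℤ.* pow 3 b ℤ.* m)

SpecialK : ℕ → Set
SpecialK k = ∃[ p ] (Prime p ×
  ((p ℕ.% 12 ≡ 5 × k ≡ p) ⊎ (p ℕ.% 6 ≡ 5 × k ≡ p ℕ.* p)))

FormIII : ℤ → Set
FormIII n = ∃[ m ] ∃[ b ] ∃[ k ] (CoprimeTo6 m
  × (b ≡ 0 ⊎ b ≡ 3 ⊎ b ≡ 5)
  × SpecialK k
  × n ≡ pow 2 5 ℤ.* pow 3 b ℤ.* m ℤ.* + k)

{-# OPTIONS --safe #-}
module Submission where

-- Write an element of ℤ[Q12] as f(a) + g(a) b. Decomposing the regular representation over ℚ gives
--   D = (f(1)² - g(1)²) (f(-1)² + g(-1)²) A² B²,  A = |f(ω)|² - |g(ω)|²,  B = |f(-ω)|² + |g(-ω)|²,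
-- with ω a primitive cube root of unity; call the first two factors N₁ and N₂. The congruences N₁ ≡ N₂ and A ≡ B
-- modulo 2 and N₁ ≡ A and N₂ ≡ B modulo 3 restrict the powers of 2 and 3 in D. When 2⁵ ∥ D and 3 ∤ N₂, the number N₂
-- is 2t or 8t with t odd and B is odd. If t ≡ 2 mod 3 then a prime p ≡ 5 mod 6 divides t, and p² divides the sum of two
-- squares N₂ unless p ≡ 5 mod 12; if t ≡ 1 mod 3 then B ≡ N₂ ≡ 2 mod 3, so p² divides B² for a prime p ≡ 5 mod 6.
--
-- Conversely N₁ takes all values of suitable arithmetic progressions while the other factors stay fixed. The primes p
-- enter through N₂ = 2p, where p ≡ 5 mod 12 is a sum of two squares (Zagier's involution), and through N₂ = 2, B = p,
-- where p ≡ 5 mod 6 is a sum of two norms from ℤ[ω] (pigeonhole and descent, as in Lagrange's four-square theorem).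

open import Defs
open import Data.Empty using (⊥)
open import Data.Nat as ℕ using (ℕ; zero; suc)
open import Data.Product using (_×_; _,_; ∃-syntax; proj₁; proj₂)
open import Data.Sum using (_⊎_; inj₁; inj₂; [_,_]′)
open import Function using (_∘_)
open import Relation.Binary.PropositionalEquality
open import Relation.Nullary using (¬_; yes; no; contradiction)

-- `det` is a cofactor expansion, so at size 12 it cannot be computed, even symbolically. The
-- factorisation is therefore obtained by similarity, from `P ⊗ M ≐ D ⊗ P` and `P ⊗ Q ≐ 12 δ`. This
-- needs the product rule for determinants, which is derived from the uniqueness of alternating
-- functions of the rows. The relation with `P` is linear in the twelve variables, so it reduces to
-- finitely many identities between integers. The congruences hold because f(x) and f(-x) have the
-- same coefficients modulo 2, and because 1 and ω agree modulo the prime 1 - ω above 3. Modulo x³ -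
-- 1 the condition at 2 is the only one: any triples that agree modulo 2 come from some f and g.
-- Adding a multiple of 1 + x + x² to a triple moves its value at 1 and fixes its value at ω, which
-- produces the arithmetic progressions of N₁ with A unchanged.

module Determinants where

  open import Data.Fin using (Fin; zero; suc; toℕ; punchIn)
  open import Data.Fin.Properties using (suc-injective)
  open import Data.Integer using (ℤ; +_; -_; _+_; _*_; _^_; ≢-nonZero)
  open import Data.Integer.Properties
  open import Data.Integer.Tactic.RingSolver using (solve-∀)
  open import Data.Vec.Functional using (_∷_; insertAt; updateAt)
  open import Data.Vec.Functional.Properties using (updateAt-updates; updateAt-minimal)
  open ≡-Reasoning

  -- Linearity and reordering of finite sums.

  sum-cong : ∀ n {f g : Fin n → ℤ} → f ≗ g → sumFin n f ≡ sumFin n g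
  sum-cong zero    f≗g = refl
  sum-cong (suc n) f≗g = cong₂ _+_ (f≗g zero) (sum-cong n (f≗g ∘ suc))

  sum-0 : ∀ n {f : Fin n → ℤ} → (∀ i → f i ≡ + 0) → sumFin n f ≡ + 0
  sum-0 zero    f≗0 = refl
  sum-0 (suc n) f≗0 = cong₂ _+_ (f≗0 zero) (sum-0 n (f≗0 ∘ suc))

  sum-+ : ∀ n (f g : Fin n → ℤ) → sumFin n (λ i → f i + g i) ≡ sumFin n f + sumFin n g
  sum-+ zero    f g = refl
  sum-+ (suc n) f g = trans (cong (_+_ (f zero + g zero)) (sum-+ n (f ∘ suc) (g ∘ suc)))
    (interchange (f zero) (g zero) (sumFin n (f ∘ suc)) (sumFin n (g ∘ suc)))
    where
    interchange : ∀ a b c d → a + b + (c + d) ≡ a + c + (b + d)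
    interchange = solve-∀

  sum-*ˡ : ∀ n k (f : Fin n → ℤ) → sumFin n (λ i → k * f i) ≡ k * sumFin n f
  sum-*ˡ zero    k f = sym (*-zeroʳ k)
  sum-*ˡ (suc n) k f = trans (cong (_+_ (k * f zero)) (sum-*ˡ n k (f ∘ suc)))
    (sym (*-distribˡ-+ k (f zero) (sumFin n (f ∘ suc))))

  sum-*ʳ : ∀ n k (f : Fin n → ℤ) → sumFin n (λ i → f i * k) ≡ sumFin n f * k
  sum-*ʳ n k f = begin
    sumFin n (λ i → f i * k) ≡⟨ sum-cong n (λ i → *-comm (f i) k) ⟩
    sumFin n (λ i → k * f i) ≡⟨ sum-*ˡ n k f ⟩
    k * sumFin n f           ≡⟨ *-comm k _ ⟩
    sumFin n f * k           ∎

  sum-swap : ∀ m n (f : Fin m → Fin n → ℤ) →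
    sumFin m (λ i → sumFin n (f i)) ≡ sumFin n (λ j → sumFin m (λ i → f i j))
  sum-swap zero    n f = sym (sum-0 n (λ _ → refl))
  sum-swap (suc m) n f = trans (cong (_+_ (sumFin n (f zero))) (sum-swap m n (f ∘ suc)))
    (sym (sum-+ n (f zero) (λ j → sumFin m (λ i → f (suc i) j))))

  sum-+* : ∀ n k (f g : Fin n → ℤ) →
    sumFin n (λ i → f i + k * g i) ≡ sumFin n f + k * sumFin n g
  sum-+* n k f g = trans (sum-+ n f (λ i → k * g i)) (cong (_+_ (sumFin n f)) (sum-*ˡ n k g))

  -- Alternating functions of the rows, and their uniqueness up to a factor.

  Mat : ℕ → ℕ → Set
  Mat n m = Fin n → Fin m → ℤ

  infix 4 _≐_
  _≐_ : ∀ {n m} → Mat n m → Mat n m → Set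
  A ≐ B = ∀ i j → A i j ≡ B i j

  record RowComb {n m} (i : Fin n) (k : ℤ) (A B C : Mat n m) : Set where
    field
      here   : ∀ c → C i c ≡ A i c + k * B i c
      thereᴬ : ∀ r → r ≢ i → ∀ c → C r c ≡ A r c
      thereᴮ : ∀ r → r ≢ i → ∀ c → C r c ≡ B r c

  record Alternating {n m} (f : Mat n m → ℤ) : Set where
    field
      ext    : ∀ {A B} → A ≐ B → f A ≡ f B
      linear : ∀ {i k A B C} → RowComb i k A B C → f C ≡ f A + k * f B
      repeat : ∀ {i j A} → i ≢ j → A i ≗ A j → f A ≡ + 0

  suc≢ : ∀ {n} {i j : Fin n} → i ≢ j → Fin.suc i ≢ suc j
  suc≢ i≢j = i≢j ∘ suc-injective

  ∷-tail : ∀ {n m} {u v : Fin m → ℤ} {A B : Mat n m} → u ≗ v → A ≐ B →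
    (u ∷ A) ≐ (v ∷ B)
  ∷-tail u≗v A≐B zero    = u≗v
  ∷-tail u≗v A≐B (suc r) = A≐B r

  ∷-η : ∀ {n m} (A : Mat (suc n) m) → A ≐ (A zero ∷ A ∘ suc)
  ∷-η A zero    c = refl
  ∷-η A (suc r) c = refl

  RowComb-∷ : ∀ {n m i k} {A B C : Mat n m} (u : Fin m → ℤ) →
    RowComb i k A B C → RowComb (suc i) k (u ∷ A) (u ∷ B) (u ∷ C)
  RowComb-∷ u R = record
    { here   = here
    ; thereᴬ = λ { zero _ c → refl ; (suc r) r≢ → thereᴬ r (r≢ ∘ cong suc) }
    ; thereᴮ = λ { zero _ c → refl ; (suc r) r≢ → thereᴮ r (r≢ ∘ cong suc) }
    }
    where open RowComb R

  Alternating-∷ : ∀ {n m} {f : Mat (suc n) m → ℤ} (u : Fin m → ℤ) →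
    Alternating f → Alternating (λ A → f (u ∷ A))
  Alternating-∷ u alt = record
    { ext    = λ A≐B → ext (∷-tail (λ _ → refl) A≐B)
    ; linear = λ R → linear (RowComb-∷ u R)
    ; repeat = λ i≢j → repeat (suc≢ i≢j)
    }
    where open Alternating alt

  module _ {n m} {f : Mat (suc n) m → ℤ} (alt : Alternating f) where
    open Alternating alt

    head-linear : ∀ u v k (A : Mat n m) →
      f ((λ c → u c + k * v c) ∷ A) ≡ f (u ∷ A) + k * f (v ∷ A)
    head-linear u v k A = linear {zero} {k} {u ∷ A} {v ∷ A} record
      { here   = λ _ → refl
      ; thereᴬ = λ { zero 0≢0 → contradiction refl 0≢0 ; (suc r) _ c → refl }
      ; thereᴮ = λ { zero 0≢0 → contradiction refl 0≢0 ; (suc r) _ c → refl }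
      }

    -- Since 0 + 1 · 0 computes to 0, linearity gives z = z + 1 · z.
    head-0 : ∀ (A : Mat n m) → f ((λ _ → + 0) ∷ A) ≡ + 0
    head-0 A = begin
      z                       ≡⟨ shift z ⟩
      (z + + 1 * z) + - z     ≡⟨ cong (_+ - z) (sym (head-linear _ _ (+ 1) A)) ⟩
      z + - z                 ≡⟨ +-inverseʳ z ⟩
      + 0                     ∎
      where
      z = f ((λ _ → + 0) ∷ A)
      shift : ∀ z → z ≡ (z + + 1 * z) + - z
      shift = solve-∀

    head-sum : ∀ p (a : Fin p → ℤ) (e : Mat p m) (A : Mat n m) →
      f ((λ c → sumFin p (λ j → a j * e j c)) ∷ A) ≡ sumFin p (λ j → a j * f (e j ∷ A))
    head-sum zero    a e A = head-0 A
    head-sum (suc p) a e A = begin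
      f ((λ c → a zero * e zero c + rest c) ∷ A)
        ≡⟨ ext (∷-tail (λ c → +-comm (a zero * e zero c) (rest c)) (λ _ _ → refl)) ⟩
      f ((λ c → rest c + a zero * e zero c) ∷ A)
        ≡⟨ head-linear rest (e zero) (a zero) A ⟩
      f (rest ∷ A) + a zero * f (e zero ∷ A)
        ≡⟨ +-comm (f (rest ∷ A)) _ ⟩
      a zero * f (e zero ∷ A) + f (rest ∷ A)
        ≡⟨ cong (_+_ (a zero * f (e zero ∷ A))) (head-sum p (a ∘ suc) (e ∘ suc) A) ⟩
      sumFin (suc p) (λ j → a j * f (e j ∷ A)) ∎
      where rest = λ c → sumFin p (λ j → a (suc j) * e (suc j) c)

  -- Polarisation: with `w` = u + v, expand the vanishing value at the rows `w`, `w` and drop the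
  -- values at `u`, `u` and at `v`, `v`.
  swap₀₁ : ∀ {n m} {f : Mat (suc (suc n)) m → ℤ} → Alternating f →
    ∀ u v (A : Mat n m) → f (u ∷ v ∷ A) ≡ - f (v ∷ u ∷ A)
  swap₀₁ {f = f} alt u v A = solve-for (f (u ∷ v ∷ A)) (f (v ∷ u ∷ A)) (begin
    f (u ∷ v ∷ A) + + 1 * f (v ∷ u ∷ A)
      ≡⟨ cong₂ (λ x y → x + + 1 * y) (sym expand-u) (sym expand-v) ⟩
    f (u ∷ w ∷ A) + + 1 * f (v ∷ w ∷ A)
      ≡⟨ sym (head-linear alt u v (+ 1) (w ∷ A)) ⟩
    f (w ∷ w ∷ A)
      ≡⟨ equal-rows w ⟩
    + 0 ∎)
    where
    open Alternating alt
    w = λ c → u c + + 1 * v c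
    solve-for : ∀ x y → x + + 1 * y ≡ + 0 → x ≡ - y
    solve-for x y eq = begin
      x                       ≡⟨ shift x y ⟩
      (x + + 1 * y) + - y     ≡⟨ cong (_+ - y) eq ⟩
      + 0 + - y               ≡⟨ +-identityˡ (- y) ⟩
      - y                     ∎
      where
      shift : ∀ x y → x ≡ (x + + 1 * y) + - y
      shift = solve-∀
    equal-rows : ∀ t → f (t ∷ t ∷ A) ≡ + 0
    equal-rows t = repeat {i = zero} {j = suc zero} (λ ()) (λ _ → refl)
    expand-u : f (u ∷ w ∷ A) ≡ f (u ∷ v ∷ A)
    expand-u = begin
      f (u ∷ w ∷ A)                         ≡⟨ head-linear (Alternating-∷ u alt) u v (+ 1) A ⟩
      f (u ∷ u ∷ A) + + 1 * f (u ∷ v ∷ A)   ≡⟨ cong₂ _+_ (equal-rows u) (*-identityˡ _) ⟩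
      + 0 + f (u ∷ v ∷ A)                   ≡⟨ +-identityˡ _ ⟩
      f (u ∷ v ∷ A)                         ∎
    expand-v : f (v ∷ w ∷ A) ≡ f (v ∷ u ∷ A)
    expand-v = begin
      f (v ∷ w ∷ A)                         ≡⟨ head-linear (Alternating-∷ v alt) u v (+ 1) A ⟩
      f (v ∷ u ∷ A) + + 1 * f (v ∷ v ∷ A)   ≡⟨ cong (λ z → f (v ∷ u ∷ A) + + 1 * z) (equal-rows v) ⟩
      f (v ∷ u ∷ A) + + 0                   ≡⟨ +-identityʳ _ ⟩
      f (v ∷ u ∷ A)                         ∎

  -- Row `j` rises by `j` exchanges of neighbours, each of which changes the sign.
  move-to-top : ∀ {n m} {f : Mat (suc n) m → ℤ} → Alternating f → ∀ (A : Mat (suc n) m) j →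
    f (A j ∷ A ∘ punchIn j) ≡ sign (toℕ j) * f A
  move-to-top {f = f} alt A zero =
    trans (Alternating.ext alt (λ r c → sym (∷-η A r c))) (sym (*-identityˡ (f A)))
  move-to-top {suc n} {f = f} alt A (suc j) = begin
    f (A (suc j) ∷ A ∘ punchIn (suc j))
      ≡⟨ ext (∷-tail (λ _ → refl) (∷-η (A ∘ punchIn (suc j)))) ⟩
    f (A (suc j) ∷ A zero ∷ A ∘ suc ∘ punchIn j)
      ≡⟨ swap₀₁ alt _ _ _ ⟩
    - f (A zero ∷ A (suc j) ∷ A ∘ suc ∘ punchIn j)
      ≡⟨ cong -_ (move-to-top (Alternating-∷ (A zero) alt) (A ∘ suc) j) ⟩
    - (sign (toℕ j) * f (A zero ∷ A ∘ suc))
      ≡⟨ cong (λ z → - (sign (toℕ j) * z)) (sym (ext (∷-η A))) ⟩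
    - (sign (toℕ j) * f A)
      ≡⟨ neg-distribˡ-* (sign (toℕ j)) (f A) ⟩
    - sign (toℕ j) * f A ∎
    where open Alternating alt

  -- Rows are replaced one at a time. The hypothesis on a single row leaves the other rows of `C`
  -- and `D` arbitrary, because by the time row `i` is treated the rows above it already come from
  -- `B`.
  replace-rows : ∀ {n m} (f : Mat n m → ℤ) (A B : Mat n m) →
    (∀ {C D} → C ≐ D → f C ≡ f D) →
    (∀ i {C D} → C i ≗ A i → D i ≗ B i → (∀ r → r ≢ i → C r ≗ D r) → f C ≡ f D) →
    f A ≡ f B
  replace-rows {zero}  f A B ext step = ext (λ ())
  replace-rows {suc n} f A B ext step = begin
    f A                      ≡⟨ step zero (λ _ → refl) (λ _ → refl) there₀ ⟩
    f (B zero ∷ A ∘ suc)     ≡⟨ replace-rows (λ C → f (B zero ∷ C)) (A ∘ suc) (B ∘ suc)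
                                  (λ C≐D → ext (∷-tail (λ _ → refl) C≐D))
                                  (λ i hereᶜ hereᵈ there → step (suc i) hereᶜ hereᵈ
                                    λ { zero _ _ → refl ; (suc r) r≢ → there r (r≢ ∘ cong suc) }) ⟩
    f (B zero ∷ B ∘ suc)     ≡⟨ ext (λ r c → sym (∷-η B r c)) ⟩
    f B                      ∎
    where
    there₀ : ∀ r → r ≢ zero → A r ≗ (B zero ∷ A ∘ suc) r
    there₀ zero    0≢0 = contradiction refl 0≢0
    there₀ (suc r) _ _ = refl

  δ : ∀ {n} → Mat n n
  δ zero    zero    = + 1
  δ zero    (suc _) = + 0
  δ (suc _) zero    = + 0
  δ (suc i) (suc j) = δ i j

  sum-δ : ∀ n (a : Fin n → ℤ) c → sumFin n (λ j → a j * δ j c) ≡ a c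
  sum-δ (suc n) a zero = begin
    a zero * + 1 + sumFin n (λ j → a (suc j) * + 0)
      ≡⟨ cong₂ _+_ (*-identityʳ (a zero)) (sum-0 n (λ j → *-zeroʳ (a (suc j)))) ⟩
    a zero + + 0
      ≡⟨ +-identityʳ (a zero) ⟩
    a zero ∎
  sum-δ (suc n) a (suc c) = begin
    a zero * + 0 + sumFin n (λ j → a (suc j) * δ j c)
      ≡⟨ cong₂ _+_ (*-zeroʳ (a zero)) (sum-δ n (a ∘ suc) c) ⟩
    + 0 + a (suc c)
      ≡⟨ +-identityˡ _ ⟩
    a (suc c) ∎

  sum-δˡ : ∀ n i (a : Fin n → ℤ) → sumFin n (λ j → δ i j * a j) ≡ a i
  sum-δˡ (suc n) zero a = begin
    + 1 * a zero + sumFin n (λ j → + 0 * a (suc j))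
      ≡⟨ cong₂ _+_ (*-identityˡ (a zero)) (sum-0 n (λ j → *-zeroˡ (a (suc j)))) ⟩
    a zero + + 0
      ≡⟨ +-identityʳ (a zero) ⟩
    a zero ∎
  sum-δˡ (suc n) (suc i) a = begin
    + 0 * a zero + sumFin n (λ j → δ i j * a (suc j))
      ≡⟨ cong₂ _+_ (*-zeroˡ (a zero)) (sum-δˡ n i (a ∘ suc)) ⟩
    + 0 + a (suc i)
      ≡⟨ +-identityˡ _ ⟩
    a (suc i) ∎

  δ-punchIn : ∀ {n} j (r : Fin n) → δ (punchIn j r) ≗ insertAt (δ r) j (+ 0)
  δ-punchIn zero    r       zero    = refl
  δ-punchIn zero    r       (suc c) = refl
  δ-punchIn (suc j) zero    zero    = refl
  δ-punchIn (suc j) zero    (suc c) = sym (insertAt-0 j c)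
    where
    insertAt-0 : ∀ {n} (j : Fin (suc n)) → insertAt (λ _ → + 0) j (+ 0) ≗ (λ _ → + 0)
    insertAt-0 {zero}  zero    zero    = refl
    insertAt-0 {suc n} zero    zero    = refl
    insertAt-0 {suc n} zero    (suc c) = refl
    insertAt-0 {suc n} (suc j) zero    = refl
    insertAt-0 {suc n} (suc j) (suc c) = insertAt-0 j c
  δ-punchIn (suc j) (suc r) zero    = refl
  δ-punchIn (suc j) (suc r) (suc c) = δ-punchIn j r c

  insertAt-cong : ∀ {n} (j : Fin (suc n)) {u v : Fin n → ℤ} → u ≗ v →
    insertAt u j (+ 0) ≗ insertAt v j (+ 0)
  insertAt-cong zero            u≗v zero    = refl
  insertAt-cong zero            u≗v (suc c) = u≗v c
  insertAt-cong {suc n} (suc j) u≗v zero    = u≗v zero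
  insertAt-cong {suc n} (suc j) u≗v (suc c) = insertAt-cong j (u≗v ∘ suc) c

  insertAt-linear : ∀ {n} (j : Fin (suc n)) k {u v w : Fin n → ℤ} →
    (∀ c → w c ≡ u c + k * v c) →
    ∀ c → insertAt w j (+ 0) c ≡ insertAt u j (+ 0) c + k * insertAt v j (+ 0) c
  insertAt-linear zero            k eq zero    = sym (trans (+-identityˡ _) (*-zeroʳ k))
  insertAt-linear zero            k eq (suc c) = eq c
  insertAt-linear {suc n} (suc j) k eq zero    = eq zero
  insertAt-linear {suc n} (suc j) k eq (suc c) = insertAt-linear j k (eq ∘ suc) c

  split-entry : ∀ {n} j (u : Fin (suc n) → ℤ) c →
    u c ≡ insertAt (u ∘ punchIn j) j (+ 0) c + u j * δ j c
  split-entry zero u zero = sym (trans (+-identityˡ _) (*-identityʳ (u zero)))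
  split-entry zero u (suc c) =
    sym (trans (cong (_+_ (u (suc c))) (*-zeroʳ (u zero))) (+-identityʳ _))
  split-entry {suc n} (suc j) u zero =
    sym (trans (cong (_+_ (u zero)) (*-zeroʳ (u (suc j)))) (+-identityʳ _))
  split-entry {suc n} (suc j) u (suc c) = split-entry j (u ∘ suc) c

  -- Makes the induction hypothesis of `alternating-det` applicable to the minor left over after the
  -- first row has become `δ j` and column `j` has been cleared.
  Alternating-minor : ∀ {n m} {f : Mat (suc n) (suc m) → ℤ} (j : Fin (suc m)) → Alternating f →
    Alternating {n} {m} (λ A → f (δ j ∷ λ r → insertAt (A r) j (+ 0)))
  Alternating-minor j alt = record
    { ext    = λ A≐B → ext (∷-tail (λ _ → refl) (λ r → insertAt-cong j (A≐B r)))
    ; linear = λ {i} {k} R → let open RowComb R in linear {suc i} {k} (RowComb-∷ (δ j) record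
        { here   = insertAt-linear j k here
        ; thereᴬ = λ r r≢i → insertAt-cong j (thereᴬ r r≢i)
        ; thereᴮ = λ r r≢i → insertAt-cong j (thereᴮ r r≢i)
        })
    ; repeat = λ i≢j Aᵢ≗Aⱼ → repeat (suc≢ i≢j) (insertAt-cong j Aᵢ≗Aⱼ)
    }
    where open Alternating alt

  -- Expand the first row in unit vectors. Below a first row `δ j`, column `j` can be cleared by row
  -- operations; the induction hypothesis then extracts the minor, and moving row `j` of the
  -- identity to the top gives the cofactor sign.
  alternating-det : ∀ n (f : Mat n n → ℤ) → Alternating f → ∀ A → f A ≡ det n A * f δ
  alternating-det zero    f alt A = trans (Alternating.ext alt (λ ())) (sym (*-identityˡ (f δ)))
  alternating-det (suc n) f alt A = begin
    f A
      ≡⟨ ext (∷-η A) ⟩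
    f (A zero ∷ A ∘ suc)
      ≡⟨ ext (∷-tail (λ c → sym (sum-δ (suc n) (A zero) c)) (λ _ _ → refl)) ⟩
    f ((λ c → sumFin (suc n) (λ j → A zero j * δ j c)) ∷ A ∘ suc)
      ≡⟨ head-sum alt (suc n) (A zero) δ (A ∘ suc) ⟩
    sumFin (suc n) (λ j → A zero j * f (δ j ∷ A ∘ suc))
      ≡⟨ sum-cong (suc n) (λ j → cong (A zero j *_) (column j)) ⟩
    sumFin (suc n) (λ j → A zero j * (det n (minor j) * (sign (toℕ j) * f δ)))
      ≡⟨ sum-cong (suc n) (λ j → reorder (A zero j) (det n (minor j)) (sign (toℕ j)) (f δ)) ⟩
    sumFin (suc n) (λ j → sign (toℕ j) * A zero j * det n (minor j) * f δ)
      ≡⟨ sum-*ʳ (suc n) (f δ) (λ j → sign (toℕ j) * A zero j * det n (minor j)) ⟩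
    det (suc n) A * f δ ∎
    where
    open Alternating alt
    minor : Fin (suc n) → Mat n n
    minor j r c = A (suc r) (punchIn j c)
    reorder : ∀ a b c d → a * (b * (c * d)) ≡ c * a * b * d
    reorder = solve-∀
    column : ∀ j → f (δ j ∷ A ∘ suc) ≡ det n (minor j) * (sign (toℕ j) * f δ)
    column j = begin
      f (δ j ∷ A ∘ suc)
        ≡⟨ replace-rows (λ C → f (δ j ∷ C)) (A ∘ suc) (λ r → insertAt (minor j r) j (+ 0))
             (λ C≐D → ext (∷-tail (λ _ → refl) C≐D)) clear ⟩
      f (δ j ∷ λ r → insertAt (minor j r) j (+ 0))
        ≡⟨ alternating-det n _ (Alternating-minor j alt) (minor j) ⟩
      det n (minor j) * f (δ j ∷ λ r → insertAt (δ r) j (+ 0))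
        ≡⟨ cong (det n (minor j) *_) (ext (∷-tail (λ _ → refl) (λ r c → sym (δ-punchIn j r c)))) ⟩
      det n (minor j) * f (δ j ∷ δ ∘ punchIn j)
        ≡⟨ cong (det n (minor j) *_) (move-to-top alt δ j) ⟩
      det n (minor j) * (sign (toℕ j) * f δ) ∎
      where
      clear : ∀ i {C D : Mat n (suc n)} → C i ≗ A (suc i) → D i ≗ insertAt (minor j i) j (+ 0) →
        (∀ r → r ≢ i → C r ≗ D r) → f (δ j ∷ C) ≡ f (δ j ∷ D)
      clear i {C} {D} Cᵢ≗ Dᵢ≗ there = begin
        f (δ j ∷ C)
          ≡⟨ linear {i = suc i} {k = A (suc i) j} {A = δ j ∷ D} {B = δ j ∷ E} {C = δ j ∷ C}
               (RowComb-∷ (δ j) record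
                 { here = λ c → trans (Cᵢ≗ c) (trans (split-entry j (A (suc i)) c)
                     (cong₂ _+_ (sym (Dᵢ≗ c)) (cong (A (suc i) j *_) (sym (E-here c)))))
                 ; thereᴬ = there
                 ; thereᴮ = λ r r≢i c → trans (there r r≢i c) (sym (E-there r r≢i c))
                 }) ⟩
        f (δ j ∷ D) + A (suc i) j * f (δ j ∷ E)
          ≡⟨ cong (λ z → f (δ j ∷ D) + A (suc i) j * z)
               (repeat {i = suc i} {j = zero} (λ ()) E-here) ⟩
        f (δ j ∷ D) + A (suc i) j * + 0
          ≡⟨ cong (_+_ (f (δ j ∷ D))) (*-zeroʳ (A (suc i) j)) ⟩
        f (δ j ∷ D) + + 0
          ≡⟨ +-identityʳ _ ⟩
        f (δ j ∷ D) ∎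
        where
        -- `E` carries the multiple of `δ j` by which row `i` of `C` exceeds that of `D`. It repeats
        -- the top row, so its term vanishes.
        E : Mat n (suc n)
        E = updateAt D i (λ _ → δ j)
        E-here : E i ≗ δ j
        E-here c = cong-app (updateAt-updates i D) c
        E-there : ∀ r → r ≢ i → E r ≗ D r
        E-there r r≢i c = cong-app (updateAt-minimal r i D r≢i) c

  -- Sum over ordered pairs of distinct columns (j , punchIn j k): exchanging a and b pairs the terms
  -- with opposite signs.
  double-sum : ∀ n (a b : Fin (suc (suc n)) → ℤ) → ((Fin n → Fin (suc (suc n))) → ℤ) → ℤ
  double-sum n a b H = sumFin (suc (suc n)) (λ j → sign (toℕ j) * a j *
    sumFin (suc n) (λ k → sign (toℕ k) * b (punchIn j k) * H (λ c → punchIn j (punchIn k c))))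

  lift : ∀ {m n} → (Fin m → Fin n) → Fin (suc m) → Fin (suc n)
  lift φ zero    = zero
  lift φ (suc c) = suc (φ c)

  -- Separate the pairs in which column 0 comes first (`top`) or second (`bottom`). Exchanging `a`
  -- and `b` turns one kind into the negative of the other. The pairs that avoid column 0 form the
  -- same kind of sum for a smaller `n`, with `H` composed with `lift`; the two column maps then
  -- agree only pointwise, hence the extensionality hypothesis.
  double-sum-antisym : ∀ n a b (H : (Fin n → Fin (suc (suc n))) → ℤ) →
    (∀ {φ ψ} → φ ≗ ψ → H φ ≡ H ψ) → double-sum n a b H + double-sum n b a H ≡ + 0
  double-sum-antisym n a b H H-ext = begin
    double-sum n a b H + double-sum n b a H
      ≡⟨ cong₂ _+_ (split a b) (split b a) ⟩
    (top a b + (bottom a b + rest n H a b)) + (top b a + (bottom b a + rest n H b a))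
      ≡⟨ cong₂ (λ x y → (top a b + (x + rest n H a b)) + (top b a + (y + rest n H b a)))
           (bottom≡-top a b) (bottom≡-top b a) ⟩
    (top a b + (- top b a + rest n H a b)) + (top b a + (- top a b + rest n H b a))
      ≡⟨ cancel (top a b) (top b a) (rest n H a b) (rest n H b a) ⟩
    rest n H a b + rest n H b a
      ≡⟨ rest-antisym n a b H H-ext ⟩
    + 0 ∎
    where
    top bottom : (a b : Fin (suc (suc n)) → ℤ) → ℤ
    top a b = + 1 * a zero * sumFin (suc n) (λ k → sign (toℕ k) * b (suc k) * H (λ c → suc (punchIn k c)))
    bottom a b = sumFin (suc n) (λ j → - sign (toℕ j) * a (suc j) * (+ 1 * b zero * H (λ c → suc (punchIn j c))))
    rest : ∀ n → ((Fin n → Fin (suc (suc n))) → ℤ) → (a b : Fin (suc (suc n)) → ℤ) → ℤ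
    rest n H a b = sumFin (suc n) (λ j → - sign (toℕ j) * a (suc j) *
      sumFin n (λ k → - sign (toℕ k) * b (suc (punchIn j k)) *
        H (λ c → punchIn (suc j) (punchIn (suc k) c))))
    split : ∀ a b → double-sum n a b H ≡ top a b + (bottom a b + rest n H a b)
    split a b = cong (_+_ (top a b)) (trans
      (sum-cong (suc n) (λ j → *-distribˡ-+ (coeff j) (first j) (others j)))
      (sum-+ (suc n) (λ j → coeff j * first j) (λ j → coeff j * others j)))
      where
      coeff first others : Fin (suc n) → ℤ
      coeff j = - sign (toℕ j) * a (suc j)
      first j = + 1 * b zero * H (λ c → suc (punchIn j c))
      others j = sumFin n (λ k → - sign (toℕ k) * b (suc (punchIn j k)) *
        H (λ c → punchIn (suc j) (punchIn (suc k) c)))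
    bottom≡-top : ∀ a b → bottom a b ≡ - top b a
    bottom≡-top a b = begin
      bottom a b
        ≡⟨ sum-cong (suc n) (λ j → shuffle (sign (toℕ j)) (a (suc j)) (b zero) (H (λ c → suc (punchIn j c)))) ⟩
      sumFin (suc n) (λ j → - b zero * (sign (toℕ j) * a (suc j) * H (λ c → suc (punchIn j c))))
        ≡⟨ sum-*ˡ (suc n) (- b zero) (λ j → sign (toℕ j) * a (suc j) * H (λ c → suc (punchIn j c))) ⟩
      - b zero * sumFin (suc n) (λ j → sign (toℕ j) * a (suc j) * H (λ c → suc (punchIn j c)))
        ≡⟨ negate (b zero) _ ⟩
      - top b a ∎
      where
      shuffle : ∀ s x y h → - s * x * (+ 1 * y * h) ≡ - y * (s * x * h)
      shuffle = solve-∀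
      negate : ∀ y s → - y * s ≡ - (+ 1 * y * s)
      negate = solve-∀
    cancel : ∀ x y r s → (x + (- y + r)) + (y + (- x + s)) ≡ r + s
    cancel = solve-∀
    rest-antisym : ∀ n a b H → (∀ {φ ψ} → φ ≗ ψ → H φ ≡ H ψ) → rest n H a b + rest n H b a ≡ + 0
    rest-antisym zero a b H H-ext = cong₂ _+_ (vanish a b) (vanish b a)
      where
      vanish : ∀ a b → rest zero H a b ≡ + 0
      vanish a b = sum-0 1 (λ j → *-zeroʳ (- sign (toℕ j) * a (suc j)))
    rest-antisym (suc n) a b H H-ext = trans (cong₂ _+_ (reduce a b) (reduce b a))
      (double-sum-antisym n (a ∘ suc) (b ∘ suc) (H ∘ lift) (λ φ≗ψ → H-ext (lift-cong φ≗ψ)))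
      where
      lift-cong : ∀ {m n} {φ ψ : Fin m → Fin n} → φ ≗ ψ → lift φ ≗ lift ψ
      lift-cong φ≗ψ zero    = refl
      lift-cong φ≗ψ (suc c) = cong suc (φ≗ψ c)
      lift-punchIn : ∀ (j : Fin (suc (suc n))) (k : Fin (suc n)) → (λ c → punchIn (suc j) (punchIn (suc k) c)) ≗
        lift (λ (c : Fin n) → punchIn j (punchIn k c))
      lift-punchIn j k zero    = refl
      lift-punchIn j k (suc c) = refl
      reduce : ∀ a b → rest (suc n) H a b ≡ double-sum n (a ∘ suc) (b ∘ suc) (H ∘ lift)
      reduce a b = sum-cong (suc (suc n)) (λ j → begin
        - sign (toℕ j) * a (suc j) * sumFin (suc n) (λ k → - sign (toℕ k) * b (suc (punchIn j k)) *
          H (λ c → punchIn (suc j) (punchIn (suc k) c)))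
          ≡⟨ cong (- sign (toℕ j) * a (suc j) *_) (sum-cong (suc n) (λ k → trans
               (cong (- sign (toℕ k) * b (suc (punchIn j k)) *_) (H-ext (lift-punchIn j k)))
               (signs (sign (toℕ k)) (b (suc (punchIn j k))) (H (lift (λ c → punchIn j (punchIn k c))))))) ⟩
        - sign (toℕ j) * a (suc j) * sumFin (suc n) (λ k → - + 1 * summand j k)
          ≡⟨ cong (- sign (toℕ j) * a (suc j) *_) (sum-*ˡ (suc n) (- + 1) (summand j)) ⟩
        - sign (toℕ j) * a (suc j) * (- + 1 * sumFin (suc n) (summand j))
          ≡⟨ signs₂ (sign (toℕ j)) (a (suc j)) (sumFin (suc n) (summand j)) ⟩
        sign (toℕ j) * a (suc j) * sumFin (suc n) (summand j) ∎)
        where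
        summand : Fin (suc (suc n)) → Fin (suc n) → ℤ
        summand j k = sign (toℕ k) * b (suc (punchIn j k)) * H (lift (λ c → punchIn j (punchIn k c)))
        signs : ∀ s x h → - s * x * h ≡ - + 1 * (s * x * h)
        signs = solve-∀
        signs₂ : ∀ s x h → - s * x * (- + 1 * h) ≡ s * x * h
        signs₂ = solve-∀

  -- The cofactor determinant is alternating and multiplicative.

  det-cong : ∀ n {A B : Mat n n} → A ≐ B → det n A ≡ det n B
  det-cong zero    A≐B = refl
  det-cong (suc n) A≐B = sum-cong (suc n) (λ j → cong₂ _*_
    (cong (sign (toℕ j) *_) (A≐B zero j)) (det-cong n (λ r c → A≐B (suc r) (punchIn j c))))

  det-linear : ∀ n {i k} {A B C : Mat n n} → RowComb i k A B C → det n C ≡ det n A + k * det n B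
  det-linear (suc n) {zero} {k} {A} {B} {C} R = trans
    (sum-cong (suc n) (λ j → begin
      sign (toℕ j) * C zero j * minor C j
        ≡⟨ cong (λ z → sign (toℕ j) * z * minor C j) (here j) ⟩
      sign (toℕ j) * (A zero j + k * B zero j) * minor C j
        ≡⟨ distrib (sign (toℕ j)) (A zero j) k (B zero j) (minor C j) ⟩
      sign (toℕ j) * A zero j * minor C j + k * (sign (toℕ j) * B zero j * minor C j)
        ≡⟨ cong₂ (λ x y → sign (toℕ j) * A zero j * x + k * (sign (toℕ j) * B zero j * y))
             (det-cong n (λ r c → thereᴬ (suc r) (λ ()) (punchIn j c)))
             (det-cong n (λ r c → thereᴮ (suc r) (λ ()) (punchIn j c))) ⟩
      sign (toℕ j) * A zero j * minor A j + k * (sign (toℕ j) * B zero j * minor B j) ∎))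
    (sum-+* (suc n) k (term A) (term B))
    where
    open RowComb R
    cut : Mat (suc n) (suc n) → Fin (suc n) → Mat n n
    cut M j r c = M (suc r) (punchIn j c)
    minor : Mat (suc n) (suc n) → Fin (suc n) → ℤ
    minor M j = det n (cut M j)
    term : Mat (suc n) (suc n) → Fin (suc n) → ℤ
    term M j = sign (toℕ j) * M zero j * minor M j
    distrib : ∀ s x k y d → s * (x + k * y) * d ≡ s * x * d + k * (s * y * d)
    distrib = solve-∀
  det-linear (suc n) {suc i} {k} {A} {B} {C} R = trans
    (sum-cong (suc n) (λ j → begin
      sign (toℕ j) * C zero j * minor C j
        ≡⟨ cong (sign (toℕ j) * C zero j *_) (det-linear n {i} {k} {cut A j} {cut B j} record
             { here   = λ c → here (punchIn j c)
             ; thereᴬ = λ r r≢i c → thereᴬ (suc r) (suc≢ r≢i) (punchIn j c)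
             ; thereᴮ = λ r r≢i c → thereᴮ (suc r) (suc≢ r≢i) (punchIn j c)
             }) ⟩
      sign (toℕ j) * C zero j * (minor A j + k * minor B j)
        ≡⟨ distrib (sign (toℕ j)) (C zero j) (minor A j) k (minor B j) ⟩
      sign (toℕ j) * C zero j * minor A j + k * (sign (toℕ j) * C zero j * minor B j)
        ≡⟨ cong₂ (λ x y → sign (toℕ j) * x * minor A j + k * (sign (toℕ j) * y * minor B j))
             (thereᴬ zero (λ ()) j) (thereᴮ zero (λ ()) j) ⟩
      sign (toℕ j) * A zero j * minor A j + k * (sign (toℕ j) * B zero j * minor B j) ∎))
    (sum-+* (suc n) k (term A) (term B))
    where
    open RowComb R
    cut : Mat (suc n) (suc n) → Fin (suc n) → Mat n n
    cut M j r c = M (suc r) (punchIn j c)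
    minor : Mat (suc n) (suc n) → Fin (suc n) → ℤ
    minor M j = det n (cut M j)
    term : Mat (suc n) (suc n) → Fin (suc n) → ℤ
    term M j = sign (toℕ j) * M zero j * minor M j
    distrib : ∀ s x a k b → s * x * (a + k * b) ≡ s * x * a + k * (s * x * b)
    distrib = solve-∀

  exchange₀₁ : ∀ {n} → Fin (suc (suc n)) → Fin (suc (suc n))
  exchange₀₁ zero          = suc zero
  exchange₀₁ (suc zero)    = zero
  exchange₀₁ (suc (suc r)) = suc (suc r)

  -- Expanding along two rows in succession is, by definition, a `double-sum` in these rows.
  det-exchange₀₁ : ∀ n (A : Mat (suc (suc n)) (suc (suc n))) → det _ A + det _ (A ∘ exchange₀₁) ≡ + 0
  det-exchange₀₁ n A = double-sum-antisym n (A zero) (A (suc zero))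
    (λ φ → det n (λ r c → A (suc (suc r)) (φ c)))
    (λ φ≗ψ → det-cong n (λ r c → cong (A (suc (suc r))) (φ≗ψ c)))

  RepeatVanishes : ℕ → Set
  RepeatVanishes n = ∀ {i j} {A : Mat n n} → i ≢ j → A i ≗ A j → det n A ≡ + 0

  det-repeat-tail : ∀ n → RepeatVanishes n → ∀ {i j} {A : Mat (suc n) (suc n)} → i ≢ j →
    A (suc i) ≗ A (suc j) → det (suc n) A ≡ + 0
  det-repeat-tail n ih {A = A} i≢j Aᵢ≗Aⱼ = sum-0 (suc n) (λ l → trans
    (cong (sign (toℕ l) * A zero l *_)
      (ih {A = λ r c → A (suc r) (punchIn l c)} i≢j (λ c → Aᵢ≗Aⱼ (punchIn l c))))
    (*-zeroʳ (sign (toℕ l) * A zero l)))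

  -- If the equal rows are the first two, the exchange changes nothing and twice the determinant is
  -- 0. Otherwise the exchange moves row 0 below the top, where the case of two lower rows applies.
  det-repeat-head : ∀ n → RepeatVanishes n → ∀ {j} {A : Mat (suc n) (suc n)} →
    A zero ≗ A (suc j) → det (suc n) A ≡ + 0
  det-repeat-head (suc n) ih {zero} {A} A₀≗A₁ = x+x≡0⇒x≡0 (det _ A)
    (trans (cong (_+_ (det _ A)) (det-cong _ {A} {A ∘ exchange₀₁} unchanged)) (det-exchange₀₁ n A))
    where
    x+x≡0⇒x≡0 : ∀ x → x + x ≡ + 0 → x ≡ + 0
    x+x≡0⇒x≡0 (+ zero) _ = refl
    unchanged : A ≐ (A ∘ exchange₀₁)
    unchanged zero          = A₀≗A₁
    unchanged (suc zero)    = λ c → sym (A₀≗A₁ c)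
    unchanged (suc (suc r)) = λ _ → refl
  det-repeat-head (suc n) ih {suc j} {A} A₀≗Aⱼ = begin
    det _ A
      ≡⟨ sym (+-identityʳ _) ⟩
    det _ A + + 0
      ≡⟨ cong (_+_ (det _ A)) (sym (det-repeat-tail _ ih {zero} {suc j} {A ∘ exchange₀₁} (λ ()) A₀≗Aⱼ)) ⟩
    det _ A + det _ (A ∘ exchange₀₁)
      ≡⟨ det-exchange₀₁ n A ⟩
    + 0 ∎

  det-repeat : ∀ n → RepeatVanishes n
  det-repeat (suc n) {zero}  {zero}  i≢j _ = contradiction refl i≢j
  det-repeat (suc n) {zero}  {suc j} {A} _ A₀≗Aⱼ = det-repeat-head n (det-repeat n) {j} {A} A₀≗Aⱼ
  det-repeat (suc n) {suc i} {zero}  {A} _ Aᵢ≗A₀ =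
    det-repeat-head n (det-repeat n) {i} {A} (λ c → sym (Aᵢ≗A₀ c))
  det-repeat (suc n) {suc i} {suc j} {A} i≢j Aᵢ≗Aⱼ =
    det-repeat-tail n (det-repeat n) {A = A} (i≢j ∘ cong suc) Aᵢ≗Aⱼ

  _⊗_ : ∀ {n m p} → Mat n m → Mat m p → Mat n p
  _⊗_ {m = m} A B i j = sumFin m (λ k → A i k * B k j)

  -- `C ↦ det (C ⊗ B)` is alternating and takes the value `det B` at the identity, so uniqueness
  -- applies.
  det-⊗ : ∀ n (A B : Mat n n) → det n (A ⊗ B) ≡ det n A * det n B
  det-⊗ n A B = trans (alternating-det n (λ C → det n (C ⊗ B)) alt A)
    (cong (det n A *_) (det-cong n (λ i j → sum-δˡ n i (λ k → B k j))))
    where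
    alt : Alternating (λ C → det n (C ⊗ B))
    alt = record
      { ext    = λ C≐D → det-cong n (λ i j → sum-cong n (λ k → cong (_* B k j) (C≐D i k)))
      ; linear = λ {i} {k} {C} {D} {E} R → let open RowComb R in det-linear n {i} {k} {C ⊗ B} {D ⊗ B} record
          { here   = λ j → trans
              (sum-cong n (λ l → trans (cong (_* B l j) (here l)) (distrib (C i l) k (D i l) (B l j))))
              (sum-+* n k (λ l → C i l * B l j) (λ l → D i l * B l j))
          ; thereᴬ = λ r r≢i j → sum-cong n (λ l → cong (_* B l j) (thereᴬ r r≢i l))
          ; thereᴮ = λ r r≢i j → sum-cong n (λ l → cong (_* B l j) (thereᴮ r r≢i l))
          }
      ; repeat = λ {i} {j} {C} i≢j Cᵢ≗Cⱼ → det-repeat n {A = C ⊗ B} i≢j (λ p → sum-cong n (λ l → cong (_* B l p) (Cᵢ≗Cⱼ l)))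
      }
      where
      distrib : ∀ x k y b → (x + k * y) * b ≡ x * b + k * (y * b)
      distrib = solve-∀

  det-first-row : ∀ n (A : Mat (suc n) (suc n)) → (∀ j → A zero (suc j) ≡ + 0) →
    det (suc n) A ≡ A zero zero * det n (λ r c → A (suc r) (suc c))
  det-first-row n A A₀≗0 = begin
    + 1 * A zero zero * minor zero + sumFin n (λ j → - sign (toℕ j) * A zero (suc j) * minor (suc j))
      ≡⟨ cong₂ _+_ (cong (_* minor zero) (*-identityˡ (A zero zero))) (sum-0 n vanish) ⟩
    A zero zero * minor zero + + 0
      ≡⟨ +-identityʳ _ ⟩
    A zero zero * minor zero ∎
    where
    minor : Fin (suc n) → ℤ
    minor j = det n (λ r c → A (suc r) (punchIn j c))
    vanish : ∀ j → - sign (toℕ j) * A zero (suc j) * minor (suc j) ≡ + 0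
    vanish j = begin
      - sign (toℕ j) * A zero (suc j) * minor (suc j)
        ≡⟨ cong (λ z → - sign (toℕ j) * z * minor (suc j)) (A₀≗0 j) ⟩
      - sign (toℕ j) * + 0 * minor (suc j)
        ≡⟨ cong (_* minor (suc j)) (*-zeroʳ (- sign (toℕ j))) ⟩
      + 0 * minor (suc j)
        ≡⟨ *-zeroˡ (minor (suc j)) ⟩
      + 0 ∎

  det-first-rows₂ : ∀ n (A : Mat (suc (suc n)) (suc (suc n))) →
    (∀ j → A zero (suc (suc j)) ≡ + 0) → (∀ j → A (suc zero) (suc (suc j)) ≡ + 0) →
    det (suc (suc n)) A ≡
    (A zero zero * A (suc zero) (suc zero) + - (A zero (suc zero) * A (suc zero) zero)) *
    det n (λ r c → A (suc (suc r)) (suc (suc c)))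
  det-first-rows₂ n A A₀≗0 A₁≗0 = begin
    + 1 * a * minor zero + (- + 1 * b * minor (suc zero) + sumFin n rest)
      ≡⟨ cong₂ (λ x y → + 1 * a * x + (- + 1 * b * y + sumFin n rest))
           (det-first-row n (cut zero) A₁≗0) (det-first-row n (cut (suc zero)) A₁≗0) ⟩
    + 1 * a * (d * block) + (- + 1 * b * (c * block) + sumFin n rest)
      ≡⟨ cong (λ z → + 1 * a * (d * block) + (- + 1 * b * (c * block) + z)) (sum-0 n vanish) ⟩
    + 1 * a * (d * block) + (- + 1 * b * (c * block) + + 0)
      ≡⟨ collect a b c d block ⟩
    (a * d + - (b * c)) * block ∎
    where
    a = A zero zero
    b = A zero (suc zero)
    c = A (suc zero) zero
    d = A (suc zero) (suc zero)
    block = det n (λ r c → A (suc (suc r)) (suc (suc c)))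
    cut : Fin (suc (suc n)) → Mat (suc n) (suc n)
    cut j r c = A (suc r) (punchIn j c)
    minor : Fin (suc (suc n)) → ℤ
    minor j = det (suc n) (cut j)
    rest : Fin n → ℤ
    rest j = - - sign (toℕ j) * A zero (suc (suc j)) * minor (suc (suc j))
    vanish : ∀ j → rest j ≡ + 0
    vanish j = begin
      - - sign (toℕ j) * A zero (suc (suc j)) * minor (suc (suc j))
        ≡⟨ cong (λ z → - - sign (toℕ j) * z * minor (suc (suc j))) (A₀≗0 j) ⟩
      - - sign (toℕ j) * + 0 * minor (suc (suc j))
        ≡⟨ cong (_* minor (suc (suc j))) (*-zeroʳ (- - sign (toℕ j))) ⟩
      + 0 * minor (suc (suc j))
        ≡⟨ *-zeroˡ (minor (suc (suc j))) ⟩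
      + 0 ∎
    collect : ∀ a b c d x → + 1 * a * (d * x) + (- + 1 * b * (c * x) + + 0) ≡ (a * d + - (b * c)) * x
    collect = solve-∀

  det-scalar : ∀ n k → det n (λ i j → k * δ i j) ≡ k ^ n
  det-scalar zero    k = refl
  det-scalar (suc n) k = trans
    (det-first-row n (λ i j → k * δ i j) (λ _ → *-zeroʳ k))
    (cong₂ _*_ (*-identityʳ k) (det-scalar n k))

  -- `P` is not invertible over ℤ, but det P · det Q = k ^ n is not 0, and that suffices for
  -- cancelling det P.
  det-similar : ∀ n {k} (P Q M D : Mat n n) → ¬ (k ≡ + 0) →
    (P ⊗ Q) ≐ (λ i j → k * δ i j) → (P ⊗ M) ≐ (D ⊗ P) → det n M ≡ det n D
  det-similar n {k} P Q M D k≢0 PQ≐k PM≐DP = *-cancelˡ-≡ (det n P) _ _ ⦃ ≢-nonZero det-P≢0 ⦄ (begin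
    det n P * det n M   ≡⟨ sym (det-⊗ n P M) ⟩
    det n (P ⊗ M)       ≡⟨ det-cong n PM≐DP ⟩
    det n (D ⊗ P)       ≡⟨ det-⊗ n D P ⟩
    det n D * det n P   ≡⟨ *-comm (det n D) (det n P) ⟩
    det n P * det n D   ∎)
    where
    ^≢0 : ∀ n → ¬ (k ^ n ≡ + 0)
    ^≢0 (suc n) eq with i*j≡0⇒i≡0∨j≡0 k eq
    ... | inj₁ k≡0 = k≢0 k≡0
    ... | inj₂ eq′ = ^≢0 n eq′
    det-P≢0 : ¬ (det n P ≡ + 0)
    det-P≢0 eq = ^≢0 n (begin
      k ^ n                       ≡⟨ sym (det-scalar n k) ⟩
      det n (λ i j → k * δ i j)   ≡⟨ sym (det-cong n PQ≐k) ⟩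
      det n (P ⊗ Q)               ≡⟨ det-⊗ n P Q ⟩
      det n P * det n Q           ≡⟨ cong (_* det n Q) eq ⟩
      + 0 * det n Q               ≡⟨ *-zeroˡ (det n Q) ⟩
      + 0                         ∎)

-- Block diagonalisation of the group matrix.

module GroupDeterminant where

  open Determinants
  open import Data.Fin using (Fin; zero; suc; #_; combine; toℕ; punchIn)
  open import Data.Fin.Properties using (all?) renaming (_≟_ to _≟ᶠ_)
  open import Data.Integer using (ℤ; +_; -_; _+_; _*_; _-_; _≟_)
  open import Data.Integer.Properties using (*-distribʳ-+; *-comm; *-assoc; *-zeroˡ)
  open import Data.Integer.Tactic.RingSolver using (solve-∀; ring)
  open import Data.Product.Properties using (≡-dec)
  open import Data.Vec using (Vec; []; _∷_; lookup)
  import Tactic.RingSolver.NonReflective as RingExpr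
  open import Relation.Nullary.Decidable using (from-yes)
  open ≡-Reasoning

  -- The variable x k belongs to a^k when k < 6 and to a^(k - 6) b otherwise.
  data Form : Set where
    x    : Fin 12 → Form
    𝟎    : Form
    _⊞_  : Form → Form → Form
    ⊟_   : Form → Form

  infixl 6 _⊞_
  infix 7 ⊟_

  value : (Fin 12 → ℤ) → Form → ℤ
  value X (x k)   = X k
  value X 𝟎       = + 0
  value X (e ⊞ f) = value X e + value X f
  value X (⊟ e)   = - value X e

  -- Reduces a linear identity in the variables to its coefficients, that is, to the twelve
  -- assignments `δ h`.
  value-linear : ∀ X e → value X e ≡ sumFin 12 (λ h → value (δ h) e * X h)
  value-linear X (x k) = begin
    X k                           ≡⟨ sym (sum-δ 12 X k) ⟩
    sumFin 12 (λ h → X h * δ h k) ≡⟨ sum-cong 12 (λ h → *-comm (X h) (δ h k)) ⟩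
    sumFin 12 (λ h → δ h k * X h) ∎
  value-linear X 𝟎 = sym (sum-0 12 (λ h → *-zeroˡ (X h)))
  value-linear X (e ⊞ f) = begin
    value X e + value X f
      ≡⟨ cong₂ _+_ (value-linear X e) (value-linear X f) ⟩
    sumFin 12 (λ h → value (δ h) e * X h) + sumFin 12 (λ h → value (δ h) f * X h)
      ≡⟨ sym (sum-+ 12 (λ h → value (δ h) e * X h) (λ h → value (δ h) f * X h)) ⟩
    sumFin 12 (λ h → value (δ h) e * X h + value (δ h) f * X h)
      ≡⟨ sum-cong 12 (λ h → sym (*-distribʳ-+ (X h) (value (δ h) e) (value (δ h) f))) ⟩
    sumFin 12 (λ h → (value (δ h) e + value (δ h) f) * X h) ∎
  value-linear X (⊟ e) = begin
    - value X e
      ≡⟨ cong -_ (value-linear X e) ⟩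
    - sumFin 12 (λ h → value (δ h) e * X h)
      ≡⟨ minus _ ⟩
    - + 1 * sumFin 12 (λ h → value (δ h) e * X h)
      ≡⟨ sym (sum-*ˡ 12 (- + 1) (λ h → value (δ h) e * X h)) ⟩
    sumFin 12 (λ h → - + 1 * (value (δ h) e * X h))
      ≡⟨ sum-cong 12 (λ h → minus-* (value (δ h) e) (X h)) ⟩
    sumFin 12 (λ h → - value (δ h) e * X h) ∎
    where
    minus : ∀ y → - y ≡ - + 1 * y
    minus = solve-∀
    minus-* : ∀ y z → - + 1 * (y * z) ≡ - y * z
    minus-* = solve-∀

  FormMat : ℕ → Set
  FormMat n = Fin n → Fin n → Form

  infixr 5 _⊕₁_ _⊕₂_

  _⊕₁_ : ∀ {n} → Form → FormMat n → FormMat (suc n)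
  (e ⊕₁ B) zero    zero    = e
  (e ⊕₁ B) (suc i) (suc j) = B i j
  (e ⊕₁ B) _       _       = 𝟎

  _⊕₂_ : ∀ {n} → Vec (Vec Form 2) 2 → FormMat n → FormMat (suc (suc n))
  (A ⊕₂ B) zero          zero          = lookup (lookup A zero) zero
  (A ⊕₂ B) zero          (suc zero)    = lookup (lookup A zero) (suc zero)
  (A ⊕₂ B) (suc zero)    zero          = lookup (lookup A (suc zero)) zero
  (A ⊕₂ B) (suc zero)    (suc zero)    = lookup (lookup A (suc zero)) (suc zero)
  (A ⊕₂ B) (suc (suc i)) (suc (suc j)) = B i j
  (A ⊕₂ B) _             _             = 𝟎

  valueMat : ∀ {m} → (Fin 12 → ℤ) → FormMat m → Mat m m
  valueMat X L i j = value X (L i j)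

  -- If f is the polynomial with coefficients x 0, ..., x 5, and ω, ζ are primitive cube and sixth roots of unity, then
  -- t = f(1), n = f(-1), f(ω) = p + qω and f(ζ) = u + vζ; the primed forms belong to x 6, ..., x 11.
  t t′ n n′ p p′ q q′ u u′ v v′ : Form
  t  = x (# 0) ⊞ x (# 1) ⊞ x (# 2) ⊞ x (# 3) ⊞ x (# 4) ⊞ x (# 5)
  t′ = x (# 6) ⊞ x (# 7) ⊞ x (# 8) ⊞ x (# 9) ⊞ x (# 10) ⊞ x (# 11)
  n  = x (# 0) ⊞ x (# 2) ⊞ x (# 4) ⊞ ⊟ (x (# 1) ⊞ x (# 3) ⊞ x (# 5))
  n′ = x (# 6) ⊞ x (# 8) ⊞ x (# 10) ⊞ ⊟ (x (# 7) ⊞ x (# 9) ⊞ x (# 11))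
  p  = x (# 0) ⊞ x (# 3) ⊞ ⊟ (x (# 2) ⊞ x (# 5))
  p′ = x (# 6) ⊞ x (# 9) ⊞ ⊟ (x (# 8) ⊞ x (# 11))
  q  = x (# 1) ⊞ x (# 4) ⊞ ⊟ (x (# 2) ⊞ x (# 5))
  q′ = x (# 7) ⊞ x (# 10) ⊞ ⊟ (x (# 8) ⊞ x (# 11))
  u  = x (# 0) ⊞ x (# 5) ⊞ ⊟ (x (# 2) ⊞ x (# 3))
  u′ = x (# 6) ⊞ x (# 11) ⊞ ⊟ (x (# 8) ⊞ x (# 9))
  v  = x (# 1) ⊞ x (# 2) ⊞ ⊟ (x (# 4) ⊞ x (# 5))
  v′ = x (# 7) ⊞ x (# 8) ⊞ ⊟ (x (# 10) ⊞ x (# 11))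

  negative : Vec (Vec Form 2) 2
  negative = (n  ∷ ⊟ n′ ∷ []) ∷
            (n′ ∷ n    ∷ []) ∷ []

  -- A matrix of f + gb on ℤ[ω] with determinant |p + qω|² - |p′ + q′ω|², the factor A.
  dihedral : Vec (Vec Form 2) 2
  dihedral = (p ⊞ ⊟ q′      ∷ p′ ⊞ ⊟ q     ∷ []) ∷
             (q ⊞ p′ ⊞ ⊟ q′ ∷ p ⊞ ⊟ q ⊞ q′ ∷ []) ∷ []

  quaternion : FormMat 4
  quaternion i j = lookup (lookup rows i) j
    where
    rows : Vec (Vec Form 4) 4
    rows = (u  ∷ ⊟ v       ∷ ⊟ u′ ∷ ⊟ (u′ ⊞ v′) ∷ []) ∷
           (v  ∷ u ⊞ v     ∷ ⊟ v′ ∷ u′          ∷ []) ∷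
           (u′ ∷ u′ ⊞ v′   ∷ u    ∷ ⊟ v         ∷ []) ∷
           (v′ ∷ ⊟ u′      ∷ v    ∷ u ⊞ v       ∷ []) ∷ []

  -- The regular representation over ℚ: the two characters trivial on a, the representation a ↦ -1, two copies of the
  -- two-dimensional representation of Q12/⟨a^3⟩ ≅ S₃, and left multiplication on the quaternion order
  -- ℤ⟨ζ,b⟩ with ζ² = ζ - 1, b² = -1, b ζ = ζ⁻¹ b, in the basis 1, ζ, b, ζb.
  blocks : FormMat 12
  blocks = (t ⊞ t′) ⊕₁ (t ⊞ ⊟ t′) ⊕₁ negative ⊕₂ dihedral ⊕₂ dihedral ⊕₂ quaternion

  table : Vec (Vec ℤ 12) 12 → Mat 12 12
  table rows i j = lookup (lookup rows i) j

  module _ where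
    private
      o i m : ℤ
      o = + 0
      i = + 1
      m = - + 1

    -- The rows are matrix coefficients of the representations in blocks, and Q = 12 P⁻¹.
    P : Mat 12 12
    P = table (
      (i ∷ i ∷ i ∷ i ∷ i ∷ i ∷ i ∷ i ∷ i ∷ i ∷ i ∷ i ∷ []) ∷
      (i ∷ i ∷ i ∷ i ∷ i ∷ i ∷ m ∷ m ∷ m ∷ m ∷ m ∷ m ∷ []) ∷
      (i ∷ m ∷ i ∷ m ∷ i ∷ m ∷ o ∷ o ∷ o ∷ o ∷ o ∷ o ∷ []) ∷
      (o ∷ o ∷ o ∷ o ∷ o ∷ o ∷ i ∷ m ∷ i ∷ m ∷ i ∷ m ∷ []) ∷
      (i ∷ o ∷ m ∷ i ∷ o ∷ m ∷ o ∷ m ∷ i ∷ o ∷ m ∷ i ∷ []) ∷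
      (o ∷ i ∷ m ∷ o ∷ i ∷ m ∷ i ∷ m ∷ o ∷ i ∷ m ∷ o ∷ []) ∷
      (o ∷ m ∷ i ∷ o ∷ m ∷ i ∷ i ∷ o ∷ m ∷ i ∷ o ∷ m ∷ []) ∷
      (i ∷ m ∷ o ∷ i ∷ m ∷ o ∷ o ∷ i ∷ m ∷ o ∷ i ∷ m ∷ []) ∷
      (i ∷ o ∷ m ∷ m ∷ o ∷ i ∷ o ∷ o ∷ o ∷ o ∷ o ∷ o ∷ []) ∷
      (o ∷ i ∷ i ∷ o ∷ m ∷ m ∷ o ∷ o ∷ o ∷ o ∷ o ∷ o ∷ []) ∷
      (o ∷ o ∷ o ∷ o ∷ o ∷ o ∷ i ∷ o ∷ m ∷ m ∷ o ∷ i ∷ []) ∷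
      (o ∷ o ∷ o ∷ o ∷ o ∷ o ∷ o ∷ i ∷ i ∷ o ∷ m ∷ m ∷ []) ∷
      [])

    Q : Mat 12 12
    Q = table (
      (i ∷ i ∷ + 2 ∷ o ∷ + 2 ∷ o ∷ o ∷ + 2 ∷ + 4 ∷ + 2 ∷ o ∷ o ∷ []) ∷
      (i ∷ i ∷ - + 2 ∷ o ∷ - + 2 ∷ + 2 ∷ - + 2 ∷ o ∷ + 2 ∷ + 4 ∷ o ∷ o ∷ []) ∷
      (i ∷ i ∷ + 2 ∷ o ∷ o ∷ - + 2 ∷ + 2 ∷ - + 2 ∷ - + 2 ∷ + 2 ∷ o ∷ o ∷ []) ∷
      (i ∷ i ∷ - + 2 ∷ o ∷ + 2 ∷ o ∷ o ∷ + 2 ∷ - + 4 ∷ - + 2 ∷ o ∷ o ∷ []) ∷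
      (i ∷ i ∷ + 2 ∷ o ∷ - + 2 ∷ + 2 ∷ - + 2 ∷ o ∷ - + 2 ∷ - + 4 ∷ o ∷ o ∷ []) ∷
      (i ∷ i ∷ - + 2 ∷ o ∷ o ∷ - + 2 ∷ + 2 ∷ - + 2 ∷ + 2 ∷ - + 2 ∷ o ∷ o ∷ []) ∷
      (i ∷ m ∷ o ∷ + 2 ∷ o ∷ + 2 ∷ + 2 ∷ o ∷ o ∷ o ∷ + 4 ∷ + 2 ∷ []) ∷
      (i ∷ m ∷ o ∷ - + 2 ∷ - + 2 ∷ o ∷ - + 2 ∷ + 2 ∷ o ∷ o ∷ + 2 ∷ + 4 ∷ []) ∷
      (i ∷ m ∷ o ∷ + 2 ∷ + 2 ∷ - + 2 ∷ o ∷ - + 2 ∷ o ∷ o ∷ - + 2 ∷ + 2 ∷ []) ∷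
      (i ∷ m ∷ o ∷ - + 2 ∷ o ∷ + 2 ∷ + 2 ∷ o ∷ o ∷ o ∷ - + 4 ∷ - + 2 ∷ []) ∷
      (i ∷ m ∷ o ∷ + 2 ∷ - + 2 ∷ o ∷ - + 2 ∷ + 2 ∷ o ∷ o ∷ - + 2 ∷ - + 4 ∷ []) ∷
      (i ∷ m ∷ o ∷ - + 2 ∷ + 2 ∷ - + 2 ∷ o ∷ - + 2 ∷ o ∷ o ∷ + 2 ∷ - + 2 ∷ []) ∷
      [])

  PQ : (P ⊗ Q) ≐ (λ i j → + 12 * δ i j)
  PQ = from-yes (all? λ i → all? λ j → (P ⊗ Q) i j ≟ + 12 * δ i j)

  index : Q12 → Fin 12
  index (i , j) = combine j i

  enum-index : ∀ g → Q12-enum (index g) ≡ g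
  enum-index (i , j) = entry i j
    where
    entry : ∀ i j → Q12-enum (index (i , j)) ≡ (i , j)
    entry = from-yes (all? λ i → all? λ j → ≡-dec _≟ᶠ_ _≟ᶠ_ (Q12-enum (index (i , j))) (i , j))

  quotient : Fin 12 → Fin 12 → Fin 12
  quotient i j = index (Q12-mul (Q12-enum i) (Q12-inv (Q12-enum j)))

  -- The coefficient of the variable `h` in entry `(i , j)` of the relation with `P`. It involves
  -- integer constants only, so all 12³ cases are decided by evaluation.
  intertwines : ∀ h i j → sumFin 12 (λ k → P i k * δ (quotient k j) h) ≡
    sumFin 12 (λ l → value (δ h) (blocks i l) * P l j)
  intertwines = from-yes (all? λ h → all? λ i → all? λ j →
    sumFin 12 (λ k → P i k * δ (quotient k j) h) ≟ sumFin 12 (λ l → value (δ h) (blocks i l) * P l j))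

  groupMat : (Q12 → ℤ) → Mat 12 12
  groupMat f i j = f (Q12-mul (Q12-enum i) (Q12-inv (Q12-enum j)))

  -- Write each variable as a combination of the unit assignments, bring the sum over `h` outside,
  -- apply `intertwines` to every coefficient and fold back.
  P-intertwines : ∀ f → (P ⊗ groupMat f) ≐ (valueMat (f ∘ Q12-enum) blocks ⊗ P)
  P-intertwines f i j = begin
    sumFin 12 (λ k → P i k * groupMat f k j)
      ≡⟨ sum-cong 12 (λ k → cong (P i k *_) (trans (cong f (sym (enum-index (Q12-mul (Q12-enum k) (Q12-inv (Q12-enum j))))))
           (sym (sum-δˡ 12 (quotient k j) X)))) ⟩
    sumFin 12 (λ k → P i k * sumFin 12 (λ h → δ (quotient k j) h * X h))
      ≡⟨ sum-cong 12 (λ k → trans (sym (sum-*ˡ 12 (P i k) (λ h → δ (quotient k j) h * X h)))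
           (sum-cong 12 (λ h → sym (*-assoc (P i k) (δ (quotient k j) h) (X h))))) ⟩
    sumFin 12 (λ k → sumFin 12 (λ h → P i k * δ (quotient k j) h * X h))
      ≡⟨ sum-swap 12 12 (λ k h → P i k * δ (quotient k j) h * X h) ⟩
    sumFin 12 (λ h → sumFin 12 (λ k → P i k * δ (quotient k j) h * X h))
      ≡⟨ sum-cong 12 (λ h → trans (sum-*ʳ 12 (X h) (λ k → P i k * δ (quotient k j) h))
           (trans (cong (_* X h) (intertwines h i j))
           (sym (sum-*ʳ 12 (X h) (λ l → value (δ h) (blocks i l) * P l j))))) ⟩
    sumFin 12 (λ h → sumFin 12 (λ l → value (δ h) (blocks i l) * P l j * X h))
      ≡⟨ sum-swap 12 12 (λ h l → value (δ h) (blocks i l) * P l j * X h) ⟩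
    sumFin 12 (λ l → sumFin 12 (λ h → value (δ h) (blocks i l) * P l j * X h))
      ≡⟨ sum-cong 12 (λ l → trans
           (sum-cong 12 (λ h → reorder (value (δ h) (blocks i l)) (P l j) (X h)))
           (sum-*ʳ 12 (P l j) (λ h → value (δ h) (blocks i l) * X h))) ⟩
    sumFin 12 (λ l → sumFin 12 (λ h → value (δ h) (blocks i l) * X h) * P l j)
      ≡⟨ sum-cong 12 (λ l → cong (_* P l j) (sym (value-linear X (blocks i l)))) ⟩
    sumFin 12 (λ l → valueMat (f ∘ Q12-enum) blocks i l * P l j) ∎
    where
    X = f ∘ Q12-enum
    reorder : ∀ a b c → a * b * c ≡ a * c * b
    reorder = solve-∀

  det₂ : (Fin 12 → ℤ) → (a b c d : Form) → ℤ
  det₂ X a b c d = value X a * value X d + - (value X b * value X c)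

  -- Opaque, because unfolding a determinant of size 12 produces 12! terms.
  opaque
    formDet : ∀ m → (Fin 12 → ℤ) → FormMat m → ℤ
    formDet m X L = det m (valueMat X L)

    formDet≡det : ∀ m X L → det m (valueMat X L) ≡ formDet m X L
    formDet≡det m X L = refl

    formDet-⊕₁ : ∀ m X e (L : FormMat m) → formDet (suc m) X (e ⊕₁ L) ≡ value X e * formDet m X L
    formDet-⊕₁ m X e L = det-first-row m (valueMat X (e ⊕₁ L)) (λ _ → refl)

    formDet-⊕₂ : ∀ m X a b c d (L : FormMat m) →
      formDet (suc (suc m)) X (((a ∷ b ∷ []) ∷ (c ∷ d ∷ []) ∷ []) ⊕₂ L) ≡ det₂ X a b c d * formDet m X L
    formDet-⊕₂ m X a b c d L =
      det-first-rows₂ m (valueMat X (((a ∷ b ∷ []) ∷ (c ∷ d ∷ []) ∷ []) ⊕₂ L)) (λ _ → refl) (λ _ → refl)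

  groupDet≡formDet : ∀ f → det 12 (groupMat f) ≡ formDet 12 (f ∘ Q12-enum) blocks
  groupDet≡formDet f = trans
    (det-similar 12 {+ 12} P Q (groupMat f) (valueMat (f ∘ Q12-enum) blocks) (λ ()) PQ (P-intertwines f))
    (formDet≡det 12 (f ∘ Q12-enum) blocks)

  open RingExpr ring using (Expr; Κ; _⊕_; ⊝_; _⊜_) renaming (_⊗_ to _⊙_; solve to solve-expr)

  -- `det` in the syntax of the ring solver, so that the determinant of size 4 need not be written
  -- out.
  polyDet : ∀ {k} n → (Fin n → Fin n → Expr ℤ k) → Expr ℤ k
  polyDet zero    M = Κ (+ 1)
  polyDet {k} (suc n) M = polySum (suc n) (λ j → Κ (sign (toℕ j)) ⊙ M zero j ⊙
    polyDet n (λ r c → M (suc r) (punchIn j c)))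
    where
    polySum : ∀ m → (Fin m → Expr ℤ k) → Expr ℤ k
    polySum zero    f = Κ (+ 0)
    polySum (suc m) f = f zero ⊕ polySum m (λ i → f (suc i))

  -- Left multiplication on a quaternion order has determinant the square of the reduced norm; u² +
  -- uv + v² is the norm of u + vζ.
  det-quaternion : ∀ X → let [_] = value X in det 4 (valueMat X quaternion) ≡
    ([ u ] * [ u ] + [ u ] * [ v ] + [ v ] * [ v ] + ([ u′ ] * [ u′ ] + [ u′ ] * [ v′ ] + [ v′ ] * [ v′ ])) *
    ([ u ] * [ u ] + [ u ] * [ v ] + [ v ] * [ v ] + ([ u′ ] * [ u′ ] + [ u′ ] * [ v′ ] + [ v′ ] * [ v′ ]))
  det-quaternion X = solve-expr 4 (λ a b c d →
    polyDet 4 (λ i j → lookup (lookup (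
      (a ∷ ⊝ b     ∷ ⊝ c ∷ ⊝ (c ⊕ d) ∷ []) ∷
      (b ∷ a ⊕ b   ∷ ⊝ d ∷ c           ∷ []) ∷
      (c ∷ c ⊕ d   ∷ a    ∷ ⊝ b        ∷ []) ∷
      (d ∷ ⊝ c     ∷ b    ∷ a ⊕ b      ∷ []) ∷ []) i) j)
    ⊜ (a ⊙ a ⊕ a ⊙ b ⊕ b ⊙ b ⊕ (c ⊙ c ⊕ c ⊙ d ⊕ d ⊙ d)) ⊙
       (a ⊙ a ⊕ a ⊙ b ⊕ b ⊙ b ⊕ (c ⊙ c ⊕ c ⊙ d ⊕ d ⊙ d)))
    refl (value X u) (value X v) (value X u′) (value X v′)

  -- The determinant as a product of traces and norms.

  record Triple : Set where
    constructor ⟨_,_,_⟩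
    field c₀ c₁ c₂ : ℤ

  open Triple

  -- A triple stands for a + bx + cx² modulo x³ - 1. The trace is its value at 1, and the norm is
  -- the squared absolute value of its value at ω.
  trace norm : Triple → ℤ
  trace ⟨ a , b , c ⟩ = a + b + c
  norm  ⟨ a , b , c ⟩ = a * a + b * b + c * c - a * b - b * c - c * a

  infix 6 _+2*_
  _+2*_ : Triple → Triple → Triple
  ⟨ a , b , c ⟩ +2* ⟨ d , e , f ⟩ = ⟨ a + + 2 * d , b + + 2 * e , c + + 2 * f ⟩

  productForm : (s s′ w w′ : Triple) → ℤ
  productForm s s′ w w′ =
    (trace s * trace s - trace s′ * trace s′) * (trace w * trace w + trace w′ * trace w′) *
    ((norm s - norm s′) * (norm s - norm s′)) * ((norm w + norm w′) * (norm w + norm w′))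

  -- In the notation above, the coefficients of f(x) and of f(-x) modulo x³ - 1.
  tripleˢ tripleˢ′ tripleʷ tripleʷ′ : (Q12 → ℤ) → Triple
  tripleˢ  f = let X = f ∘ Q12-enum in ⟨ X (# 0) + X (# 3) , X (# 1) + X (# 4) , X (# 2) + X (# 5) ⟩
  tripleˢ′ f = let X = f ∘ Q12-enum in ⟨ X (# 6) + X (# 9) , X (# 7) + X (# 10) , X (# 8) + X (# 11) ⟩
  tripleʷ  f = let X = f ∘ Q12-enum in ⟨ X (# 0) - X (# 3) , X (# 4) - X (# 1) , X (# 2) - X (# 5) ⟩
  tripleʷ′ f = let X = f ∘ Q12-enum in ⟨ X (# 6) - X (# 9) , X (# 10) - X (# 7) , X (# 8) - X (# 11) ⟩

  -- Stated for integer variables, so that the equations are composed without any determinant being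
  -- evaluated.
  factor-chain : ∀ {a b c d x₀ x₁ x₂ x₃ x₄} x₅ → x₀ ≡ a * x₁ → x₁ ≡ b * x₂ → x₂ ≡ c * x₃ →
    x₃ ≡ d * x₄ → x₄ ≡ d * x₅ → x₀ ≡ a * (b * (c * (d * (d * x₅))))
  factor-chain _ refl refl refl refl refl = refl

  dihedralDet negativeDet : (Fin 12 → ℤ) → ℤ
  dihedralDet X = det₂ X (p ⊞ ⊟ q′) (p′ ⊞ ⊟ q) (q ⊞ p′ ⊞ ⊟ q′) (p ⊞ ⊟ q ⊞ q′)
  negativeDet X = det₂ X n (⊟ n′) n′ n

  formDet-blocks : ∀ X → formDet 12 X blocks ≡
    value X (t ⊞ t′) * (value X (t ⊞ ⊟ t′) * (negativeDet X * (dihedralDet X * (dihedralDet X *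
    formDet 4 X quaternion))))
  formDet-blocks X = factor-chain
    {value X (t ⊞ t′)} {value X (t ⊞ ⊟ t′)} {negativeDet X} {dihedralDet X}
    {formDet 12 X blocks} {formDet 11 X L₁₁} {formDet 10 X L₁₀} {formDet 8 X L₈} {formDet 6 X L₆}
    (formDet 4 X quaternion)
    (formDet-⊕₁ 11 X (t ⊞ t′) L₁₁)
    (formDet-⊕₁ 10 X (t ⊞ ⊟ t′) L₁₀)
    (formDet-⊕₂ 8 X n (⊟ n′) n′ n L₈)
    (dihedral-step 6 L₆)
    (dihedral-step 4 quaternion)
    where
    L₆ = dihedral ⊕₂ quaternion
    L₈ = dihedral ⊕₂ L₆
    L₁₀ = negative ⊕₂ L₈
    L₁₁ = (t ⊞ ⊟ t′) ⊕₁ L₁₀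
    dihedral-step : ∀ m (L : FormMat m) →
      formDet (suc (suc m)) X (dihedral ⊕₂ L) ≡ dihedralDet X * formDet m X L
    dihedral-step m = formDet-⊕₂ m X (p ⊞ ⊟ q′) (p′ ⊞ ⊟ q) (q ⊞ p′ ⊞ ⊟ q′) (p ⊞ ⊟ q ⊞ q′)

  combine-factors : ∀ a b c d A B {T₁ T₂ N A′ B²} → T₁ ≡ a + b → T₂ ≡ a + - b → N ≡ c * c + d * d →
    A′ ≡ A → B² ≡ B * B → T₁ * (T₂ * (N * (A′ * (A′ * B²)))) ≡
    (a * a - b * b) * (c * c + d * d) * (A * A) * (B * B)
  combine-factors a b c d A B refl refl refl refl refl = regroup a b c d A B
    where
    regroup : ∀ a b c d A B → (a + b) * ((a + - b) * ((c * c + d * d) * (A * (A * (B * B))))) ≡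
      (a * a + - (b * b)) * (c * c + d * d) * (A * A) * (B * B)
    regroup = solve-∀

  groupDet-product : ∀ f → groupDet 12 Q12-enum Q12-mul Q12-inv f ≡
    productForm (tripleˢ f) (tripleˢ′ f) (tripleʷ f) (tripleʷ′ f)
  groupDet-product f = trans (groupDet≡formDet f) (trans (formDet-blocks X)
    (combine-factors (trace (tripleˢ f)) (trace (tripleˢ′ f)) (trace (tripleʷ f)) (trace (tripleʷ′ f))
      (norm (tripleˢ f) - norm (tripleˢ′ f)) (norm (tripleʷ f) + norm (tripleʷ′ f))
      (cong₂ _+_ (t-trace x₀ x₁ x₂ x₃ x₄ x₅) (t-trace y₀ y₁ y₂ y₃ y₄ y₅))
      (cong₂ _-_ (t-trace x₀ x₁ x₂ x₃ x₄ x₅) (t-trace y₀ y₁ y₂ y₃ y₄ y₅))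
      (trans (rotation-det (value X n) (value X n′))
        (cong₂ (λ a b → a * a + b * b) (n-trace x₀ x₁ x₂ x₃ x₄ x₅) (n-trace y₀ y₁ y₂ y₃ y₄ y₅)))
      (trans (dihedral-norm (value X p) (value X q) (value X p′) (value X q′))
        (cong₂ _-_ (s-norm (x₀ + x₃) (x₁ + x₄) (x₂ + x₅)) (s-norm (y₀ + y₃) (y₁ + y₄) (y₂ + y₅))))
      (trans (sym (formDet≡det 4 X quaternion)) (trans (det-quaternion X)
        (cong (λ b → b * b) (cong₂ _+_ (w-norm x₀ x₁ x₂ x₃ x₄ x₅) (w-norm y₀ y₁ y₂ y₃ y₄ y₅)))))))
    where
    X = f ∘ Q12-enum
    x₀ = X (# 0) ; x₁ = X (# 1) ; x₂ = X (# 2) ; x₃ = X (# 3) ; x₄ = X (# 4) ; x₅ = X (# 5)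
    y₀ = X (# 6) ; y₁ = X (# 7) ; y₂ = X (# 8) ; y₃ = X (# 9) ; y₄ = X (# 10) ; y₅ = X (# 11)
    t-trace : ∀ a b c d e f → a + b + c + d + e + f ≡ a + d + (b + e) + (c + f)
    t-trace = solve-∀
    n-trace : ∀ a b c d e f → a + c + e + - (b + d + f) ≡ a + - d + (e + - b) + (c + - f)
    n-trace = solve-∀
    rotation-det : ∀ a b → a * a + - (- b * b) ≡ a * a + b * b
    rotation-det = solve-∀
    dihedral-norm : ∀ a b c d → (a + - d) * (a + - b + d) + - ((c + - b) * (b + c + - d)) ≡
      a * a + - (a * b) + b * b + - (c * c + - (c * d) + d * d)
    dihedral-norm = solve-∀
    s-norm : ∀ a b c → (a + - c) * (a + - c) + - ((a + - c) * (b + - c)) + (b + - c) * (b + - c) ≡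
      a * a + b * b + c * c + - (a * b) + - (b * c) + - (c * a)
    s-norm = solve-∀
    w-norm : ∀ a b c d e f →
      (a + f + - (c + d)) * (a + f + - (c + d)) + (a + f + - (c + d)) * (b + c + - (e + f)) +
      (b + c + - (e + f)) * (b + c + - (e + f)) ≡
      (a + - d) * (a + - d) + (e + - b) * (e + - b) + (c + - f) * (c + - f) +
      - ((a + - d) * (e + - b)) + - ((e + - b) * (c + - f)) + - ((c + - f) * (a + - d))
    w-norm = solve-∀

-- Values of the determinant in arithmetic progressions.

module Families where

  open GroupDeterminant hiding (t; t′; n; n′; p; p′; q; q′; u; u′; v; v′; x)
  open import Data.Fin using (zero; suc)
  open import Data.Integer using (ℤ; +_; -_; _+_; _*_; _-_)
  open import Data.Integer.DivMod using (a≡a%ℕn+[a/ℕn]*n; n%ℕd<d) renaming (_/ℕ_ to _divℕ_; _%ℕ_ to _modℕ_)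
  open import Data.Integer.Properties using (neg-involutive; neg-distribʳ-*; +-identityˡ; +-comm; *-comm)
  open import Data.Integer.Tactic.RingSolver using (solve-∀)
  open import Data.Vec using ([]; _∷_; lookup)
  open ≡-Reasoning

  triple-cong : ∀ {a b c a′ b′ c′} → a ≡ a′ → b ≡ b′ → c ≡ c′ → ⟨ a , b , c ⟩ ≡ ⟨ a′ , b′ , c′ ⟩
  triple-cong refl refl refl = refl

  productForm-cong : ∀ {s s₁ t t₁ w w₁ v v₁} → s ≡ s₁ → t ≡ t₁ → w ≡ w₁ → v ≡ v₁ →
    productForm s t w v ≡ productForm s₁ t₁ w₁ v₁
  productForm-cong refl refl refl refl = refl

  -- The triples of f(x) and of f(-x) consist of sums and of differences of the same pairs of
  -- coefficients, so they agree modulo 2. Conversely the pair v + c + d and d - c has the sum v +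
  -- 2d and the difference v + 2c.
  realise : ∀ v v′ c c′ d d′ →
    InS-Q12 (productForm (v +2* d) (v′ +2* d′) (v +2* c) (v′ +2* c′))
  realise ⟨ v₀ , v₁ , v₂ ⟩ ⟨ v₀′ , v₁′ , v₂′ ⟩ ⟨ c₀ , c₁ , c₂ ⟩ ⟨ c₀′ , c₁′ , c₂′ ⟩
          ⟨ d₀ , d₁ , d₂ ⟩ ⟨ d₀′ , d₁′ , d₂′ ⟩ =
    f , trans (groupDet-product f) (productForm-cong
      (triple-cong (sum v₀ c₀ d₀) (sum′ v₁ c₁ d₁) (sum v₂ c₂ d₂))
      (triple-cong (sum v₀′ c₀′ d₀′) (sum′ v₁′ c₁′ d₁′) (sum v₂′ c₂′ d₂′))
      (triple-cong (diff v₀ c₀ d₀) (diff v₁ c₁ d₁) (diff v₂ c₂ d₂))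
      (triple-cong (diff v₀′ c₀′ d₀′) (diff v₁′ c₁′ d₁′) (diff v₂′ c₂′ d₂′)))
    where
    f : Q12 → ℤ
    f g = lookup (
      v₀  + c₀  + d₀  ∷ d₁  - c₁  ∷ v₂  + c₂  + d₂  ∷ d₀  - c₀  ∷ v₁  + c₁  + d₁  ∷ d₂  - c₂  ∷
      v₀′ + c₀′ + d₀′ ∷ d₁′ - c₁′ ∷ v₂′ + c₂′ + d₂′ ∷ d₀′ - c₀′ ∷ v₁′ + c₁′ + d₁′ ∷ d₂′ - c₂′ ∷
      []) (index g)
    sum : ∀ v c d → v + c + d + (d + - c) ≡ v + + 2 * d
    sum = solve-∀
    sum′ : ∀ v c d → d + - c + (v + c + d) ≡ v + + 2 * d
    sum′ = solve-∀
    diff : ∀ v c d → v + c + d + - (d + - c) ≡ v + + 2 * c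
    diff = solve-∀

  productForm-swap : ∀ s s′ w w′ → productForm s′ s w′ w ≡ - productForm s s′ w w′
  productForm-swap s s′ w w′ =
    swap (trace s) (trace s′) (trace w) (trace w′) (norm s) (norm s′) (norm w) (norm w′)
    where
    swap : ∀ a b c d e f g h →
      (b * b + - (a * a)) * (d * d + c * c) * ((f + - e) * (f + - e)) * ((h + g) * (h + g)) ≡
      - ((a * a + - (b * b)) * (c * c + d * d) * ((e + - f) * (e + - f)) * ((g + h) * (g + h)))
    swap = solve-∀

  -- Exchanging the variables of the two cosets of ⟨a⟩ negates N₁ and A, and A enters squared.
  InS-neg : ∀ {n} → InS-Q12 n → InS-Q12 (- n)
  InS-neg {n} (f , eq) = f ∘ exchange , (begin
    groupDet 12 Q12-enum Q12-mul Q12-inv (f ∘ exchange)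
      ≡⟨ groupDet-product (f ∘ exchange) ⟩
    productForm (tripleˢ′ f) (tripleˢ f) (tripleʷ′ f) (tripleʷ f)
      ≡⟨ productForm-swap (tripleˢ f) (tripleˢ′ f) (tripleʷ f) (tripleʷ′ f) ⟩
    - productForm (tripleˢ f) (tripleˢ′ f) (tripleʷ f) (tripleʷ′ f)
      ≡⟨ cong -_ (trans (sym (groupDet-product f)) eq) ⟩
    - n ∎)
    where
    exchange : Q12 → Q12
    exchange (i , zero)     = i , suc zero
    exchange (i , suc zero) = i , zero

  InS-neg⁻¹ : ∀ {n} → InS-Q12 (- n) → InS-Q12 n
  InS-neg⁻¹ {n} h = subst InS-Q12 (neg-involutive n) (InS-neg h)

  -- Adds k (1 + x + x²), which vanishes at ω; hence traces move and norms do not.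
  shift : Triple → ℤ → Triple
  shift ⟨ a , b , c ⟩ k = ⟨ a + k , b + k , c + k ⟩

  trace-shift : ∀ v d k → trace (v +2* shift d k) ≡ trace (v +2* d) + + 6 * k
  trace-shift ⟨ v₀ , v₁ , v₂ ⟩ ⟨ d₀ , d₁ , d₂ ⟩ k = expand v₀ v₁ v₂ d₀ d₁ d₂ k
    where
    expand : ∀ a b c d e f k → a + + 2 * (d + k) + (b + + 2 * (e + k)) + (c + + 2 * (f + k)) ≡
      a + + 2 * d + (b + + 2 * e) + (c + + 2 * f) + + 6 * k
    expand = solve-∀

  norm-shift : ∀ v d k → norm (v +2* shift d k) ≡ norm (v +2* d)
  norm-shift ⟨ v₀ , v₁ , v₂ ⟩ ⟨ d₀ , d₁ , d₂ ⟩ k = trans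
    (norm-cong (move v₀ d₀) (move v₁ d₁) (move v₂ d₂))
    (invariant (v₀ + + 2 * d₀) (v₁ + + 2 * d₁) (v₂ + + 2 * d₂) (+ 2 * k))
    where
    norm-cong : ∀ {a b c a′ b′ c′} → a ≡ a′ → b ≡ b′ → c ≡ c′ → norm ⟨ a , b , c ⟩ ≡ norm ⟨ a′ , b′ , c′ ⟩
    norm-cong refl refl refl = refl
    move : ∀ v d → v + + 2 * (d + k) ≡ v + + 2 * d + + 2 * k
    move v d = move′ v d k
      where
      move′ : ∀ v d k → v + + 2 * (d + k) ≡ v + + 2 * d + + 2 * k
      move′ = solve-∀
    invariant : ∀ a b c k →
      (a + k) * (a + k) + (b + k) * (b + k) + (c + k) * (c + k) +
        - ((a + k) * (b + k)) + - ((b + k) * (c + k)) + - ((c + k) * (a + k)) ≡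
      a * a + b * b + c * c + - (a * b) + - (b * c) + - (c * a)
    invariant = solve-∀

  -- The part N₂ B² of the product, which depends only on the triples of f(-x) and g(-x).
  weight : Triple → Triple → ℤ
  weight w w′ = (trace w * trace w + trace w′ * trace w′) * ((norm w + norm w′) * (norm w + norm w′))

  -- Both `d` and `d′` are shifted by the same `k`. The two traces grow by 6k each, so their
  -- difference stays and their sum grows by 12k.
  family : ∀ v v′ c c′ d d′ {a b r κ} →
    trace (v +2* d) ≡ a → trace (v′ +2* d′) ≡ b → norm (v +2* d) - norm (v′ +2* d′) ≡ r →
    weight (v +2* c) (v′ +2* c′) ≡ κ →
    ∀ k → InS-Q12 ((a - b) * (a + b + + 12 * k) * (r * r) * κ)
  family v v′ c c′ d d′ refl refl refl refl k = subst InS-Q12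
    (trans (productForm-unfold (v +2* shift d k) (v′ +2* shift d′ k)
        (trace-shift v d k) (trace-shift v′ d′ k) (cong₂ _-_ (norm-shift v d k) (norm-shift v′ d′ k)))
      (regroup (trace (v +2* d)) (trace (v′ +2* d′)) k
        (trace w * trace w + trace w′ * trace w′)
        (norm (v +2* d) - norm (v′ +2* d′)) (norm w + norm w′)))
    (realise v v′ c c′ (shift d k) (shift d′ k))
    where
    w = v +2* c
    w′ = v′ +2* c′
    productForm-unfold : ∀ s s′ {a b r} → trace s ≡ a → trace s′ ≡ b → norm s - norm s′ ≡ r →
      productForm s s′ w w′ ≡
      (a * a - b * b) * (trace w * trace w + trace w′ * trace w′) * (r * r) * ((norm w + norm w′) * (norm w + norm w′))
    productForm-unfold s s′ refl refl refl = refl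
    regroup : ∀ a b k c r e →
      ((a + + 6 * k) * (a + + 6 * k) + - ((b + + 6 * k) * (b + + 6 * k))) * c * (r * r) * (e * e) ≡
      (a + - b) * (a + b + + 12 * k) * (r * r) * (c * (e * e))
    regroup = solve-∀

  zeros e₁ ones : Triple
  zeros = ⟨ + 0 , + 0 , + 0 ⟩
  e₁ = ⟨ + 1 , + 0 , + 0 ⟩
  ones = ⟨ + 1 , + 1 , + 1 ⟩

  _≡±_ : ℤ → ℤ → Set
  a ≡± b = a ≡ b ⊎ - a ≡ b

  InS-± : ∀ {a b} → a ≡± b → InS-Q12 b → InS-Q12 a
  InS-± (inj₁ refl) h = h
  InS-± (inj₂ refl) h = InS-neg⁻¹ h

  Odd : ℤ → Set
  Odd u = ∃[ k ] u ≡ + 2 * k + + 1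

  -- Up to sign the integers prime to 3, and those prime to 6.
  Unit₃ Unit₆ : ℤ → Set
  Unit₃ u = ∃[ k ] u ≡± (+ 3 * k + + 1)
  Unit₆ u = ∃[ k ] u ≡± (+ 6 * k + + 1)

  parity : ∀ k → (∃[ j ] k ≡ + 2 * j) ⊎ (∃[ j ] k ≡ + 2 * j + + 1)
  parity k with k divℕ 2 | k modℕ 2 | a≡a%ℕn+[a/ℕn]*n k 2 | n%ℕd<d k 2
  ... | q | zero        | eq | _ = inj₁ (q , trans eq (trans (+-identityˡ (q * + 2)) (*-comm q (+ 2))))
  ... | q | suc zero    | eq | _ = inj₂ (q , trans eq (trans (+-comm (+ 1) (q * + 2)) (cong (_+ + 1) (*-comm q (+ 2)))))
  ... | q | suc (suc _) | _  | ℕ.s≤s (ℕ.s≤s ())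

  scale : ∀ c {u v} → u ≡± v → (c * u) ≡± (c * v)
  scale c (inj₁ refl) = inj₁ refl
  scale c {u} (inj₂ refl) = inj₂ (neg-distribʳ-* c u)

  ≡±-trans : ∀ {a b c} → a ≡± b → b ≡± c → a ≡± c
  ≡±-trans (inj₁ refl) h           = h
  ≡±-trans (inj₂ refl) (inj₁ refl) = inj₂ refl
  ≡±-trans {a} (inj₂ refl) (inj₂ refl) = inj₁ (sym (neg-involutive a))

  -- Here N₂ = B = 1 and A = ±1. The traces 1, 0 give N₁ = 1 + 12j. The traces 3, 2 give N₁ = 5 +
  -- 12j, which up to sign is the class of 7 modulo 12.
  InS-prime-to-6 : ∀ {u} → Unit₆ u → InS-Q12 u
  InS-prime-to-6 (k , u≡) = InS-± u≡ (by-parity (parity k))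
    where
    r₁ : ∀ j → (+ 1 + - + 0) * (+ 1 + + 0 + + 12 * j) * (+ 1 * + 1) * + 1 ≡ + 6 * (+ 2 * j) + + 1
    r₁ = solve-∀
    r₇ : ∀ j → (+ 3 + - + 2) * (+ 3 + + 2 + + 12 * (- j + - + 1)) * (- + 1 * - + 1) * + 1 ≡
      - (+ 6 * (+ 2 * j + + 1) + + 1)
    r₇ = solve-∀
    by-parity : (∃[ j ] k ≡ + 2 * j) ⊎ (∃[ j ] k ≡ + 2 * j + + 1) → InS-Q12 (+ 6 * k + + 1)
    by-parity (inj₁ (j , refl)) = subst InS-Q12 (r₁ j)
      (family e₁ zeros zeros zeros zeros zeros refl refl refl refl j)
    by-parity (inj₂ (j , refl)) = InS-neg⁻¹ (subst InS-Q12 (r₇ j)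
      (family e₁ zeros zeros zeros ⟨ + 0 , + 1 , + 0 ⟩ e₁ refl refl refl refl (- j + - + 1)))

  -- The traces 5, 4 and norms 1, 4 give N₁ = 3 (4j + 3) and A = -3; the class of 1 modulo 4 is
  -- reached by a change of sign.
  InS-27-odd : ∀ {u} → Odd u → InS-Q12 (+ 27 * u)
  InS-27-odd (k , refl) = by-parity (parity k)
    where
    r₁ : ∀ j → (+ 5 + - + 4) * (+ 5 + + 4 + + 12 * (- j + - + 1)) * (- + 3 * - + 3) * + 1 ≡
      - (+ 27 * (+ 2 * (+ 2 * j) + + 1))
    r₁ = solve-∀
    r₃ : ∀ j → (+ 5 + - + 4) * (+ 5 + + 4 + + 12 * j) * (- + 3 * - + 3) * + 1 ≡
      + 27 * (+ 2 * (+ 2 * j + + 1) + + 1)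
    r₃ = solve-∀
    nine : ∀ j → InS-Q12 ((+ 5 - + 4) * (+ 5 + + 4 + + 12 * j) * (- + 3 * - + 3) * + 1)
    nine = family e₁ zeros zeros zeros ⟨ + 0 , + 1 , + 1 ⟩ ⟨ + 1 , + 1 , + 0 ⟩ refl refl refl refl
    by-parity : (∃[ j ] k ≡ + 2 * j) ⊎ (∃[ j ] k ≡ + 2 * j + + 1) → InS-Q12 (+ 27 * (+ 2 * k + + 1))
    by-parity (inj₁ (j , refl)) = InS-neg⁻¹ (subst InS-Q12 (r₁ j) (nine (- j + - + 1)))
    by-parity (inj₂ (j , refl)) = subst InS-Q12 (r₃ j) (nine j)

  -- Trace 2 and norm 1. Starting from `e₂₃` and `zeros`, N₂ = 4 and B = 1, while both traces
  -- entering N₁ are even and so 4 divides N₁.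
  e₂₃ : Triple
  e₂₃ = ⟨ + 0 , + 1 , + 1 ⟩

  InS-16-prime-to-6 : ∀ {u} → Unit₆ u → InS-Q12 (+ 16 * u)
  InS-16-prime-to-6 (k , u≡) = InS-± (scale (+ 16) u≡) (subst InS-Q12 (identity k)
    (family e₂₃ zeros zeros zeros zeros zeros refl refl refl refl k))
    where
    identity : ∀ k → (+ 2 + - + 0) * (+ 2 + + 0 + + 12 * k) * (+ 1 * + 1) * + 4 ≡ + 16 * (+ 6 * k + + 1)
    identity = solve-∀

  InS-432-odd : ∀ {u} → Odd u → InS-Q12 (+ 16 * (+ 27 * u))
  InS-432-odd (k , refl) = subst InS-Q12 (identity k)
    (family e₂₃ zeros zeros zeros e₁ e₁ refl refl refl refl k)
    where
    identity : ∀ k → (+ 4 + - + 2) * (+ 4 + + 2 + + 12 * k) * (- + 3 * - + 3) * + 4 ≡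
      + 16 * (+ 27 * (+ 2 * k + + 1))
    identity = solve-∀

  InS-64-prime-to-3 : ∀ {u} → Unit₃ u → InS-Q12 (+ 64 * u)
  InS-64-prime-to-3 (k , u≡) = InS-± (scale (+ 64) u≡) (subst InS-Q12 (identity k)
    (family e₂₃ zeros zeros zeros e₁ zeros refl refl refl refl k))
    where
    identity : ∀ k → (+ 4 + - + 0) * (+ 4 + + 0 + + 12 * k) * (+ 1 * + 1) * + 4 ≡ + 64 * (+ 3 * k + + 1)
    identity = solve-∀

  -- The traces 2 and -2 cancel in the sum, so N₁ = 48u with no constant term; A = 1 - 4 = -3
  -- supplies the factor 9.
  InS-1728 : ∀ u → InS-Q12 (+ 64 * (+ 27 * u))
  InS-1728 u = subst InS-Q12 (identity u)
    (family e₂₃ zeros zeros zeros zeros ⟨ - + 1 , + 0 , + 0 ⟩ refl refl refl refl u)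
    where
    identity : ∀ k → (+ 2 + - - + 2) * (+ 2 + - + 2 + + 12 * k) * (- + 3 * - + 3) * + 4 ≡ + 64 * (+ 27 * k)
    identity = solve-∀

  -- The triples are congruent to (1, 0, 0) and (1, 1, 1) modulo 2, as needed to make N₁ = 16 m and A = 1 or -3.
  Weight : ℤ → Set
  Weight κ = ∃[ c ] ∃[ c′ ] weight (e₁ +2* c) (ones +2* c′) ≡ + 2 * κ

  InS-32-prime-to-3 : ∀ κ {u} → Weight κ → Unit₃ u → InS-Q12 (+ 32 * (κ * u))
  InS-32-prime-to-3 κ (c , c′ , wt) (k , u≡) = InS-± (scale (+ 32) (scale κ u≡)) (subst InS-Q12 (identity κ k)
    -- The shift is even so that the traces 5, 3 give N₁ = 2 (8 + 24k) = 16 (3k + 1); the norms 1, 0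
    -- give A = 1.
    (family e₁ ones c c′ ⟨ + 0 , + 1 , + 1 ⟩ zeros refl refl refl wt (+ 2 * k)))
    where
    identity : ∀ κ k → (+ 5 + - + 3) * (+ 5 + + 3 + + 12 * (+ 2 * k)) * (+ 1 * + 1) * (+ 2 * κ) ≡
      + 32 * (κ * (+ 3 * k + + 1))
    identity = solve-∀

  -- The traces 1 and -1 make N₁ = 48u, and the norms 1, 4 give A = -3.
  InS-864 : ∀ κ → Weight κ → ∀ u → InS-Q12 (+ 32 * (+ 27 * (κ * u)))
  InS-864 κ (c , c′ , wt) u = subst InS-Q12 (identity κ u)
    (family e₁ ones c c′ zeros ⟨ + 0 , - + 1 , - + 1 ⟩ refl refl refl wt (+ 2 * u))
    where
    identity : ∀ κ k → (+ 1 + - - + 1) * (+ 1 + - + 1 + + 12 * (+ 2 * k)) * (- + 3 * - + 3) * (+ 2 * κ) ≡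
      + 32 * (+ 27 * (κ * k))
    identity = solve-∀

  -- The triples (1, 2, 0) and (1, 1, 1): N₂ = 9 + 9 and B = 3.
  Weight-81 : Weight (+ 81)
  Weight-81 = ⟨ + 0 , + 1 , + 0 ⟩ , zeros , refl

  -- The triples (3, 4, 2) and (3, 3, 3): N₂ = 81 + 81 and B = 3.
  Weight-729 : Weight (+ 729)
  Weight-729 = ⟨ + 1 , + 2 , + 1 ⟩ , ones , refl

-- Primes congruent to 1 modulo 4 are sums of two squares.

module SumsOfTwoSquares where

  open import Data.Nat as ℕ using (ℕ; zero; suc; _+_; _*_; _∸_; _≤_; _<_; z≤n; s≤s; z<s; _%_; _/_)
  open import Data.Nat.Divisibility using (divides; m∣m*n)
  open import Data.Nat.DivMod using (m≡m%n+[m/n]*n; m*n%n≡0; [m+kn]%n≡m%n)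
  open import Data.Nat.Primality using (Prime; prime⇒irreducible; prime⇒nonZero; prime⇒nonTrivial)
  open import Data.Nat.Properties
  open import Data.Nat.Tactic.RingSolver using (solve-∀)
  open import Data.List using (List; []; _∷_; length; upTo; filter; cartesianProduct)
  open import Data.List.Membership.Propositional using (_∈_; _∉_; find; lose)
  open import Data.List.Membership.Propositional.Properties using (∈-cartesianProduct⁺; ∈-filter⁺; ∈-filter⁻; ∈-upTo⁺)
  open import Data.List.Relation.Unary.All using ([]; _∷_)
  open import Data.List.Relation.Unary.All.Properties using (All¬⇒¬Any; ¬Any⇒All¬)
  open import Data.List.Relation.Unary.AllPairs using ([]; _∷_)
  open import Data.List.Relation.Unary.Any using (here; there; any?)
  open import Data.List.Relation.Unary.Unique.Propositional using (Unique)
  open import Data.List.Relation.Unary.Unique.Propositional.Properties using (upTo⁺; cartesianProduct⁺; filter⁺)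
  open import Relation.Binary.Definitions using (tri<; tri≈; tri>)

  record Removal {A : Set} (x : A) (xs : List A) : Set where
    field
      rest    : List A
      split   : ∀ {z} → z ∈ xs → z ≡ x ⊎ z ∈ rest
      unsplit : ∀ {z} → z ∈ rest → z ∈ xs
      absent  : x ∉ rest
      unique  : Unique rest
      size    : length xs ≡ suc (length rest)

  removal : ∀ {A : Set} {x : A} {xs} → Unique xs → x ∈ xs → Removal x xs
  removal {xs = x ∷ xs} (x∉ ∷ u) (here refl) = record
    { rest    = xs
    ; split   = λ { (here eq) → inj₁ eq ; (there z∈) → inj₂ z∈ }
    ; unsplit = there
    ; absent  = All¬⇒¬Any x∉
    ; unique  = u
    ; size    = refl
    }
  removal {x = x} {xs = y ∷ xs} (y∉ ∷ u) (there x∈) = record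
    { rest    = y ∷ rest
    ; split   = λ { (here eq) → inj₂ (here eq) ; (there z∈) → split-there z∈ }
    ; unsplit = λ { (here eq) → here eq ; (there z∈) → there (unsplit z∈) }
    ; absent  = λ { (here refl) → All¬⇒¬Any y∉ x∈ ; (there x∈′) → absent x∈′ }
    ; unique  = ¬Any⇒All¬ rest (λ y∈ → All¬⇒¬Any y∉ (unsplit y∈)) ∷ unique
    ; size    = cong suc size
    }
    where
    open Removal (removal u x∈)
    split-there : ∀ {z} → z ∈ xs → z ≡ x ⊎ z ∈ y ∷ rest
    split-there z∈ with split z∈
    ... | inj₁ eq  = inj₁ eq
    ... | inj₂ z∈′ = inj₂ (there z∈′)

  Even Odd : ℕ → Set
  Even n = ∃[ k ] n ≡ 2 * k
  Odd  n = ∃[ k ] n ≡ 2 * k + 1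

  even-odd-absurd : ∀ {n} → Even n → ¬ Odd n
  even-odd-absurd (k , refl) (j , eq) = 0≢1+n (begin
    0                 ≡⟨ sym (m*n%n≡0 k 2) ⟩
    (k * 2) % 2       ≡⟨ cong (_% 2) (trans (*-comm k 2) (trans eq (trans (+-comm (2 * j) 1) (cong suc (*-comm 2 j))))) ⟩
    (1 + j * 2) % 2   ≡⟨ [m+kn]%n≡m%n 1 j 2 ⟩
    1                 ∎)
    where open ≡-Reasoning

  module Involution {A : Set} (R : A → A → Set)
    (symmetric : ∀ {x y} → R x y → R y x)
    (functional : ∀ {x y z} → R x y → R x z → y ≡ z) where

    Total : List A → Set
    Total xs = ∀ {x} → x ∈ xs → ∃[ y ] R x y × y ∈ xs

    remove-fixed : ∀ {x xs} → R x x → (rm : Removal x xs) → Total xs → Total (Removal.rest rm)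
    remove-fixed {x} Rxx rm total z∈ with total (unsplit z∈)
      where open Removal rm
    ... | w , Rzw , w∈ with Removal.split rm w∈
    ...   | inj₁ refl = contradiction (subst (_∈ Removal.rest rm) (functional (symmetric Rzw) Rxx) z∈)
                          (Removal.absent rm)
    ...   | inj₂ w∈′  = w , Rzw , w∈′

    -- Remove the head together with its partner: by symmetry and functionality the rest is still
    -- closed under `R`. The bound `n` makes the recursion structural, since removing the partner
    -- does not yield a sublist in the structural sense.
    even-of-fixed-point-free : ∀ n xs → length xs ≤ n → Unique xs → Total xs →
      (∀ {x} → x ∈ xs → ¬ R x x) → Even (length xs)
    even-of-fixed-point-free n [] _ _ _ _ = 0 , refl
    even-of-fixed-point-free (suc n) (x ∷ xs) (s≤s xs≤n) (x∉ ∷ u) total free with total (here refl)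
    ... | y , Rxy , here refl = contradiction Rxy (free (here refl))
    ... | y , Rxy , there y∈ = suc k , trans (cong suc (trans size (cong suc length≡))) (double k)
      where
      open Removal (removal u y∈)
      rest-total : Total rest
      rest-total z∈ with total (there (unsplit z∈))
      ... | w , Rzw , here refl = contradiction
              (subst (_∈ rest) (functional (symmetric Rzw) Rxy) z∈) absent
      ... | w , Rzw , there w∈ with split w∈
      ...   | inj₂ w∈′  = w , Rzw , w∈′
      ...   | inj₁ refl = contradiction
                (subst (_∈ xs) (functional (symmetric Rzw) (symmetric Rxy)) (unsplit z∈)) (All¬⇒¬Any x∉)
      ih : Even (length rest)
      ih = even-of-fixed-point-free n rest (≤-trans (n≤1+n _) (≤-trans (≤-reflexive (sym size)) xs≤n))
        unique rest-total (λ z∈ → free (there (unsplit z∈)))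
      k = proj₁ ih
      length≡ = proj₂ ih
      double : ∀ k → suc (suc (2 * k)) ≡ 2 * suc k
      double = solve-∀

    odd-of-one-fixed-point : ∀ xs → Unique xs → Total xs → ∀ {x} → x ∈ xs → R x x →
      (∀ {y} → y ∈ xs → R y y → y ≡ x) → Odd (length xs)
    odd-of-one-fixed-point xs u total {x} x∈ Rxx only = k , trans size (trans (cong suc length≡) (+-comm 1 (2 * k)))
      where
      rm = removal u x∈
      open Removal rm
      even-rest : Even (length rest)
      even-rest = even-of-fixed-point-free (length rest) rest ≤-refl unique (remove-fixed Rxx rm total)
        (λ z∈ Rzz → absent (subst (_∈ rest) (only (unsplit z∈) Rzz) z∈))
      k = proj₁ even-rest
      length≡ = proj₂ even-rest

  -- Zagier's involution on {(x , y , z) : x² + 4yz = p}, described by its graph.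
  ℕ³ : Set
  ℕ³ = ℕ × ℕ × ℕ

  data Zagier : ℕ³ → ℕ³ → Set where
    low  : ∀ {x y z x′ y′ z′} → x + z < y → x′ ≡ x + 2 * z → y′ ≡ z → x + z + z′ ≡ y →
           Zagier (x , y , z) (x′ , y′ , z′)
    mid  : ∀ {x y z x′ y′ z′} → y < x + z → x < 2 * y → x + x′ ≡ 2 * y → y′ ≡ y → x + z ≡ y + z′ →
           Zagier (x , y , z) (x′ , y′ , z′)
    high : ∀ {x y z x′ y′ z′} → 2 * y < x → x ≡ x′ + 2 * y → z′ ≡ y → x + z ≡ y + y′ →
           Zagier (x , y , z) (x′ , y′ , z′)

  triple≡ : ∀ {x y z x′ y′ z′ : ℕ} → x ≡ x′ → y ≡ y′ → z ≡ z′ → (x , y , z) ≡ (x′ , y′ , z′)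
  triple≡ refl refl refl = refl

  low-high : ∀ {x y z} → x + z < y → ¬ (2 * y < x)
  low-high {x} {y} {z} lo hi = <-irrefl refl (<-trans (<-≤-trans (≤-<-trans (m≤m+n x z) lo) (m≤m+n y _)) hi)

  Zagier-functional : ∀ {a b c} → Zagier a b → Zagier a c → b ≡ c
  Zagier-functional (low {x} {y} {z} _ e₁ e₂ e₃) (low _ f₁ f₂ f₃) =
    triple≡ (trans e₁ (sym f₁)) (trans e₂ (sym f₂)) (+-cancelˡ-≡ (x + z) _ _ (trans e₃ (sym f₃)))
  Zagier-functional (mid {x} {y} {z} _ _ e₁ e₂ e₃) (mid _ _ f₁ f₂ f₃) =
    triple≡ (+-cancelˡ-≡ x _ _ (trans e₁ (sym f₁))) (trans e₂ (sym f₂)) (+-cancelˡ-≡ y _ _ (trans (sym e₃) f₃))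
  Zagier-functional (high {x} {y} {z} _ e₁ e₂ e₃) (high _ f₁ f₂ f₃) =
    triple≡ (+-cancelʳ-≡ (2 * y) _ _ (trans (sym e₁) f₁)) (+-cancelˡ-≡ y _ _ (trans (sym e₃) f₃)) (trans e₂ (sym f₂))
  Zagier-functional (low lo _ _ _) (mid lo′ _ _ _ _)  = contradiction lo′ (<-asym lo)
  Zagier-functional (mid lo′ _ _ _ _) (low lo _ _ _)  = contradiction lo′ (<-asym lo)
  Zagier-functional (low {z = z} lo _ _ _) (high hi _ _ _)      = contradiction hi (low-high {z = z} lo)
  Zagier-functional (high hi _ _ _) (low {z = z} lo _ _ _)      = contradiction hi (low-high {z = z} lo)
  Zagier-functional (mid _ m _ _ _) (high hi _ _ _)   = contradiction hi (<-asym m)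
  Zagier-functional (high hi _ _ _) (mid _ m _ _ _)   = contradiction hi (<-asym m)

  Positive : ℕ³ → Set
  Positive (x , y , z) = 0 < x × 0 < y × 0 < z

  -- `low` and `high` are inverse to each other and `mid` is its own inverse. Positivity provides
  -- the strict inequalities of the target case.
  Zagier-sym : ∀ {a b} → Positive a → Zagier a b → Zagier b a
  Zagier-sym (x>0 , _) (low {x} {y} {z} {z′ = z′} lo refl refl refl) =
    high (m<n+m (2 * z) x>0) refl refl (reorder x z z′)
    where
    reorder : ∀ x z z′ → x + 2 * z + z′ ≡ z + (x + z + z′)
    reorder = solve-∀
  Zagier-sym {a} (x>0 , y>0 , z>0) (mid {x} {y} {z} {x′} {z′ = z′} lt₁ lt₂ e₁ refl e₃) =
    mid (≤-<-trans (≤-reflexive refl) y<x′+z′) (subst (x′ <_) e₁ (m<n+m x′ x>0))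
      (trans (+-comm x′ x) e₁) refl x′+z′≡y+z
    where
    sum : x + (x′ + z′) ≡ x + (y + z)
    sum = begin
      x + (x′ + z′) ≡⟨ sym (+-assoc x x′ z′) ⟩
      x + x′ + z′   ≡⟨ cong (_+ z′) e₁ ⟩
      2 * y + z′    ≡⟨ reorder y z′ ⟩
      y + (y + z′)  ≡⟨ cong (y +_) (sym e₃) ⟩
      y + (x + z)   ≡⟨ reorder′ x y z ⟩
      x + (y + z)   ∎
      where
      open ≡-Reasoning
      reorder : ∀ y z → 2 * y + z ≡ y + (y + z)
      reorder = solve-∀
      reorder′ : ∀ x y z → y + (x + z) ≡ x + (y + z)
      reorder′ = solve-∀
    x′+z′≡y+z : x′ + z′ ≡ y + z
    x′+z′≡y+z = +-cancelˡ-≡ x _ _ sum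
    y<x′+z′ : y < x′ + z′
    y<x′+z′ = subst (y <_) (sym x′+z′≡y+z) (m<m+n y z>0)
  Zagier-sym (x>0 , y>0 , z>0) (high {x} {y} {z} {x′} {y′} hi refl refl e₃) =
    low (subst (x′ + y <_) (sym y′≡) (subst (x′ + y <_) (+-assoc x′ y z) (m<m+n (x′ + y) z>0)))
      refl refl (trans (+-assoc x′ y z) (sym y′≡))
    where
    y′≡ : y′ ≡ x′ + (y + z)
    y′≡ = +-cancelˡ-≡ y _ _ (trans (sym e₃) (reorder x′ y z))
      where
      reorder : ∀ x y z → x + 2 * y + z ≡ y + (x + (y + z))
      reorder = solve-∀

  quadratic : ℕ³ → ℕ
  quadratic (x , y , z) = x * x + 4 * (y * z)

  Zagier-quadratic : ∀ {a b} → Zagier a b → quadratic b ≡ quadratic a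
  Zagier-quadratic (low {x} {y} {z} {z′ = z′} _ refl refl refl) = expand x z z′
    where
    expand : ∀ x z z′ → (x + 2 * z) * (x + 2 * z) + 4 * (z * z′) ≡ x * x + 4 * ((x + z + z′) * z)
    expand = solve-∀
  -- Adding 4y² to both sides keeps the computation in ℕ free of subtraction: `x′` and `z′` are
  -- known only through sums.
  Zagier-quadratic (mid {x} {y} {z} {x′} {z′ = z′} _ _ e₁ refl e₃) = +-cancelˡ-≡ (4 * (y * y)) _ _ (begin
    4 * (y * y) + (x′ * x′ + 4 * (y * z′))
      ≡⟨ regroup x′ y z′ ⟩
    x′ * x′ + 4 * (y * (y + z′))
      ≡⟨ cong (λ t → x′ * x′ + 4 * (y * t)) (sym e₃) ⟩
    x′ * x′ + 4 * (y * (x + z))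
      ≡⟨ regroup₂ x x′ y z ⟩
    x′ * x′ + 2 * (2 * y * x) + 4 * (y * z)
      ≡⟨ cong (λ t → x′ * x′ + 2 * (t * x) + 4 * (y * z)) (sym e₁) ⟩
    x′ * x′ + 2 * ((x + x′) * x) + 4 * (y * z)
      ≡⟨ regroup₃ x x′ (4 * (y * z)) ⟩
    (x + x′) * (x + x′) + (x * x + 4 * (y * z))
      ≡⟨ cong (λ t → t * t + (x * x + 4 * (y * z))) e₁ ⟩
    2 * y * (2 * y) + (x * x + 4 * (y * z))
      ≡⟨ cong (_+ (x * x + 4 * (y * z))) (four y) ⟩
    4 * (y * y) + (x * x + 4 * (y * z)) ∎)
    where
    open ≡-Reasoning
    regroup : ∀ x y z → 4 * (y * y) + (x * x + 4 * (y * z)) ≡ x * x + 4 * (y * (y + z))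
    regroup = solve-∀
    regroup₂ : ∀ x x′ y z → x′ * x′ + 4 * (y * (x + z)) ≡ x′ * x′ + 2 * (2 * y * x) + 4 * (y * z)
    regroup₂ = solve-∀
    regroup₃ : ∀ x x′ w → x′ * x′ + 2 * ((x + x′) * x) + w ≡ (x + x′) * (x + x′) + (x * x + w)
    regroup₃ = solve-∀
    four : ∀ y → 2 * y * (2 * y) ≡ 4 * (y * y)
    four = solve-∀
  Zagier-quadratic (high {x} {y} {z} {x′} {y′} hi refl refl e₃) = begin
    x′ * x′ + 4 * (y′ * y)
      ≡⟨ cong (λ t → x′ * x′ + 4 * (t * y)) y′≡ ⟩
    x′ * x′ + 4 * ((x′ + (y + z)) * y)
      ≡⟨ expand x′ y z ⟩
    (x′ + 2 * y) * (x′ + 2 * y) + 4 * (y * z) ∎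
    where
    open ≡-Reasoning
    reorder : ∀ x y z → x + 2 * y + z ≡ y + (x + (y + z))
    reorder = solve-∀
    y′≡ : y′ ≡ x′ + (y + z)
    y′≡ = +-cancelˡ-≡ y _ _ (trans (sym e₃) (reorder x′ y z))
    expand : ∀ x y z → x * x + 4 * ((x + (y + z)) * y) ≡ (x + 2 * y) * (x + 2 * y) + 4 * (y * z)
    expand = solve-∀

  module _ {p : ℕ} (p-prime : Prime p) (p%4≡1 : p % 4 ≡ 1) where

    Solution : ℕ³ → Set
    Solution a = quadratic a ≡ p

    instance
      p-nonZero = prime⇒nonZero p-prime
      p-nonTrivial = prime⇒nonTrivial p-prime

    p≡1+4k : ∃[ k ] p ≡ 1 + k * 4
    p≡1+4k = p / 4 , trans (m≡m%n+[m/n]*n p 4) (cong (_+ p / 4 * 4) p%4≡1)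

    1<p : 1 < p
    1<p = ℕ.nonTrivial⇒n>1 p

    p≢square : ∀ x → p ≢ x * x
    p≢square x refl with prime⇒irreducible p-prime (m∣m*n {x} x)
    ... | inj₁ refl = <-irrefl refl 1<p
    ... | inj₂ x≡xx = contradiction p-prime (go x x≡xx)
      where
      go : ∀ x → x ≡ x * x → ¬ Prime (x * x)
      go zero    _  pr = ℕ.≢-nonZero⁻¹ 0 ⦃ prime⇒nonZero pr ⦄ refl
      go (suc x) eq pr with *-cancelˡ-≡ 1 (suc x) (suc x) (trans (*-identityʳ (suc x)) eq)
      ... | refl = <-irrefl refl (ℕ.nonTrivial⇒n>1 1 ⦃ prime⇒nonTrivial pr ⦄)

    p≢4* : ∀ k → p ≢ 4 * k
    p≢4* k eq = 0≢1+n (begin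
      0           ≡⟨ sym (m*n%n≡0 k 4) ⟩
      (k * 4) % 4 ≡⟨ cong (_% 4) (trans (*-comm k 4) (sym eq)) ⟩
      p % 4       ≡⟨ p%4≡1 ⟩
      1           ∎)
      where open ≡-Reasoning

    -- A vanishing coordinate would make p a multiple of 4 or a perfect square.
    positive : ∀ a → Solution a → Positive a
    positive (zero , y , z) eq = contradiction (sym eq) (p≢4* (y * z))
    positive (suc x , zero , z) eq = contradiction (trans (sym eq) (+-identityʳ _)) (p≢square (suc x))
    positive (suc x , suc y , zero) eq =
      contradiction (trans (sym eq) (trans (cong (λ t → suc x * suc x + 4 * t) (*-zeroʳ (suc y))) (+-identityʳ _)))
        (p≢square (suc x))
    positive (suc x , suc y , suc z) _ = z<s , z<s , z<s

    -- The boundary cases x = y - z and x = 2y do not occur on solutions.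
    Zagier-total : ∀ a → Solution a → ∃[ b ] Zagier a b
    Zagier-total (x , y , z) sol with <-cmp (x + z) y
    ... | tri< lo _ _ = (x + 2 * z , z , y ∸ (x + z)) , low lo refl refl (m+[n∸m]≡n (<⇒≤ lo))
    ... | tri≈ _ refl _ = contradiction (trans (sym sol) (square x z)) (p≢square (x + 2 * z))
      where
      square : ∀ x z → x * x + 4 * ((x + z) * z) ≡ (x + 2 * z) * (x + 2 * z)
      square = solve-∀
    ... | tri> _ _ y<x+z with <-cmp x (2 * y)
    ...   | tri< x<2y _ _ = (2 * y ∸ x , y , x + z ∸ y) ,
              mid y<x+z x<2y (m+[n∸m]≡n (<⇒≤ x<2y)) refl (sym (m+[n∸m]≡n (<⇒≤ y<x+z)))
    ...   | tri≈ _ refl _ = contradiction (trans (sym sol) (fourfold y z)) (p≢4* (y * (y + z)))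
      where
      fourfold : ∀ y z → 2 * y * (2 * y) + 4 * (y * z) ≡ 4 * (y * (y + z))
      fourfold = solve-∀
    ...   | tri> _ _ 2y<x = (x ∸ 2 * y , x + z ∸ y , y) ,
              high 2y<x (sym (m∸n+n≡m (<⇒≤ 2y<x))) refl (sym (m+[n∸m]≡n (<⇒≤ y<x+z)))

    R flip : ℕ³ → ℕ³ → Set
    R a b = Solution a × Solution b × Zagier a b
    flip (x , y , z) b = b ≡ (x , z , y)

    solutions : List ℕ³
    solutions = filter (λ a → quadratic a ≟ p)
      (cartesianProduct (upTo (suc p)) (cartesianProduct (upTo (suc p)) (upTo (suc p))))

    solutions-unique : Unique solutions
    solutions-unique = filter⁺ (λ a → quadratic a ≟ p)
      (cartesianProduct⁺ (upTo⁺ (suc p)) (cartesianProduct⁺ (upTo⁺ (suc p)) (upTo⁺ (suc p))))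

    ∈⇒Solution : ∀ {a} → a ∈ solutions → Solution a
    ∈⇒Solution a∈ = proj₂ (∈-filter⁻ (λ a → quadratic a ≟ p)
      {xs = cartesianProduct (upTo (suc p)) (cartesianProduct (upTo (suc p)) (upTo (suc p)))} a∈)

    Solution⇒∈ : ∀ {a} → Solution a → a ∈ solutions
    Solution⇒∈ {a@(x , y , z)} sol with positive a sol
    ... | x>0 , y>0 , z>0 = ∈-filter⁺ (λ a → quadratic a ≟ p)
      (∈-cartesianProduct⁺ (∈-upTo⁺ (s≤s x≤p)) (∈-cartesianProduct⁺ (∈-upTo⁺ (s≤s y≤p)) (∈-upTo⁺ (s≤s z≤p)))) sol
      where
      yz≤p : y * z ≤ p
      yz≤p = ≤-trans (m≤n*m (y * z) 4) (≤-trans (m≤n+m (4 * (y * z)) (x * x)) (≤-reflexive sol))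
      x≤p : x ≤ p
      x≤p = ≤-trans (m≤m*n x x ⦃ ℕ.>-nonZero x>0 ⦄) (≤-trans (m≤m+n (x * x) _) (≤-reflexive sol))
      y≤p : y ≤ p
      y≤p = ≤-trans (m≤m*n y z ⦃ ℕ.>-nonZero z>0 ⦄) yz≤p
      z≤p : z ≤ p
      z≤p = ≤-trans (m≤n*m z y ⦃ ℕ.>-nonZero y>0 ⦄) yz≤p

    R-sym : ∀ {a b} → R a b → R b a
    R-sym {a} (sol , sol′ , r) = sol′ , sol , Zagier-sym (positive a sol) r

    R-functional : ∀ {a b c} → R a b → R a c → b ≡ c
    R-functional (_ , _ , r) (_ , _ , r′) = Zagier-functional r r′

    flip-sym : ∀ {a b} → flip a b → flip b a
    flip-sym refl = refl

    flip-functional : ∀ {a b c} → flip a b → flip a c → b ≡ c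
    flip-functional refl refl = refl

    module Z = Involution R R-sym R-functional
    module F = Involution flip flip-sym flip-functional

    R-total : Z.Total solutions
    R-total {a} a∈ with Zagier-total a (∈⇒Solution a∈)
    ... | b , r = b , (sol , sol′ , r) , Solution⇒∈ sol′
      where
      sol = ∈⇒Solution a∈
      sol′ = trans (Zagier-quadratic r) sol

    flip-total : F.Total solutions
    flip-total {x , y , z} a∈ = (x , z , y) , refl ,
      Solution⇒∈ (trans (cong (λ t → x * x + 4 * t) (*-comm z y)) (∈⇒Solution a∈))

    fixed : ℕ³
    fixed = 1 , 1 , proj₁ p≡1+4k

    fixed-solution : Solution fixed
    fixed-solution = trans (expand (proj₁ p≡1+4k)) (sym (proj₂ p≡1+4k))
      where
      expand : ∀ k → 1 * 1 + 4 * (1 * k) ≡ 1 + k * 4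
      expand = solve-∀

    fixed-fixed : R fixed fixed
    fixed-fixed = fixed-solution , fixed-solution ,
      mid (s≤s (proj₂ (proj₂ (positive fixed fixed-solution)))) (s≤s (s≤s z≤n)) refl refl refl

    -- In the outer two cases the first coordinate changes. A fixed point of `mid` has x = y, hence
    -- x divides p; x = p is too large, so x = 1.
    fixed-only : ∀ {a} → a ∈ solutions → R a a → a ≡ fixed
    fixed-only {x , y , z} a∈ (sol , _ , r) = go r
      where
      pos = positive (x , y , z) sol
      go : Zagier (x , y , z) (x , y , z) → (x , y , z) ≡ fixed
      go (low _ e _ _) = contradiction e (<⇒≢ (m<m+n x (≤-trans (proj₂ (proj₂ pos)) (m≤n*m z 2))))
      go (high _ e _ _) = contradiction e (<⇒≢ (m<m+n x (≤-trans (proj₁ (proj₂ pos)) (m≤n*m y 2))))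
      go (mid _ _ e _ _) with *-cancelˡ-≡ x y 2 (trans (cong (x +_) (+-identityʳ x)) e)
      ... | refl with prime⇒irreducible p-prime (divides (x + 4 * z) (trans (sym sol) (factor x z)))
        where
        factor : ∀ x z → x * x + 4 * (x * z) ≡ (x + 4 * z) * x
        factor = solve-∀
      ...   | inj₁ refl = triple≡ refl refl (*-cancelʳ-≡ _ _ 4 (suc-injective
                (trans (sym (expand z)) (trans sol (proj₂ p≡1+4k)))))
        where
        expand : ∀ k → 1 * 1 + 4 * (1 * k) ≡ 1 + k * 4
        expand = solve-∀
      ...   | inj₂ refl = contradiction (sym sol) (<⇒≢ (≤-<-trans (m≤m*n x x) (m<m+n (x * x)
                (≤-trans (*-mono-≤ (proj₁ (proj₂ pos)) (proj₂ (proj₂ pos))) (m≤n*m (x * z) 4)))))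

    solutions-odd : Odd (length solutions)
    solutions-odd = Z.odd-of-one-fixed-point solutions solutions-unique R-total
      (Solution⇒∈ fixed-solution) fixed-fixed fixed-only

    -- Zagier's involution shows that the number of solutions is odd, so the exchange of y and z has
    -- a fixed point as well, and there p = x² + (2y)².
    two-squares : ∃[ a ] ∃[ b ] p ≡ a * a + b * b
    two-squares with any? (λ { (x , y , z) → y ≟ z }) solutions
    ... | no none = contradiction solutions-odd (even-odd-absurd
            (F.even-of-fixed-point-free (length solutions) solutions ≤-refl solutions-unique flip-total
              (λ { {x , y , z} a∈ refl → none (lose a∈ refl) })))
    ... | yes some with find some
    ...   | (x , y , .y) , a∈ , refl = x , 2 * y , trans (sym (∈⇒Solution a∈)) (expand x y)
      where
      expand : ∀ x y → x * x + 4 * (y * y) ≡ x * x + 2 * y * (2 * y)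
      expand = solve-∀

-- Primes as sums of two norms from ℤ[ω].

module EisensteinNorms where

  open import Data.Nat as ℕ using (ℕ; suc; NonZero; _<_; _≤_; z<s; s<s; z≤n; s≤s; _%_; _∸_)
  import Data.Nat.Properties as ℕ
  import Data.Nat.Divisibility as ℕ
  import Data.Nat.Tactic.RingSolver as ℕ-solver
  open import Data.Nat.DivMod using (m≡m%n+[m/n]*n; m%n<n; %-distribˡ-+; m*n%n≡0)
  open import Data.Nat.Induction using (<-rec)
  open import Data.Nat.Primality using (Prime; euclidsLemma; prime⇒irreducible; prime⇒nonZero)
  open import Data.Fin using (Fin; toℕ; splitAt; join; fromℕ<)
  open import Data.Fin.Properties using (pigeonhole; toℕ-injective; toℕ<n; toℕ-fromℕ<; join-splitAt)
  open import Data.Integer using (ℤ; +_; -[1+_]; -_; _+_; _*_; _-_; ∣_∣)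
  open import Data.Integer.DivMod using (a≡a%ℕn+[a/ℕn]*n; n%ℕd<d) renaming (_/ℕ_ to _divℕ_; _%ℕ_ to _modℕ_)
  open import Data.Integer.Properties
  open import Data.Integer.Tactic.RingSolver using (solve-∀; ring)
  import Tactic.RingSolver.NonReflective as RingExpr
  open import Relation.Binary.Definitions using (tri<; tri≈; tri>)

  square≡+ : ∀ z → z * z ≡ + (∣ z ∣ ℕ.* ∣ z ∣)
  square≡+ (+ n)    = sym (pos-* n n)
  square≡+ -[1+ n ] = refl

  -- The norm of u + vω.
  N : ℤ → ℤ → ℤ
  N u v = u * u - u * v + v * v

  Rep : ℕ → Set
  Rep k = ∃[ a ] ∃[ b ] ∃[ c ] ∃[ d ] + k ≡ N a b + N c d

  positive-multiple : ∀ m .⦃ _ : NonZero m ⦄ x n → + m * x ≡ + n → ∃[ y ] x ≡ + y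
  positive-multiple (suc k) (+ y)    n eq = y , refl
  positive-multiple (suc k) -[1+ y ] n ()

  4N : ∀ u v → + 4 * N u v ≡ (+ 2 * u - v) * (+ 2 * u - v) + + 3 * (v * v)
  4N = expand
    where
    expand : ∀ u v → + 4 * (u * u + - (u * v) + v * v) ≡ (+ 2 * u + - v) * (+ 2 * u + - v) + + 3 * (v * v)
    expand = solve-∀

  4N≡+ : ∀ u v → + 4 * N u v ≡ + (∣ + 2 * u - v ∣ ℕ.* ∣ + 2 * u - v ∣ ℕ.+ 3 ℕ.* (∣ v ∣ ℕ.* ∣ v ∣))
  4N≡+ u v = trans (4N u v) (cong₂ _+_ (square≡+ (+ 2 * u - v))
    (trans (cong (+ 3 *_) (square≡+ v)) (sym (pos-* 3 (∣ v ∣ ℕ.* ∣ v ∣)))))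

  N-natural : ∀ u v → ∃[ k ] N u v ≡ + k
  N-natural u v = positive-multiple 4 (N u v) _ (4N≡+ u v)

  N≡0 : ∀ u v → N u v ≡ + 0 → u ≡ + 0 × v ≡ + 0
  N≡0 u v eq = u≡0 , v≡0
    where
    open ≡-Reasoning
    square≡0 : ∀ z → ∣ z ∣ ℕ.* ∣ z ∣ ≡ 0 → z ≡ + 0
    square≡0 z eq = ∣i∣≡0⇒i≡0 ([ (λ e → e) , (λ e → e) ]′ (ℕ.m*n≡0⇒m≡0∨n≡0 ∣ z ∣ eq))
    sum≡0 : ∣ + 2 * u - v ∣ ℕ.* ∣ + 2 * u - v ∣ ℕ.+ 3 ℕ.* (∣ v ∣ ℕ.* ∣ v ∣) ≡ 0
    sum≡0 = +-injective (trans (sym (4N≡+ u v)) (cong (+ 4 *_) eq))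
    v≡0 : v ≡ + 0
    v≡0 = square≡0 v ([ (λ ()) , (λ e → e) ]′
      (ℕ.m*n≡0⇒m≡0∨n≡0 3 (ℕ.m+n≡0⇒n≡0 (∣ + 2 * u - v ∣ ℕ.* ∣ + 2 * u - v ∣) sum≡0)))
    u≡0 : u ≡ + 0
    u≡0 = square≡0 u (+-injective (begin
      + (∣ u ∣ ℕ.* ∣ u ∣)          ≡⟨ sym (square≡+ u) ⟩
      u * u                       ≡⟨ drop u ⟩
      u * u + - (u * + 0) + + 0 * + 0   ≡⟨ cong (λ t → u * u + - (u * t) + t * t) (sym v≡0) ⟩
      N u v                       ≡⟨ eq ⟩
      + 0                         ∎))
      where
      drop : ∀ u → u * u ≡ u * u + - (u * + 0) + + 0 * + 0
      drop = solve-∀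

  -- A balanced remainder of `t` modulo 2m: writing m² as its square plus a natural number expresses
  -- that it is at most m in absolute value.
  centred : ∀ m .⦃ _ : NonZero m ⦄ t →
    ∃[ k ] ∃[ e ] + m * + m ≡ (t + + 2 * + m * k) * (t + + 2 * + m * k) + + e
  -- With r the remainder of t + m modulo 2m, the balanced one is r - m, and m² - (r - m)² = r (2m -
  -- r) = r s.
  centred m@(suc _) t = - q , r ℕ.* s , (begin
    + m * + m
      ≡⟨ complete-square (+ m) (+ r) ⟩
    (+ r + - + m) * (+ r + - + m) + + r * (+ 2 * + m + - + r)
      ≡⟨ cong₂ (λ x y → x * x + + r * y) (sym t≡) 2m-r ⟩
    (t + + 2 * + m * - q) * (t + + 2 * + m * - q) + + r * + s
      ≡⟨ cong (λ y → (t + + 2 * + m * - q) * (t + + 2 * + m * - q) + y) (sym (pos-* r s)) ⟩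
    (t + + 2 * + m * - q) * (t + + 2 * + m * - q) + + (r ℕ.* s) ∎)
    where
    open ≡-Reasoning
    r = (t + + m) modℕ (2 ℕ.* m)
    q = (t + + m) divℕ (2 ℕ.* m)
    s = 2 ℕ.* m ∸ r
    2m-r : + 2 * + m + - + r ≡ + s
    2m-r = trans (cong (λ z → z + - + r) (sym (pos-* 2 m)))
      (trans (m-n≡m⊖n (2 ℕ.* m) r) (⊖-≥ (ℕ.<⇒≤ (n%ℕd<d (t + + m) (2 ℕ.* m)))))
    division : t + + m ≡ + r + q * (+ 2 * + m)
    division = trans (a≡a%ℕn+[a/ℕn]*n (t + + m) (2 ℕ.* m)) (cong (λ z → + r + q * z) (pos-* 2 m))
    t≡ : t + + 2 * + m * - q ≡ + r + - + m
    t≡ = begin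
      t + + 2 * + m * - q                         ≡⟨ insert t (+ m) q ⟩
      (t + + m) + - (q * (+ 2 * + m)) + - + m     ≡⟨ cong (λ z → z + - (q * (+ 2 * + m)) + - + m) division ⟩
      (+ r + q * (+ 2 * + m)) + - (q * (+ 2 * + m)) + - + m ≡⟨ cancel (+ r) (q * (+ 2 * + m)) (+ m) ⟩
      + r + - + m ∎
      where
      insert : ∀ t m q → t + + 2 * m * - q ≡ (t + m) + - (q * (+ 2 * m)) + - m
      insert = solve-∀
      cancel : ∀ r x m → (r + x) + - x + - m ≡ r + - m
      cancel = solve-∀
    complete-square : ∀ m r → m * m ≡ (r + - m) * (r + - m) + r * (+ 2 * m + - r)
    complete-square = solve-∀

  record Reduction (m : ℕ) (u v : ℤ) : Set where
    field
      u′ v′ g h : ℤ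
      excess    : ℕ
      u≡        : u ≡ u′ + + m * g
      v≡        : v ≡ v′ + + m * h
      bound     : + 7 * (+ m * + m) ≡ + 16 * N u′ v′ + + excess

  -- By `4N` it suffices to centre 2v′ and then 2u′ - v′, both modulo 2m: this gives 16 N = 4 (2u′ -
  -- v′)² + 3 (2v′)² ≤ 7m². Two such norms add up to at most 14/16 of m², which is less than m².
  reduce : ∀ m .⦃ _ : NonZero m ⦄ u v → Reduction m u v
  reduce m u v with centred m (+ 2 * v)
  ... | k₁ , e₁ , eq₁ with centred m (+ 2 * u - (v + + m * k₁))
  ...   | k₂ , e₂ , eq₂ = record
    { u′ = u + + m * k₂ ; v′ = v + + m * k₁ ; g = - k₂ ; h = - k₁ ; excess = 4 ℕ.* e₂ ℕ.+ 3 ℕ.* e₁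
    ; u≡ = undo u (+ m) k₂ ; v≡ = undo v (+ m) k₁
    ; bound = begin
        + 7 * (+ m * + m)
          ≡⟨ seven (+ m * + m) ⟩
        + 4 * (+ m * + m) + + 3 * (+ m * + m)
          ≡⟨ cong₂ (λ x y → + 4 * x + + 3 * y) eq₂ eq₁ ⟩
        + 4 * ((+ 2 * u - (v + + m * k₁) + + 2 * + m * k₂) * (+ 2 * u - (v + + m * k₁) + + 2 * + m * k₂) + + e₂) +
          + 3 * ((+ 2 * v + + 2 * + m * k₁) * (+ 2 * v + + 2 * + m * k₁) + + e₁)
          ≡⟨ collect u v (+ m) k₁ k₂ (+ e₁) (+ e₂) ⟩
        + 16 * N (u + + m * k₂) (v + + m * k₁) + (+ 4 * + e₂ + + 3 * + e₁)
          ≡⟨ cong (_+_ (+ 16 * N (u + + m * k₂) (v + + m * k₁)))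
               (sym (cong₂ _+_ (pos-* 4 e₂) (pos-* 3 e₁))) ⟩
        + 16 * N (u + + m * k₂) (v + + m * k₁) + + (4 ℕ.* e₂ ℕ.+ 3 ℕ.* e₁) ∎
    }
    where
    open ≡-Reasoning
    undo : ∀ u m k → u ≡ u + m * k + m * - k
    undo = solve-∀
    seven : ∀ x → + 7 * x ≡ + 4 * x + + 3 * x
    seven = solve-∀
    collect : ∀ u v m k₁ k₂ e₁ e₂ →
      + 4 * ((+ 2 * u + - (v + m * k₁) + + 2 * m * k₂) * (+ 2 * u + - (v + m * k₁) + + 2 * m * k₂) + e₂) +
        + 3 * ((+ 2 * v + + 2 * m * k₁) * (+ 2 * v + + 2 * m * k₁) + e₁) ≡
      + 16 * ((u + m * k₂) * (u + m * k₂) + - ((u + m * k₂) * (v + m * k₁)) + (v + m * k₁) * (v + m * k₁)) +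
        (+ 4 * e₂ + + 3 * e₁)
    collect = solve-∀

  -- The polar form of the norm, the trace of αγ̄ for α = a + bω and γ = g + hω.
  cross : (a b g h : ℤ) → ℤ
  cross a b g h = + 2 * (a * g) - a * h - b * g + + 2 * (b * h)

  cross-0 : ∀ {a b} g h → a ≡ + 0 → b ≡ + 0 → cross a b g h ≡ + 0
  cross-0 g h refl refl = refl

  N-shift : ∀ m a b g h → N (a + m * g) (b + m * h) ≡ N a b + m * (cross a b g h + m * N g h)
  N-shift = expand
    where
    expand : ∀ m a b g h → (a + m * g) * (a + m * g) + - ((a + m * g) * (b + m * h)) + (b + m * h) * (b + m * h) ≡
      a * a + - (a * b) + b * b + m * (+ 2 * (a * g) + - (a * h) + - (b * g) + + 2 * (b * h) +
        m * (g * g + - (g * h) + h * h))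
    expand = solve-∀

  -- With α = a + bω, β = c + dω, γ = g + hω, δ = i + jω: N(M + γᾱ + δβ̄) + N(γβ - δα).
  norm-product : ∀ M a b c d g h i j →
    N (M + (g * a - g * b + h * b) + (i * c - i * d + j * d)) (h * a - g * b + (j * c - i * d)) +
    N (g * c - h * d - (i * a - j * b)) (g * d + h * c - h * d - (i * b + j * a - j * b)) ≡
    M * (M + (cross a b g h + cross c d i j)) + (N g h + N i j) * (N a b + N c d)
  norm-product M a b c d g h i j = solve-expr 9 (λ M a b c d g h i j →
    let _⊖_ : ∀ {n} → Expr ℤ n → Expr ℤ n → Expr ℤ n
        x ⊖ y = x ⊕ (⊝ y)
        n u v = ((u ⊗ u) ⊖ (u ⊗ v)) ⊕ (v ⊗ v)
        cr a b g h = (((Κ (+ 2) ⊗ (a ⊗ g)) ⊖ (a ⊗ h)) ⊖ (b ⊗ g)) ⊕ (Κ (+ 2) ⊗ (b ⊗ h))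
    in
    (n ((M ⊕ (((g ⊗ a) ⊖ (g ⊗ b)) ⊕ (h ⊗ b))) ⊕ (((i ⊗ c) ⊖ (i ⊗ d)) ⊕ (j ⊗ d)))
       (((h ⊗ a) ⊖ (g ⊗ b)) ⊕ ((j ⊗ c) ⊖ (i ⊗ d))) ⊕
     n (((g ⊗ c) ⊖ (h ⊗ d)) ⊖ ((i ⊗ a) ⊖ (j ⊗ b)))
       ((((g ⊗ d) ⊕ (h ⊗ c)) ⊖ (h ⊗ d)) ⊖ (((i ⊗ b) ⊕ (j ⊗ a)) ⊖ (j ⊗ b))))
    ⊜ ((M ⊗ (M ⊕ (cr a b g h ⊕ cr c d i j))) ⊕ ((n g h ⊕ n i j) ⊗ (n a b ⊕ n c d))))
    refl M a b c d g h i j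
    where
    open RingExpr ring using (Expr; Κ; _⊕_; _⊗_; ⊝_; _⊜_) renaming (solve to solve-expr)

  natural-sum : ∀ a b c d → ∃[ k ] N a b + N c d ≡ + k
  natural-sum a b c d with N-natural a b | N-natural c d
  ... | k , eq | l , eq′ = k ℕ.+ l , cong₂ _+_ eq eq′

  N-sum≡0 : ∀ a b c d → N a b + N c d ≡ + 0 → (a ≡ + 0 × b ≡ + 0) × (c ≡ + 0 × d ≡ + 0)
  N-sum≡0 a b c d eq with N-natural a b | N-natural c d
  ... | k , eq₁ | l , eq₂ =
    N≡0 a b (trans eq₁ (cong +_ (ℕ.m+n≡0⇒m≡0 k sum≡0))) , N≡0 c d (trans eq₂ (cong +_ (ℕ.m+n≡0⇒n≡0 k sum≡0)))
    where
    sum≡0 : k ℕ.+ l ≡ 0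
    sum≡0 = +-injective (trans (sym (cong₂ _+_ eq₁ eq₂)) eq)

  record Decrease (m p : ℕ) : Set where
    field
      m′     : ℕ
      m′>0   : 0 < m′
      m′<m   : m′ < m
      rep    : Rep (m′ ℕ.* p)

  -- One step of the descent. The given pair is α + mγ, β + mδ with α = a + bω and β = c + dω
  -- reduced modulo m. Then m divides S = N(α) + N(β), and the new multiplier is the quotient, which
  -- equals `X`.
  module Step {p : ℕ} (p-prime : Prime p) (m : ℕ) (1<m : 1 < m) (m<p : m < p)
    (a b c d g h i j : ℤ) (e f : ℕ)
    (mp≡ : + (m ℕ.* p) ≡ N (a + + m * g) (b + + m * h) + N (c + + m * i) (d + + m * j))
    (boundᵅ : + 7 * (+ m * + m) ≡ + 16 * N a b + + e) (boundᵝ : + 7 * (+ m * + m) ≡ + 16 * N c d + + f) where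

    instance
      m-nonZero : NonZero m
      m-nonZero = ℕ.>-nonZero (ℕ.<-trans z<s 1<m)

    open ≡-Reasoning

    T Q S X : ℤ
    T = cross a b g h + cross c d i j
    Q = N g h + N i j
    S = N a b + N c d
    X = + p + - (T + + m * Q)

    mp≡S+ : + m * + p ≡ S + + m * (T + + m * Q)
    mp≡S+ = trans (sym (pos-* m p)) (trans mp≡ (trans
      (cong₂ _+_ (N-shift (+ m) a b g h) (N-shift (+ m) c d i j))
      (collect (N a b) (N c d) (+ m) (cross a b g h) (cross c d i j) (N g h) (N i j))))
      where
      collect : ∀ x y m t u q r → (x + m * (t + m * q)) + (y + m * (u + m * r)) ≡
        x + y + m * (t + u + m * (q + r))
      collect = solve-∀

    mX≡S : + m * X ≡ S
    mX≡S = solve-for (+ m) (+ p) S (T + + m * Q) mp≡S+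
      where
      solve-for : ∀ m p s t → m * p ≡ s + m * t → m * (p + - t) ≡ s
      solve-for m p s t eq = trans (distrib m p t) (trans (cong (_+ - (m * t)) eq) (cancel s (m * t)))
        where
        distrib : ∀ m p t → m * (p + - t) ≡ m * p + - (m * t)
        distrib = solve-∀
        cancel : ∀ s t → s + t + - t ≡ s
        cancel = solve-∀

    X-natural : ∃[ y ] X ≡ + y
    X-natural = positive-multiple m X (proj₁ (natural-sum a b c d)) (trans mX≡S (proj₂ (natural-sum a b c d)))

    module WithQuotient (m′ : ℕ) (X≡m′ : X ≡ + m′) where

      mm′≡S : + m * + m′ ≡ S
      mm′≡S = trans (cong (+ m *_) (sym X≡m′)) mX≡S

      p≡ : + p ≡ + m′ + (T + + m * Q)
      p≡ = trans (restore (+ p) (T + + m * Q)) (cong (_+ (T + + m * Q)) X≡m′)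
        where
        restore : ∀ p t → p ≡ (p + - t) + t
        restore = solve-∀

      -- From S = m m′ and p = m′ + T + mQ, the right side of `norm-product` at M = m′ becomes m′
      -- (m′ + T) + Q S = m′ p.
      rep : Rep (m′ ℕ.* p)
      rep = + m′ + (g * a - g * b + h * b) + (i * c - i * d + j * d) , h * a - g * b + (j * c - i * d) ,
        g * c - h * d - (i * a - j * b) , g * d + h * c - h * d - (i * b + j * a - j * b) ,
        trans (pos-* m′ p) (trans
          (assemble (+ m′) T Q (+ m) S (+ p) mm′≡S p≡) (sym (norm-product (+ m′) a b c d g h i j)))
        where
        assemble : ∀ M T Q m S p → m * M ≡ S → p ≡ M + (T + m * Q) → M * p ≡ M * (M + T) + Q * S
        assemble M T Q m _ _ refl refl = factor M T Q m
          where
          factor : ∀ M T Q m → M * (M + (T + m * Q)) ≡ M * (M + T) + Q * (m * M)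
          factor = solve-∀

      -- The sum of the two bounds. It leaves no room for m′ ≥ m, as 16m² exceeds 14m².
      14mm≡ : 14 ℕ.* (m ℕ.* m) ≡ 16 ℕ.* (m ℕ.* m′) ℕ.+ (e ℕ.+ f)
      14mm≡ = +-injective (begin
        + (14 ℕ.* (m ℕ.* m))
          ≡⟨ trans (pos-* 14 (m ℕ.* m)) (cong (+ 14 *_) (pos-* m m)) ⟩
        + 14 * (+ m * + m)
          ≡⟨ add (+ m * + m) (N a b) (N c d) (+ e) (+ f) boundᵅ boundᵝ ⟩
        + 16 * S + (+ e + + f)
          ≡⟨ cong (λ z → + 16 * z + (+ e + + f)) (trans (sym mm′≡S) (sym (pos-* m m′))) ⟩
        + 16 * + (m ℕ.* m′) + (+ e + + f)
          ≡⟨ cong (_+ (+ e + + f)) (sym (pos-* 16 (m ℕ.* m′))) ⟩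
        + (16 ℕ.* (m ℕ.* m′) ℕ.+ (e ℕ.+ f)) ∎)
        where
        add : ∀ m x y e f → + 7 * m ≡ + 16 * x + e → + 7 * m ≡ + 16 * y + f →
          + 14 * m ≡ + 16 * (x + y) + (e + f)
        add m x y e f eq₁ eq₂ = trans (double m) (trans (cong₂ _+_ eq₁ eq₂) (gather x y e f))
          where
          double : ∀ x → + 14 * x ≡ + 7 * x + + 7 * x
          double = solve-∀
          gather : ∀ x y e f → (+ 16 * x + e) + (+ 16 * y + f) ≡ + 16 * (x + y) + (e + f)
          gather = solve-∀

      m′<m : m′ < m
      m′<m with m′ ℕ.<? m
      ... | yes lt = lt
      ... | no ≮ = contradiction
        (ℕ.≤-trans (ℕ.*-monoʳ-≤ 16 (ℕ.*-monoʳ-≤ m (ℕ.≮⇒≥ ≮)))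
          (ℕ.≤-trans (ℕ.m≤m+n (16 ℕ.* (m ℕ.* m′)) (e ℕ.+ f)) (ℕ.≤-reflexive (sym 14mm≡))))
        (ℕ.<⇒≱ (ℕ.*-monoˡ-< (m ℕ.* m) ⦃ ℕ.m*n≢0 m m ⦄ (ℕ.m<m+n 14 {2} z<s)))

      -- If m′ = 0, both reduced elements vanish, hence T = 0 and p = mQ, contrary to 1 < m < p.
      m′≢0 : m′ ≢ 0
      m′≢0 m′≡0 = [ (λ m≡1 → ℕ.<⇒≢ 1<m (sym m≡1)) , ℕ.<⇒≢ m<p ]′
        (prime⇒irreducible p-prime {m} (ℕ.divides {m} {p} ∣ Q ∣ p≡Qm))
        where
        S≡0 : S ≡ + 0
        S≡0 = trans (sym mm′≡S) (trans (cong (λ z → + m * + z) m′≡0) (*-zeroʳ (+ m)))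
        vanish : T ≡ + 0
        vanish = let (a≡0 , b≡0) , (c≡0 , d≡0) = N-sum≡0 a b c d S≡0
          in cong₂ _+_ (cross-0 g h a≡0 b≡0) (cross-0 i j c≡0 d≡0)
        p≡mQ : + p ≡ + m * Q
        p≡mQ = drop (+ p) (+ m * Q) p≡ (cong +_ m′≡0) vanish
          where
          drop : ∀ P R {M T} → P ≡ M + (T + R) → M ≡ + 0 → T ≡ + 0 → P ≡ R
          drop P R eq refl refl = trans eq (trans (+-identityˡ (+ 0 + R)) (+-identityˡ R))
        p≡Qm : p ≡ ∣ Q ∣ ℕ.* m
        p≡Qm = trans (cong ∣_∣ p≡mQ) (trans (abs-* (+ m) Q) (ℕ.*-comm m ∣ Q ∣))

      decreased : Decrease m p
      decreased = record { m′ = m′ ; m′>0 = ℕ.n≢0⇒n>0 m′≢0 ; m′<m = m′<m ; rep = rep }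

    decrease : Decrease m p
    decrease = let m′ , X≡m′ = X-natural in WithQuotient.decreased m′ X≡m′

  module _ {p : ℕ} (p-prime : Prime p) (m : ℕ) (1<m : 1 < m) (m<p : m < p) where

    descent-reduced : ∀ {α₁ α₂ β₁ β₂} → Reduction m α₁ α₂ → Reduction m β₁ β₂ →
      + (m ℕ.* p) ≡ N α₁ α₂ + N β₁ β₂ → Decrease m p
    descent-reduced
      record { u′ = a ; v′ = b ; g = g ; h = h ; excess = e ; u≡ = refl ; v≡ = refl ; bound = boundᵅ }
      record { u′ = c ; v′ = d ; g = i ; h = j ; excess = f ; u≡ = refl ; v≡ = refl ; bound = boundᵝ } mp≡ =
      Step.decrease p-prime m 1<m m<p a b c d g h i j e f mp≡ boundᵅ boundᵝ

    descent-step : Rep (m ℕ.* p) → Decrease m p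
    descent-step (α₁ , α₂ , β₁ , β₂ , mp≡) =
      descent-reduced (reduce m ⦃ m≢0 ⦄ α₁ α₂) (reduce m ⦃ m≢0 ⦄ β₁ β₂) mp≡
      where m≢0 = ℕ.>-nonZero (ℕ.<-trans z<s 1<m)

  descend : ∀ {p} → Prime p → ∀ m → 0 < m → m < p → Rep (m ℕ.* p) → Rep p
  descend {p} p-prime = <-rec (λ m → 0 < m → m < p → Rep (m ℕ.* p) → Rep p) step
    where
    step : ∀ m → (∀ {k} → k < m → 0 < k → k < p → Rep (k ℕ.* p) → Rep p) →
      0 < m → m < p → Rep (m ℕ.* p) → Rep p
    step 1             rec _ _   rep = subst Rep (ℕ.+-identityʳ p) rep
    step (suc (suc k)) rec _ m<p rep = rec D.m′<m D.m′>0 (ℕ.<-trans D.m′<m m<p) D.rep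
      where module D = Decrease (descent-step p-prime (suc (suc k)) (s<s z<s) m<p rep)

  %-eq⇒∣ : ∀ p .⦃ _ : NonZero p ⦄ a c → a % p ≡ (a ℕ.+ c) % p → p ℕ.∣ c
  %-eq⇒∣ p a c eq = ℕ.∣m+n∣m⇒∣n (ℕ.divides ((a ℕ.+ c) ℕ./ p) (ℕ.+-cancelˡ-≡ (a % p) _ _ (begin
    a % p ℕ.+ (a ℕ./ p ℕ.* p ℕ.+ c)              ≡⟨ sym (ℕ.+-assoc (a % p) _ c) ⟩
    a % p ℕ.+ a ℕ./ p ℕ.* p ℕ.+ c                ≡⟨ cong (ℕ._+ c) (sym (m≡m%n+[m/n]*n a p)) ⟩
    a ℕ.+ c                                      ≡⟨ m≡m%n+[m/n]*n (a ℕ.+ c) p ⟩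
    (a ℕ.+ c) % p ℕ.+ (a ℕ.+ c) ℕ./ p ℕ.* p      ≡⟨ cong (ℕ._+ (a ℕ.+ c) ℕ./ p ℕ.* p) (sym eq) ⟩
    a % p ℕ.+ (a ℕ.+ c) ℕ./ p ℕ.* p              ∎))) (ℕ.n∣m*n (a ℕ./ p))
    where open ≡-Reasoning

  %-cong-+ : ∀ p .⦃ _ : NonZero p ⦄ a b c → a % p ≡ b % p → (a ℕ.+ c) % p ≡ (b ℕ.+ c) % p
  %-cong-+ p a b c eq = begin
    (a ℕ.+ c) % p           ≡⟨ %-distribˡ-+ a c p ⟩
    (a % p ℕ.+ c % p) % p   ≡⟨ cong (λ t → (t ℕ.+ c % p) % p) eq ⟩
    (b % p ℕ.+ c % p) % p   ≡⟨ sym (%-distribˡ-+ b c p) ⟩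
    (b ℕ.+ c) % p           ∎
    where open ≡-Reasoning

  -- Two of the p + 1 numbers i² and -(3j² + 1) with 0 ≤ i, j ≤ h agree modulo p = 2h + 1.
  module _ {p h : ℕ} (p-prime : Prime p) (p≡ : p ≡ suc (2 ℕ.* h)) (3<p : 3 < p) where

    instance
      p≢0 : NonZero p
      p≢0 = prime⇒nonZero p-prime

    form : ℕ → ℕ
    form j = suc (3 ℕ.* (j ℕ.* j))

    -- Multiplication by `pred p` is negation modulo p.
    residue : Fin (suc h) ⊎ Fin (suc h) → ℕ
    residue (inj₁ i) = toℕ i ℕ.* toℕ i
    residue (inj₂ j) = ℕ.pred p ℕ.* form (toℕ j)

    p∤small : ∀ {a} → 0 < a → a < p → ¬ (p ℕ.∣ a)
    p∤small a>0 a<p p∣a = ℕ.<⇒≱ a<p (ℕ.∣⇒≤ ⦃ ℕ.>-nonZero a>0 ⦄ p∣a)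

    p∤difference : ∀ i d → 0 < d → i ℕ.+ d ≤ h → ¬ (p ℕ.∣ d ℕ.* (2 ℕ.* i ℕ.+ d))
    p∤difference i d d>0 i+d≤h p∣ =
      [ p∤small d>0 (ℕ.≤-<-trans (ℕ.m≤n+m d (2 ℕ.* i)) small)
      , p∤small (ℕ.<-≤-trans d>0 (ℕ.m≤n+m d (2 ℕ.* i))) small ]′ (euclidsLemma d (2 ℕ.* i ℕ.+ d) p-prime p∣)
      where
      reorder : ∀ i d → 2 ℕ.* i ℕ.+ d ℕ.+ d ≡ 2 ℕ.* (i ℕ.+ d)
      reorder = ℕ-solver.solve-∀
      small : 2 ℕ.* i ℕ.+ d < p
      small = subst (2 ℕ.* i ℕ.+ d <_) (sym p≡) (s≤s (ℕ.≤-trans (ℕ.m≤m+n _ d)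
        (ℕ.≤-trans (ℕ.≤-reflexive (reorder i d)) (ℕ.*-monoʳ-≤ 2 i+d≤h))))

    squares-distinct : ∀ i j → i < j → j ≤ h → (i ℕ.* i) % p ≢ (j ℕ.* j) % p
    squares-distinct i j i<j j≤h eq = p∤difference i (j ∸ i) (ℕ.m<n⇒0<n∸m i<j)
      (ℕ.≤-trans (ℕ.≤-reflexive (ℕ.m+[n∸m]≡n (ℕ.<⇒≤ i<j))) j≤h)
      (%-eq⇒∣ p (i ℕ.* i) _ (trans eq (cong (_% p) (trans
        (cong (λ t → t ℕ.* t) (sym (ℕ.m+[n∸m]≡n (ℕ.<⇒≤ i<j)))) (expand i (j ∸ i))))))
      where
      expand : ∀ i d → (i ℕ.+ d) ℕ.* (i ℕ.+ d) ≡ i ℕ.* i ℕ.+ d ℕ.* (2 ℕ.* i ℕ.+ d)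
      expand = ℕ-solver.solve-∀

    forms-distinct : ∀ i j → i < j → j ≤ h → (ℕ.pred p ℕ.* form i) % p ≢ (ℕ.pred p ℕ.* form j) % p
    forms-distinct i j i<j j≤h eq = absurd (%-eq⇒∣ p (ℕ.pred p ℕ.* form i) _ (trans eq (cong (_% p) (trans
        (cong (λ t → ℕ.pred p ℕ.* form t) (sym (ℕ.m+[n∸m]≡n (ℕ.<⇒≤ i<j)))) (expand (ℕ.pred p) i (j ∸ i))))))
      where
      expand : ∀ q i d → q ℕ.* suc (3 ℕ.* ((i ℕ.+ d) ℕ.* (i ℕ.+ d))) ≡
        q ℕ.* suc (3 ℕ.* (i ℕ.* i)) ℕ.+ q ℕ.* (3 ℕ.* (d ℕ.* (2 ℕ.* i ℕ.+ d)))
      expand = ℕ-solver.solve-∀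
      absurd : ¬ (p ℕ.∣ ℕ.pred p ℕ.* (3 ℕ.* ((j ∸ i) ℕ.* (2 ℕ.* i ℕ.+ (j ∸ i)))))
      absurd p∣ with euclidsLemma (ℕ.pred p) _ p-prime p∣
      ... | inj₁ p∣pred = p∤small (ℕ.<-≤-trans z<s (ℕ.pred-mono-≤ 3<p)) (ℕ.≤-reflexive (ℕ.suc-pred p)) p∣pred
      ... | inj₂ p∣3* with euclidsLemma 3 _ p-prime p∣3*
      ...   | inj₁ p∣3 = p∤small z<s 3<p p∣3
      ...   | inj₂ p∣d = p∤difference i (j ∸ i) (ℕ.m<n⇒0<n∸m i<j)
                (ℕ.≤-trans (ℕ.≤-reflexive (ℕ.m+[n∸m]≡n (ℕ.<⇒≤ i<j))) j≤h) p∣d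

    cross-collision : ∀ i j → (i ℕ.* i) % p ≡ (ℕ.pred p ℕ.* form j) % p → p ℕ.∣ i ℕ.* i ℕ.+ form j
    cross-collision i j eq = ℕ.m%n≡0⇒n∣m _ p (begin
      (i ℕ.* i ℕ.+ form j) % p                  ≡⟨ %-cong-+ p (i ℕ.* i) (ℕ.pred p ℕ.* form j) (form j) eq ⟩
      (ℕ.pred p ℕ.* form j ℕ.+ form j) % p      ≡⟨ cong (_% p) (ℕ.+-comm _ (form j)) ⟩
      (suc (ℕ.pred p) ℕ.* form j) % p           ≡⟨ cong (λ t → (t ℕ.* form j) % p) (ℕ.suc-pred p) ⟩
      (p ℕ.* form j) % p                        ≡⟨ cong (_% p) (ℕ.*-comm p (form j)) ⟩
      (form j ℕ.* p) % p                        ≡⟨ m*n%n≡0 (form j) p ⟩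
      0                                         ∎)
      where open ≡-Reasoning

    Collision : Set
    Collision = ∃[ i ] ∃[ j ] i ≤ h × j ≤ h × p ℕ.∣ i ℕ.* i ℕ.+ form j

    toℕ≤h : (i : Fin (suc h)) → toℕ i ≤ h
    toℕ≤h i = ℕ.≤-pred (toℕ<n i)

    collision-of : ∀ (a b : Fin (suc h) ⊎ Fin (suc h)) → a ≢ b → residue a % p ≡ residue b % p → Collision
    collision-of (inj₁ i) (inj₂ j) _ eq = toℕ i , toℕ j , toℕ≤h i , toℕ≤h j , cross-collision (toℕ i) (toℕ j) eq
    collision-of (inj₂ j) (inj₁ i) _ eq = toℕ i , toℕ j , toℕ≤h i , toℕ≤h j , cross-collision (toℕ i) (toℕ j) (sym eq)
    collision-of (inj₁ i) (inj₁ j) i≢j eq with ℕ.<-cmp (toℕ i) (toℕ j)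
    ... | tri< i<j _ _ = contradiction eq (squares-distinct _ _ i<j (toℕ≤h j))
    ... | tri≈ _ i≡j _ = contradiction (cong inj₁ (toℕ-injective i≡j)) i≢j
    ... | tri> _ _ j<i = contradiction (sym eq) (squares-distinct _ _ j<i (toℕ≤h i))
    collision-of (inj₂ i) (inj₂ j) i≢j eq with ℕ.<-cmp (toℕ i) (toℕ j)
    ... | tri< i<j _ _ = contradiction eq (forms-distinct _ _ i<j (toℕ≤h j))
    ... | tri≈ _ i≡j _ = contradiction (cong inj₂ (toℕ-injective i≡j)) i≢j
    ... | tri> _ _ j<i = contradiction (sym eq) (forms-distinct _ _ j<i (toℕ≤h i))

    collision : Collision
    collision with pigeonhole p<2h+2 (λ k → fromℕ< (m%n<n (residue (splitAt (suc h) k)) p))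
      where
      p<2h+2 : p < suc h ℕ.+ suc h
      p<2h+2 = ℕ.≤-reflexive (trans (cong suc p≡) (reorder h))
        where
        reorder : ∀ h → suc (suc (2 ℕ.* h)) ≡ suc h ℕ.+ suc h
        reorder = ℕ-solver.solve-∀
    ... | k , l , k<l , eq = collision-of (splitAt (suc h) k) (splitAt (suc h) l)
      (λ same → ℕ.<⇒≢ k<l (cong toℕ (trans (sym (join-splitAt (suc h) (suc h) k))
        (trans (cong (join (suc h) (suc h)) same) (join-splitAt (suc h) (suc h) l)))))
      (trans (sym (toℕ-fromℕ< _)) (trans (cong toℕ eq) (toℕ-fromℕ< _)))

    -- The multiple i² + 3j² + 1 equals N(i + j + 2jω) + N(1), and it is at most 4h² + 1, which is
    -- below p² = (2h + 1)².
    rep-of-multiple : ∃[ m ] 0 < m × m < p × Rep (m ℕ.* p)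
    rep-of-multiple = let i , j , i≤h , j≤h , p∣ = collision in build i j i≤h j≤h p∣
      where
      build : ∀ i j → i ≤ h → j ≤ h → p ℕ.∣ i ℕ.* i ℕ.+ form j → ∃[ m ] 0 < m × m < p × Rep (m ℕ.* p)
      build i j i≤h j≤h (ℕ.divides m eq) = m , m>0 , m<p ,
        + i + + j , + 2 * + j , + 1 , + 0 , trans (cong +_ (sym eq)) (trans cast (norms (+ i) (+ j)))
        where
        cast : + (i ℕ.* i ℕ.+ suc (3 ℕ.* (j ℕ.* j))) ≡ + i * + i + (+ 1 + + 3 * (+ j * + j))
        cast = cong₂ (λ x y → x + (+ 1 + y)) (pos-* i i) (trans (pos-* 3 (j ℕ.* j)) (cong (+ 3 *_) (pos-* j j)))
        norms : ∀ i j → i * i + (+ 1 + + 3 * (j * j)) ≡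
          ((i + j) * (i + j) + - ((i + j) * (+ 2 * j)) + + 2 * j * (+ 2 * j)) +
          (+ 1 * + 1 + - (+ 1 * + 0) + + 0 * + 0)
        norms = solve-∀
        m>0 : 0 < m
        m>0 = ℕ.n≢0⇒n>0 λ { refl → ℕ.1+n≢0 (trans (sym (ℕ.+-suc (i ℕ.* i) _)) eq) }
        bound : i ℕ.* i ℕ.+ form j ≤ suc (4 ℕ.* (h ℕ.* h))
        bound = ℕ.≤-trans (ℕ.+-mono-≤ (ℕ.*-mono-≤ i≤h i≤h) (s≤s (ℕ.*-monoʳ-≤ 3 (ℕ.*-mono-≤ j≤h j≤h))))
          (ℕ.≤-reflexive (reorder (h ℕ.* h)))
          where
          reorder : ∀ x → x ℕ.+ suc (3 ℕ.* x) ≡ suc (4 ℕ.* x)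
          reorder = ℕ-solver.solve-∀
        h>0 : 0 < h
        h>0 = ℕ.n≢0⇒n>0 λ { refl → ℕ.<⇒≱ 3<p (ℕ.≤-trans (ℕ.≤-reflexive p≡) (s≤s z≤n)) }
        strict : suc (4 ℕ.* (h ℕ.* h)) < p ℕ.* p
        strict = ℕ.<-≤-trans (ℕ.m<m+n _ (ℕ.*-mono-≤ {1} {4} (s≤s z≤n) h>0))
          (ℕ.≤-reflexive (trans (expand h) (cong (λ t → t ℕ.* t) (sym p≡))))
          where
          expand : ∀ h → suc (4 ℕ.* (h ℕ.* h)) ℕ.+ 4 ℕ.* h ≡ suc (2 ℕ.* h) ℕ.* suc (2 ℕ.* h)
          expand = ℕ-solver.solve-∀
        m<p : m < p
        m<p = ℕ.*-cancelʳ-< p m p (ℕ.≤-<-trans (ℕ.≤-trans (ℕ.≤-reflexive (sym eq)) bound) strict)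

    rep : Rep p
    rep = let m , m>0 , m<p , r = rep-of-multiple in descend p-prime m m>0 m<p r

-- The special factors as values of N₂ B².

module Weights where

  open GroupDeterminant using (⟨_,_,_⟩; trace; norm; _+2*_)
  open Families
  open EisensteinNorms using (N; rep)
  open SumsOfTwoSquares using (two-squares)
  open import Data.Nat as ℕ using (ℕ; suc; _%_)
  import Data.Nat.Divisibility as ℕ
  import Data.Nat.Properties as ℕ
  import Data.Nat.Tactic.RingSolver as ℕ-solver
  open import Data.Nat.DivMod as ℕ using (m≡m%n+[m/n]*n)
  open import Data.Nat.Primality using (Prime)
  open import Data.Integer using (ℤ; +_; -_; _+_; _*_; _-_; ∣_∣)
  open import Data.Integer.DivMod using (a≡a%ℕn+[a/ℕn]*n; n%ℕd<d) renaming (_/ℕ_ to _divℕ_; _%ℕ_ to _modℕ_)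
  open import Data.Integer.Properties
  open import Data.Integer.Tactic.RingSolver using (solve-∀)
  open import Relation.Nullary.Decidable using (from-no)

  trichotomy₃ : ∀ k → (∃[ j ] k ≡ + 3 * j) ⊎ Unit₃ k
  trichotomy₃ k with k divℕ 3 | k modℕ 3 | a≡a%ℕn+[a/ℕn]*n k 3 | n%ℕd<d k 3
  ... | q | 0 | eq | _ = inj₁ (q , trans eq (trans (+-identityˡ (q * + 3)) (*-comm q (+ 3))))
  ... | q | 1 | eq | _ = inj₂ (q , inj₁ (trans eq (reorder q)))
    where
    reorder : ∀ q → + 1 + q * + 3 ≡ + 3 * q + + 1
    reorder = solve-∀
  ... | q | 2 | eq | _ = inj₂ (- q + - + 1 , inj₂ (trans (cong -_ eq) (reorder q)))
    where
    reorder : ∀ q → - (+ 2 + q * + 3) ≡ + 3 * (- q + - + 1) + + 1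
    reorder = solve-∀
  ... | q | suc (suc (suc _)) | _ | ℕ.s≤s (ℕ.s≤s (ℕ.s≤s ()))

  ≡±⇒square : ∀ {a b} → a ≡± b → a * a ≡ b * b
  ≡±⇒square (inj₁ refl) = refl
  ≡±⇒square {a} (inj₂ refl) = negate a
    where
    negate : ∀ a → a * a ≡ - a * - a
    negate = solve-∀

  multiple⇒∣ : ∀ k x n → + n ≡ + k * x → k ℕ.∣ n
  multiple⇒∣ k x n eq = ℕ.divides ∣ x ∣ (trans (cong ∣_∣ eq) (trans (abs-* (+ k) x) (ℕ.*-comm k ∣ x ∣)))

  %⇒ℤ : ∀ p n .⦃ _ : ℕ.NonZero n ⦄ {r} → p % n ≡ r → + p ≡ + r + + (p ℕ./ n) * + n
  %⇒ℤ p n refl = trans (cong +_ (m≡m%n+[m/n]*n p n)) (cong (_+_ (+ (p % n))) (pos-* (p ℕ./ n) n))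

  -- Every element of ℤ[ω] has an associate in ℤ[√-3]; which unit is needed depends on the parities.
  N-as-sum : ∀ u v → ∃[ x ] ∃[ y ] N u v ≡ x * x + + 3 * (y * y)
  N-as-sum u v with parity u | parity v
  ... | _               | inj₁ (j , refl) = u - j , j , even u j
    where
    even : ∀ u j → u * u + - (u * (+ 2 * j)) + + 2 * j * (+ 2 * j) ≡ (u + - j) * (u + - j) + + 3 * (j * j)
    even = solve-∀
  ... | inj₁ (i , refl) | _               = v - i , i , even i v
    where
    even : ∀ i v → + 2 * i * (+ 2 * i) + - (+ 2 * i * v) + v * v ≡ (v + - i) * (v + - i) + + 3 * (i * i)
    even = solve-∀
  ... | inj₂ (i , refl) | inj₂ (j , refl) = i + j + + 1 , i - j , odd i j
    where
    odd : ∀ i j → (+ 2 * i + + 1) * (+ 2 * i + + 1) + - ((+ 2 * i + + 1) * (+ 2 * j + + 1)) +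
        (+ 2 * j + + 1) * (+ 2 * j + + 1) ≡
      (i + j + + 1) * (i + j + + 1) + + 3 * ((i + - j) * (i + - j))
    odd = solve-∀

  weight-of : ∀ {w w′ a b A B} → trace w ≡ a → trace w′ ≡ b → norm w ≡ A → norm w′ ≡ B →
    weight w w′ ≡ (a * a + b * b) * ((A + B) * (A + B))
  weight-of refl refl refl refl = refl

  -- With X = 1 - 3h, Y = 2a - h and Z = 1 - 3k, W = 2b + 1 - k.
  Weight-quaternary : ∀ h a k b → Weight
    ((((+ 1 - + 3 * h) * (+ 1 - + 3 * h) + + 3 * ((+ 2 * a - h) * (+ 2 * a - h))) +
      ((+ 1 - + 3 * k) * (+ 1 - + 3 * k) + + 3 * ((+ 2 * b + + 1 - k) * (+ 2 * b + + 1 - k)))) *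
     (((+ 1 - + 3 * h) * (+ 1 - + 3 * h) + + 3 * ((+ 2 * a - h) * (+ 2 * a - h))) +
      ((+ 1 - + 3 * k) * (+ 1 - + 3 * k) + + 3 * ((+ 2 * b + + 1 - k) * (+ 2 * b + + 1 - k)))))
  Weight-quaternary h a k b = ⟨ - h , a , h - a ⟩ , ⟨ - k , b , k - b - + 1 ⟩ ,
    weight-of {⟨ + 1 , + 0 , + 0 ⟩ +2* ⟨ - h , a , h - a ⟩} {⟨ + 1 , + 1 , + 1 ⟩ +2* ⟨ - k , b , k - b - + 1 ⟩}
      (trace-e₁ h a) (trace-ones k b) (norm-e₁ h a) (norm-ones k b)
    where
    trace-e₁ : ∀ h a → + 1 + + 2 * - h + (+ 0 + + 2 * a) + (+ 0 + + 2 * (h + - a)) ≡ + 1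
    trace-e₁ = solve-∀
    trace-ones : ∀ k b → + 1 + + 2 * - k + (+ 1 + + 2 * b) + (+ 1 + + 2 * (k + - b + - + 1)) ≡ + 1
    trace-ones = solve-∀
    norm-e₁ : ∀ h a → let x = + 1 + + 2 * - h ; y = + 0 + + 2 * a ; z = + 0 + + 2 * (h + - a) in
      x * x + y * y + z * z + - (x * y) + - (y * z) + - (z * x) ≡
      (+ 1 + - (+ 3 * h)) * (+ 1 + - (+ 3 * h)) + + 3 * ((+ 2 * a + - h) * (+ 2 * a + - h))
    norm-e₁ = solve-∀
    norm-ones : ∀ k b → let x = + 1 + + 2 * - k ; y = + 1 + + 2 * b ; z = + 1 + + 2 * (k + - b + - + 1) in
      x * x + y * y + z * z + - (x * y) + - (y * z) + - (z * x) ≡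
      (+ 1 + - (+ 3 * k)) * (+ 1 + - (+ 3 * k)) + + 3 * ((+ 2 * b + + 1 + - k) * (+ 2 * b + + 1 + - k))
    norm-ones = solve-∀

  quaternary : (x y z w : ℤ) → ℤ
  quaternary x y z w = (x * x + + 3 * (y * y)) + (z * z + + 3 * (w * w))

  quaternary-cong : ∀ x x′ z z′ y w → x * x ≡ x′ * x′ → z * z ≡ z′ * z′ →
    quaternary x y z w ≡ quaternary x′ y z′ w
  quaternary-cong _ _ _ _ y w = cong₂ (λ s t → (s + + 3 * (y * y)) + (t + + 3 * (w * w)))

  move : ∀ i y {t} → i + y ≡ t → y ≡ t - i
  move i y refl = cancel i y
    where
    cancel : ∀ i y → y ≡ i + y + - i
    cancel = solve-∀

  -- Turns an impossible integer congruence into a divisibility between numerals, which is refuted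
  -- by evaluation.
  multiple-difference⇒∣ : ∀ k c n q u → + n + q * (+ k * c) ≡ + k * u → k ℕ.∣ n
  multiple-difference⇒∣ k c n q u eq = multiple⇒∣ k (u - q * c) n
    (trans (undo (+ n) (q * (+ k * c))) (trans (cong (_- q * (+ k * c)) eq) (factor (+ k) c q u)))
    where
    undo : ∀ n q → n ≡ n + q + - q
    undo = solve-∀
    factor : ∀ k c q u → k * u + - (q * (k * c)) ≡ k * (u + - (q * c))
    factor = solve-∀

  module _ (P q : ℤ) (P≡ : P ≡ + 5 + q * + 6) where

    not-even : ∀ u → P ≢ + 2 * u
    not-even u eq = from-no (2 ℕ.∣? 5) (multiple-difference⇒∣ 2 (+ 3) 5 q u (trans (sym P≡) eq))

    not-0-mod-3 : ∀ u → P ≢ + 3 * u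
    not-0-mod-3 u eq = from-no (3 ℕ.∣? 5) (multiple-difference⇒∣ 3 (+ 2) 5 q u (trans (sym P≡) eq))

    not-1-mod-3 : ∀ u → P ≢ + 3 * u + + 1
    not-1-mod-3 u eq = from-no (3 ℕ.∣? 4) (multiple-difference⇒∣ 3 (+ 2) 4 q u
      (trans (shift₁ q) (trans (cong (_- + 1) (trans (sym P≡) eq)) (drop₁ u))))
      where
      shift₁ : ∀ q → + 4 + q * + 6 ≡ + 5 + q * + 6 + - + 1
      shift₁ = solve-∀
      drop₁ : ∀ u → + 3 * u + + 1 + - + 1 ≡ + 3 * u
      drop₁ = solve-∀

    -- As P ≡ 2 mod 3, neither x nor z is divisible by 3, so up to sign they are 1 - 3i and 1 - 3j.
    -- Then P ≡ (i + y) + (j + w) mod 2. Since P is odd, exactly one of these two sums is even; that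
    -- half comes from the triple congruent to (1, 0, 0), the other from the one congruent to (1, 1,
    -- 1).
    Weight-of-quaternary : ∀ x y z w → P ≡ quaternary x y z w → Weight (P * P)
    Weight-of-quaternary x y z w eq = by-residue (trichotomy₃ x) (trichotomy₃ z)
      where
      at : (i s j t : ℤ) → ℤ
      at i s j t = quaternary (+ 1 - + 3 * i) s (+ 1 - + 3 * j) t
      by-parity : ∀ i j → P ≡ at i y j w →
        (∃[ a ] i + y ≡ + 2 * a) ⊎ (∃[ a ] i + y ≡ + 2 * a + + 1) →
        (∃[ b ] j + w ≡ + 2 * b) ⊎ (∃[ b ] j + w ≡ + 2 * b + + 1) → Weight (P * P)
      by-parity i j eq (inj₁ (a , iy)) (inj₂ (b , jw)) = subst (λ t → Weight (t * t))
        (sym (trans eq (cong₂ (λ s t → at i s j t) (move i y iy) (move j w jw)))) (Weight-quaternary i a j b)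
      by-parity i j eq (inj₂ (a , iy)) (inj₁ (b , jw)) = subst (λ t → Weight (t * t))
        (sym (trans eq (trans (cong₂ (λ s t → at i s j t) (move i y iy) (move j w jw)) (+-comm
          ((+ 1 - + 3 * i) * (+ 1 - + 3 * i) + + 3 * ((+ 2 * a + + 1 - i) * (+ 2 * a + + 1 - i)))
          ((+ 1 - + 3 * j) * (+ 1 - + 3 * j) + + 3 * ((+ 2 * b - j) * (+ 2 * b - j)))))))
        (Weight-quaternary j b i a)
      by-parity i j eq (inj₁ (a , iy)) (inj₁ (b , jw)) = contradiction
        (trans eq (trans (cong₂ (λ s t → at i s j t) (move i y iy) (move j w jw)) (even i a j b)))
        (not-even (+ 1 + - (+ 3 * i) + - (+ 3 * j) + + 6 * (i * i + j * j + a * a + b * b + - (a * i) + - (b * j))))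
        where
        even : ∀ i a j b →
          ((+ 1 + - (+ 3 * i)) * (+ 1 + - (+ 3 * i)) + + 3 * ((+ 2 * a + - i) * (+ 2 * a + - i))) +
          ((+ 1 + - (+ 3 * j)) * (+ 1 + - (+ 3 * j)) + + 3 * ((+ 2 * b + - j) * (+ 2 * b + - j))) ≡
          + 2 * (+ 1 + - (+ 3 * i) + - (+ 3 * j) + + 6 * (i * i + j * j + a * a + b * b + - (a * i) + - (b * j)))
        even = solve-∀
      by-parity i j eq (inj₂ (a , iy)) (inj₂ (b , jw)) = contradiction
        (trans eq (trans (cong₂ (λ s t → at i s j t) (move i y iy) (move j w jw)) (even i a j b)))
        (not-even (+ 4 + + 6 * (a + b + i * i + j * j + a * a + b * b + - i + - j + - (a * i) + - (b * j))))
        where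
        even : ∀ i a j b →
          ((+ 1 + - (+ 3 * i)) * (+ 1 + - (+ 3 * i)) + + 3 * ((+ 2 * a + + 1 + - i) * (+ 2 * a + + 1 + - i))) +
          ((+ 1 + - (+ 3 * j)) * (+ 1 + - (+ 3 * j)) + + 3 * ((+ 2 * b + + 1 + - j) * (+ 2 * b + + 1 + - j))) ≡
          + 2 * (+ 4 + + 6 * (a + b + i * i + j * j + a * a + b * b + - i + - j + - (a * i) + - (b * j)))
        even = solve-∀

      square-1-3* : ∀ {x} j → x ≡± (+ 3 * j + + 1) → x * x ≡ (+ 1 - + 3 * - j) * (+ 1 - + 3 * - j)
      square-1-3* j x≡ = trans (≡±⇒square x≡) (negate j)
        where
        negate : ∀ j → (+ 3 * j + + 1) * (+ 3 * j + + 1) ≡ (+ 1 + - (+ 3 * - j)) * (+ 1 + - (+ 3 * - j))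
        negate = solve-∀
      by-residue : (∃[ j ] x ≡ + 3 * j) ⊎ Unit₃ x → (∃[ j ] z ≡ + 3 * j) ⊎ Unit₃ z → Weight (P * P)
      by-residue (inj₂ (i , x≡)) (inj₂ (j , z≡)) =
        by-parity (- i) (- j) (trans eq (quaternary-cong x (+ 1 - + 3 * - i) z (+ 1 - + 3 * - j) y w
          (square-1-3* i x≡) (square-1-3* j z≡)))
          (parity (- i + y)) (parity (- j + w))
      by-residue (inj₁ (i , refl)) (inj₁ (j , refl)) = contradiction (trans eq (none i y j w))
        (not-0-mod-3 (+ 3 * (i * i) + y * y + + 3 * (j * j) + w * w))
        where
        none : ∀ i y j w → + 3 * i * (+ 3 * i) + + 3 * (y * y) + (+ 3 * j * (+ 3 * j) + + 3 * (w * w)) ≡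
          + 3 * (+ 3 * (i * i) + y * y + + 3 * (j * j) + w * w)
        none = solve-∀
      by-residue (inj₁ (i , refl)) (inj₂ (j , z≡)) = contradiction
        (trans eq (trans (quaternary-cong (+ 3 * i) (+ 3 * i) z (+ 3 * j + + 1) y w refl (≡±⇒square z≡)) (one i y j w)))
        (not-1-mod-3 (+ 3 * (i * i) + y * y + + 3 * (j * j) + + 2 * j + w * w))
        where
        one : ∀ i y j w → + 3 * i * (+ 3 * i) + + 3 * (y * y) +
            ((+ 3 * j + + 1) * (+ 3 * j + + 1) + + 3 * (w * w)) ≡
          + 3 * (+ 3 * (i * i) + y * y + + 3 * (j * j) + + 2 * j + w * w) + + 1
        one = solve-∀
      by-residue (inj₂ (i , x≡)) (inj₁ (j , refl)) = contradiction
        (trans eq (trans (quaternary-cong x (+ 3 * i + + 1) (+ 3 * j) (+ 3 * j) y w (≡±⇒square x≡) refl) (one i y j w)))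
        (not-1-mod-3 (+ 3 * (i * i) + + 2 * i + y * y + + 3 * (j * j) + w * w))
        where
        one : ∀ i y j w → (+ 3 * i + + 1) * (+ 3 * i + + 1) + + 3 * (y * y) +
            (+ 3 * j * (+ 3 * j) + + 3 * (w * w)) ≡
          + 3 * (+ 3 * (i * i) + + 2 * i + y * y + + 3 * (j * j) + w * w) + + 1
        one = solve-∀

    -- Take B = 1 and N₂ = 2P = (c + d)² + (c - d)². As P ≡ 2 mod 3, c and d may be taken to be 1
    -- modulo 3; then c - d is divisible by 3, as the trace of a triple of equal entries must be.
    Weight-of-two-squares : ∀ c d → P ≡ c * c + d * d → Weight P
    Weight-of-two-squares c d eq = by-residue (trichotomy₃ c) (trichotomy₃ d)
      where
      by-parity : ∀ i j → P ≡ (+ 3 * i + + 1) * (+ 3 * i + + 1) + (+ 3 * j + + 1) * (+ 3 * j + + 1) →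
        (∃[ k ] i + j ≡ + 2 * k) ⊎ (∃[ k ] i + j ≡ + 2 * k + + 1) → Weight P
      by-parity i j eq (inj₁ (k , ij)) = contradiction (trans eq (trans
        (cong (λ t → (+ 3 * i + + 1) * (+ 3 * i + + 1) + (+ 3 * t + + 1) * (+ 3 * t + + 1)) (move i j ij))
        (even i k)))
        (not-even (+ 9 * (i * i) + + 1 + + 18 * (k * k) + - (+ 18 * (k * i)) + + 6 * k))
        where
        even : ∀ i k → (+ 3 * i + + 1) * (+ 3 * i + + 1) + (+ 3 * (+ 2 * k + - i) + + 1) * (+ 3 * (+ 2 * k + - i) + + 1) ≡
          + 2 * (+ 9 * (i * i) + + 1 + + 18 * (k * k) + - (+ 18 * (k * i)) + + 6 * k)
        even = solve-∀
      by-parity i j eq (inj₂ (k , ij)) = ⟨ κ , κ , κ ⟩ , ⟨ ι , ι , ι ⟩ , trans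
        (weight-of {⟨ + 1 , + 0 , + 0 ⟩ +2* ⟨ κ , κ , κ ⟩} {⟨ + 1 , + 1 , + 1 ⟩ +2* ⟨ ι , ι , ι ⟩} {A = + 1} {B = + 0}
          refl refl (norm-e₁ κ) (norm-ones ι))
        (trans (total i k) (cong (+ 2 *_) (sym (trans eq
          (cong (λ t → (+ 3 * i + + 1) * (+ 3 * i + + 1) + (+ 3 * t + + 1) * (+ 3 * t + + 1)) (move i j ij))))))
        where
        -- These make the two traces -(c + d) and c - d.
        κ = - k + - + 1
        ι = i + - k + - + 1
        norm-e₁ : ∀ k → let x = + 1 + + 2 * k ; y = + 0 + + 2 * k in
          x * x + y * y + y * y + - (x * y) + - (y * y) + - (y * x) ≡ + 1
        norm-e₁ = solve-∀
        norm-ones : ∀ k → let x = + 1 + + 2 * k in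
          x * x + x * x + x * x + - (x * x) + - (x * x) + - (x * x) ≡ + 0
        norm-ones = solve-∀
        total : ∀ i k → let κ = - k + - + 1 ; ι = i + - k + - + 1
                            s = + 1 + + 2 * κ + (+ 0 + + 2 * κ) + (+ 0 + + 2 * κ)
                            t = + 1 + + 2 * ι + (+ 1 + + 2 * ι) + (+ 1 + + 2 * ι) in
          (s * s + t * t) * ((+ 1 + + 0) * (+ 1 + + 0)) ≡
          + 2 * ((+ 3 * i + + 1) * (+ 3 * i + + 1) +
            (+ 3 * (+ 2 * k + + 1 + - i) + + 1) * (+ 3 * (+ 2 * k + + 1 + - i) + + 1))
        total = solve-∀
      by-residue : (∃[ j ] c ≡ + 3 * j) ⊎ Unit₃ c → (∃[ j ] d ≡ + 3 * j) ⊎ Unit₃ d → Weight P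
      by-residue (inj₂ (i , c≡)) (inj₂ (j , d≡)) =
        by-parity i j (trans eq (cong₂ _+_ (≡±⇒square c≡) (≡±⇒square d≡))) (parity (i + j))
      by-residue (inj₁ (i , refl)) (inj₁ (j , refl)) = contradiction (trans eq (none i j))
        (not-0-mod-3 (+ 3 * (i * i) + + 3 * (j * j)))
        where
        none : ∀ i j → + 3 * i * (+ 3 * i) + + 3 * j * (+ 3 * j) ≡ + 3 * (+ 3 * (i * i) + + 3 * (j * j))
        none = solve-∀
      by-residue (inj₁ (i , refl)) (inj₂ (j , d≡)) = contradiction
        (trans eq (trans (cong (_+_ (+ 3 * i * (+ 3 * i))) (≡±⇒square d≡)) (one i j)))
        (not-1-mod-3 (+ 3 * (i * i) + + 3 * (j * j) + + 2 * j))
        where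
        one : ∀ i j → + 3 * i * (+ 3 * i) + (+ 3 * j + + 1) * (+ 3 * j + + 1) ≡
          + 3 * (+ 3 * (i * i) + + 3 * (j * j) + + 2 * j) + + 1
        one = solve-∀
      by-residue (inj₂ (i , c≡)) (inj₁ (j , refl)) = contradiction
        (trans eq (trans (cong (_+ + 3 * j * (+ 3 * j)) (≡±⇒square c≡)) (one i j)))
        (not-1-mod-3 (+ 3 * (i * i) + + 3 * (j * j) + + 2 * i))
        where
        one : ∀ i j → (+ 3 * i + + 1) * (+ 3 * i + + 1) + + 3 * j * (+ 3 * j) ≡
          + 3 * (+ 3 * (i * i) + + 3 * (j * j) + + 2 * i) + + 1
        one = solve-∀

  Weight-p² : ∀ {p} → Prime p → p % 6 ≡ 5 → Weight (+ p * + p)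
  Weight-p² {p} p-prime p%6≡5 = let a , b , c , d , p≡ = rep {h = 2 ℕ.+ q ℕ.* 3} p-prime p≡2h+1 3<p in of-rep a b c d p≡
    where
    q = p ℕ./ 6
    p≡5+ : p ≡ 5 ℕ.+ q ℕ.* 6
    p≡5+ = trans (m≡m%n+[m/n]*n p 6) (cong (ℕ._+ q ℕ.* 6) p%6≡5)
    p≡2h+1 : p ≡ suc (2 ℕ.* (2 ℕ.+ q ℕ.* 3))
    p≡2h+1 = trans p≡5+ (reorder q)
      where
      reorder : ∀ q → 5 ℕ.+ q ℕ.* 6 ≡ suc (2 ℕ.* (2 ℕ.+ q ℕ.* 3))
      reorder = ℕ-solver.solve-∀
    3<p : 3 ℕ.< p
    3<p = ℕ.<-≤-trans (ℕ.m<m+n 3 {2} ℕ.z<s) (ℕ.≤-trans (ℕ.m≤m+n 5 (q ℕ.* 6)) (ℕ.≤-reflexive (sym p≡5+)))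
    of-rep : ∀ a b c d → + p ≡ N a b + N c d → Weight (+ p * + p)
    of-rep a b c d p≡ = let x , y , ab≡ = N-as-sum a b ; z , w , cd≡ = N-as-sum c d in
      Weight-of-quaternary (+ p) (+ (p ℕ./ 6)) (%⇒ℤ p 6 p%6≡5) x y z w (trans p≡ (cong₂ _+_ ab≡ cd≡))

  Weight-p : ∀ {p} → Prime p → p % 12 ≡ 5 → Weight (+ p)
  Weight-p {p} p-prime p%12≡5 = let c , d , p≡ = two-squares p-prime p%4≡1 in
    Weight-of-two-squares (+ p) (+ (p ℕ./ 6)) (%⇒ℤ p 6 p%6≡5) (+ c) (+ d)
      (trans (cong +_ p≡) (cong₂ _+_ (pos-* c c) (pos-* d d)))
    where
    p%4≡1 : p % 4 ≡ 1
    p%4≡1 = trans (sym (ℕ.m∣n⇒o%n%m≡o%m 4 12 p (ℕ.divides 3 refl))) (cong (_% 4) p%12≡5)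
    p%6≡5 : p % 6 ≡ 5
    p%6≡5 = trans (sym (ℕ.m∣n⇒o%n%m≡o%m 6 12 p (ℕ.divides 2 refl))) (cong (_% 6) p%12≡5)

-- Every integer of the three forms is a value.

module Sufficiency where

  open Families
  open Weights using (Weight-p; Weight-p²)
  import Data.Nat.Divisibility as ℕ
  import Data.Nat.Properties as ℕ
  open import Data.Integer using (+_; -_; _+_; _*_; _-_; ∣_∣)
  open import Data.Integer.DivMod using (a≡a%ℕn+[a/ℕn]*n; n%ℕd<d) renaming (_/ℕ_ to _divℕ_; _%ℕ_ to _modℕ_)
  open import Data.Integer.Properties
  open import Data.Integer.Tactic.RingSolver using (solve-∀)

  multiple⇒∣∣ : ∀ k {x z} → z ≡ + k * x → k ℕ.∣ ∣ z ∣
  multiple⇒∣∣ k {x} refl = ℕ.divides ∣ x ∣ (trans (abs-* (+ k) x) (ℕ.*-comm k ∣ x ∣))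

  coprime⇒2∤ : ∀ {m} → CoprimeTo6 m → ¬ (2 ℕ.∣ ∣ m ∣)
  coprime⇒2∤ cop 2∣m = contradiction (cop (2∣m , ℕ.divides 3 refl)) λ ()

  coprime⇒3∤ : ∀ {m} → CoprimeTo6 m → ¬ (3 ℕ.∣ ∣ m ∣)
  coprime⇒3∤ cop 3∣m = contradiction (cop (3∣m , ℕ.divides 2 refl)) λ ()

  coprime⇒Unit₆ : ∀ m → CoprimeTo6 m → Unit₆ m
  coprime⇒Unit₆ m cop with m divℕ 6 | m modℕ 6 | a≡a%ℕn+[a/ℕn]*n m 6 | n%ℕd<d m 6
  ... | q | 0 | eq | _ = contradiction (multiple⇒∣∣ 2 {+ 3 * q} (trans eq (reorder q))) (coprime⇒2∤ {m} cop)
    where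
    reorder : ∀ q → + 0 + q * + 6 ≡ + 2 * (+ 3 * q)
    reorder = solve-∀
  ... | q | 1 | eq | _ = q , inj₁ (trans eq (reorder q))
    where
    reorder : ∀ q → + 1 + q * + 6 ≡ + 6 * q + + 1
    reorder = solve-∀
  ... | q | 2 | eq | _ = contradiction (multiple⇒∣∣ 2 {+ 3 * q + + 1} (trans eq (reorder q))) (coprime⇒2∤ {m} cop)
    where
    reorder : ∀ q → + 2 + q * + 6 ≡ + 2 * (+ 3 * q + + 1)
    reorder = solve-∀
  ... | q | 3 | eq | _ = contradiction (multiple⇒∣∣ 3 {+ 2 * q + + 1} (trans eq (reorder q))) (coprime⇒3∤ {m} cop)
    where
    reorder : ∀ q → + 3 + q * + 6 ≡ + 3 * (+ 2 * q + + 1)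
    reorder = solve-∀
  ... | q | 4 | eq | _ = contradiction (multiple⇒∣∣ 2 {+ 3 * q + + 2} (trans eq (reorder q))) (coprime⇒2∤ {m} cop)
    where
    reorder : ∀ q → + 4 + q * + 6 ≡ + 2 * (+ 3 * q + + 2)
    reorder = solve-∀
  ... | q | 5 | eq | _ = - q + - + 1 , inj₂ (trans (cong -_ eq) (reorder q))
    where
    reorder : ∀ q → - (+ 5 + q * + 6) ≡ + 6 * (- q + - + 1) + + 1
    reorder = solve-∀
  ... | q | suc (suc (suc (suc (suc (suc _))))) | _ | ℕ.s≤s (ℕ.s≤s (ℕ.s≤s (ℕ.s≤s (ℕ.s≤s (ℕ.s≤s ())))))

  Unit₆⇒Unit₃ : ∀ {m} → Unit₆ m → Unit₃ m
  Unit₆⇒Unit₃ (k , m≡) = + 2 * k , ≡±-trans m≡ (inj₁ (reorder k))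
    where
    reorder : ∀ k → + 6 * k + + 1 ≡ + 3 * (+ 2 * k) + + 1
    reorder = solve-∀

  Odd-± : ∀ {a b} → a ≡± b → Odd b → Odd a
  Odd-± (inj₁ refl) h = h
  Odd-± {a} (inj₂ refl) (k , eq) = - k + - + 1 , trans (sym (neg-involutive a)) (trans (cong -_ eq) (reorder k))
    where
    reorder : ∀ k → - (+ 2 * k + + 1) ≡ + 2 * (- k + - + 1) + + 1
    reorder = solve-∀

  Unit₆⇒Odd : ∀ {m} → Unit₆ m → Odd m
  Unit₆⇒Odd (k , m≡) = Odd-± m≡ (+ 3 * k , reorder k)
    where
    reorder : ∀ k → + 6 * k + + 1 ≡ + 2 * (+ 3 * k) + + 1
    reorder = solve-∀

  pow-+ : ∀ p k c → pow p (k ℕ.+ c) ≡ pow p k * pow p c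
  pow-+ p k c = trans (cong +_ (ℕ.^-distribˡ-+-* p k c)) (pos-* (p ℕ.^ k) (p ℕ.^ c))

  Odd-3^ : ∀ c {m} → Odd m → Odd (pow 3 c * m)
  Odd-3^ zero {m} odd = subst Odd (sym (*-identityˡ m)) odd
  Odd-3^ (suc c) {m} odd with Odd-3^ c odd
  ... | k , eq = + 3 * k + + 1 , trans (cong (_* m) (pos-* 3 (3 ℕ.^ c))) (trans (*-assoc (+ 3) (pow 3 c) m)
    (trans (cong (+ 3 *_) eq) (reorder k)))
    where
    reorder : ∀ k → + 3 * (+ 2 * k + + 1) ≡ + 2 * (+ 3 * k + + 1) + + 1
    reorder = solve-∀

  Unit₃-2^ : ∀ c {m} → Unit₃ m → Unit₃ (pow 2 c * m)
  Unit₃-2^ zero {m} unit = subst Unit₃ (sym (*-identityˡ m)) unit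
  Unit₃-2^ (suc c) {m} unit with Unit₃-2^ c unit
  ... | k , u≡ = - (+ 2 * k) + - + 1 , subst (_≡± (+ 3 * (- (+ 2 * k) + - + 1) + + 1))
    (sym (trans (cong (_* m) (pos-* 2 (2 ℕ.^ c))) (*-assoc (+ 2) (pow 2 c) m)))
    (≡±-trans (scale (+ 2) u≡) (inj₂ (reorder k)))
    where
    reorder : ∀ k → - (+ 2 * (+ 3 * k + + 1)) ≡ + 3 * (- (+ 2 * k) + - + 1) + + 1
    reorder = solve-∀

  ≤⇒+ : ∀ {k a} → k ℕ.≤ a → ∃[ c ] k ℕ.+ c ≡ a
  ≤⇒+ k≤a = ℕ.m≤n⇒∃[o]m+o≡n k≤a

  -- Surplus powers of 3 go into an odd parameter and surplus powers of 2 into one prime to 3; when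
  -- both minimal exponents are exceeded the parameter is unrestricted.
  InS-FormI : ∀ {n} → FormI n → InS-Q12 n
  InS-FormI (m , a , b , cop , a∈ , b∈ , refl) = go a∈ b∈
    where
    unit₆ = coprime⇒Unit₆ m cop
    odd = Unit₆⇒Odd unit₆
    Exponents : ℕ → ℕ → Set
    Exponents a b = InS-Q12 (pow 2 a * pow 3 b * m)
    0-3+ : ∀ {b} → ∃[ c ] 3 ℕ.+ c ≡ b → Exponents 0 b
    0-3+ (c , refl) = subst InS-Q12
      (sym (trans (cong (λ z → + 1 * z * m) (pow-+ 3 3 c)) (regroup (pow 3 c) m)))
      (InS-27-odd (Odd-3^ c odd))
      where
      regroup : ∀ z w → + 1 * (+ 27 * z) * w ≡ + 27 * (z * w)
      regroup = solve-∀
    4-3+ : ∀ {b} → ∃[ c ] 3 ℕ.+ c ≡ b → Exponents 4 b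
    4-3+ (c , refl) = subst InS-Q12
      (sym (trans (cong (λ z → + 16 * z * m) (pow-+ 3 3 c)) (regroup (pow 3 c) m)))
      (InS-432-odd (Odd-3^ c odd))
      where
      regroup : ∀ z w → + 16 * (+ 27 * z) * w ≡ + 16 * (+ 27 * (z * w))
      regroup = solve-∀
    6+-0 : ∀ {a} → ∃[ c ] 6 ℕ.+ c ≡ a → Exponents a 0
    6+-0 (c , refl) = subst InS-Q12
      (sym (trans (cong (λ z → z * + 1 * m) (pow-+ 2 6 c)) (regroup (pow 2 c) m)))
      (InS-64-prime-to-3 (Unit₃-2^ c (Unit₆⇒Unit₃ unit₆)))
      where
      regroup : ∀ z w → + 64 * z * + 1 * w ≡ + 64 * (z * w)
      regroup = solve-∀
    6+-3+ : ∀ {a b} → ∃[ c ] 6 ℕ.+ c ≡ a → ∃[ d ] 3 ℕ.+ d ≡ b → Exponents a b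
    6+-3+ (c , refl) (d , refl) = subst InS-Q12
      (sym (trans (cong₂ (λ y z → y * z * m) (pow-+ 2 6 c) (pow-+ 3 3 d)) (regroup (pow 2 c) (pow 3 d) m)))
      (InS-1728 (pow 2 c * (pow 3 d * m)))
      where
      regroup : ∀ y z w → + 64 * y * (+ 27 * z) * w ≡ + 64 * (+ 27 * (y * (z * w)))
      regroup = solve-∀
    go : ∀ {a b} → a ≡ 0 ⊎ a ≡ 4 ⊎ 6 ℕ.≤ a → b ≡ 0 ⊎ 3 ℕ.≤ b → Exponents a b
    go (inj₁ refl)        (inj₁ refl) = subst InS-Q12 (sym (*-identityˡ m)) (InS-prime-to-6 unit₆)
    go (inj₁ refl)        (inj₂ 3≤b)  = 0-3+ (≤⇒+ 3≤b)
    go (inj₂ (inj₁ refl)) (inj₁ refl) = InS-16-prime-to-6 unit₆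
    go (inj₂ (inj₁ refl)) (inj₂ 3≤b)  = 4-3+ (≤⇒+ 3≤b)
    go (inj₂ (inj₂ 6≤a))  (inj₁ refl) = 6+-0 (≤⇒+ 6≤a)
    go (inj₂ (inj₂ 6≤a))  (inj₂ 3≤b)  = 6+-3+ (≤⇒+ 6≤a) (≤⇒+ 3≤b)

  -- The weight 81 gives the exponent 4 with A = 1 and, since 27 · 81 = 3⁷, all exponents from 7 on
  -- with A = -3. The exponent 6 lies between them and uses the weight 729.
  InS-FormII : ∀ {n} → FormII n → InS-Q12 n
  InS-FormII (m , b , cop , b∈ , refl) = go b∈
    where
    unit₃ = Unit₆⇒Unit₃ (coprime⇒Unit₆ m cop)
    7+ : ∀ c → InS-Q12 (+ 32 * pow 3 (7 ℕ.+ c) * m)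
    7+ c = subst InS-Q12 (sym (trans (cong (λ z → + 32 * z * m) (pow-+ 3 7 c)) (regroup (pow 3 c) m)))
      (InS-864 (+ 81) Weight-81 (pow 3 c * m))
      where
      regroup : ∀ x w → + 32 * (+ 2187 * x) * w ≡ + 32 * (+ 27 * (+ 81 * (x * w)))
      regroup = solve-∀
    6+ : ∀ {b} → ∃[ c ] 6 ℕ.+ c ≡ b → InS-Q12 (+ 32 * pow 3 b * m)
    6+ (zero  , refl) = subst InS-Q12 (sym (*-assoc (+ 32) (+ 729) m)) (InS-32-prime-to-3 (+ 729) Weight-729 unit₃)
    6+ (suc c , refl) = subst (λ b → InS-Q12 (+ 32 * pow 3 b * m)) (sym (ℕ.+-suc 6 c)) (7+ c)
    go : ∀ {b} → b ≡ 4 ⊎ 6 ℕ.≤ b → InS-Q12 (+ 32 * pow 3 b * m)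
    go (inj₁ refl) = subst InS-Q12 (sym (*-assoc (+ 32) (+ 81) m)) (InS-32-prime-to-3 (+ 81) Weight-81 unit₃)
    go (inj₂ 6≤b)  = 6+ (≤⇒+ 6≤b)

  Weight-special : ∀ {k} → SpecialK k → Weight (+ k)
  Weight-special (p , p-prime , inj₁ (p%12≡5 , refl)) = Weight-p p-prime p%12≡5
  Weight-special (p , p-prime , inj₂ (p%6≡5 , refl)) = subst Weight (sym (pos-* p p)) (Weight-p² p-prime p%6≡5)

  InS-FormIII : ∀ {n} → FormIII n → InS-Q12 n
  InS-FormIII (m , b , k , cop , b∈ , special , refl) = go b∈
    where
    unit₃ = Unit₆⇒Unit₃ (coprime⇒Unit₆ m cop)
    wt : Weight (+ k)
    wt = Weight-special special
    go : ∀ {b} → b ≡ 0 ⊎ b ≡ 3 ⊎ b ≡ 5 → InS-Q12 (+ 32 * pow 3 b * m * + k)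
    go (inj₁ refl) = subst InS-Q12 (regroup (+ k) m) (InS-32-prime-to-3 (+ k) wt unit₃)
      where
      regroup : ∀ k m → + 32 * (k * m) ≡ + 32 * m * k
      regroup = solve-∀
    go (inj₂ (inj₁ refl)) = subst InS-Q12 (regroup (+ k) m) (InS-864 (+ k) wt m)
      where
      regroup : ∀ k m → + 32 * (+ 27 * (k * m)) ≡ + 864 * m * k
      regroup = solve-∀
    go (inj₂ (inj₂ refl)) = subst InS-Q12 (regroup (+ k) m) (InS-864 (+ k) wt (+ 9 * m))
      where
      regroup : ∀ k m → + 32 * (+ 27 * (k * (+ 9 * m))) ≡ + 7776 * m * k
      regroup = solve-∀

-- Prime divisors in given residue classes, and exact powers of primes.

module PrimeDivisors where

  open import Data.Nat using (ℕ; nonTrivial⇒n>1; >-nonZero; ≢-nonZero; zero; suc; _+_; _*_; _∸_; _^_; _≤_; _<_; z≤n; s≤s; z<s; _%_; _/_; NonZero)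
  open import Data.Nat.Coprimality using (Coprime; coprime-divisor; coprime-Bézout)
  open import Data.Nat.Divisibility
  open import Data.Nat.DivMod
  open import Data.Nat.GCD using (module Bézout)
  open import Data.Nat.Induction using (<-rec)
  open import Data.Nat.ListAction using (product)
  open import Data.Nat.Primality
  open import Data.Nat.Primality.Factorisation using (factorise; module PrimeFactorisation)
  open import Data.Nat.Properties
  open import Data.Nat.Tactic.RingSolver using (solve-∀)
  open import Data.Fin using (Fin; toℕ; fromℕ<)
  open import Data.Fin.Properties using (all?; toℕ-fromℕ<)
  open import Data.List using (List; []; _∷_)
  open import Data.List.Relation.Unary.All using (All; []; _∷_)
  open import Relation.Nullary.Decidable using (from-yes; _⊎-dec_; _→-dec_; ¬?)

  %6≡5-product : ∀ a b → (a * b) % 6 ≡ 5 → a % 6 ≡ 5 ⊎ b % 6 ≡ 5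
  %6≡5-product a b eq = subst₂ (λ i j → i ≡ 5 ⊎ j ≡ 5) (toℕ-fromℕ< (m%n<n a 6)) (toℕ-fromℕ< (m%n<n b 6))
    (table (fromℕ< (m%n<n a 6)) (fromℕ< (m%n<n b 6)) (trans
      (cong₂ (λ i j → (i * j) % 6) (toℕ-fromℕ< (m%n<n a 6)) (toℕ-fromℕ< (m%n<n b 6)))
      (trans (sym (%-distribˡ-* a b 6)) eq)))
    where
    table : ∀ (i j : Fin 6) → (toℕ i * toℕ j) % 6 ≡ 5 → toℕ i ≡ 5 ⊎ toℕ j ≡ 5
    table = from-yes (all? {n = 6} λ i → all? {n = 6} λ j →
      ((toℕ i * toℕ j) % 6 ≟ 5) →-dec ((toℕ i ≟ 5) ⊎-dec (toℕ j ≟ 5)))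

  %4≡3-cofactor : ∀ a b → a % 4 ≡ 3 → (a * b) % 4 ≡ 1 → b % 4 ≡ 3
  %4≡3-cofactor a b eq₁ eq₂ = subst (_≡ 3) (toℕ-fromℕ< (m%n<n b 4)) (table (fromℕ< (m%n<n b 4)) (trans
    (cong₂ (λ i j → (i * j) % 4) (sym eq₁) (toℕ-fromℕ< (m%n<n b 4))) (trans (sym (%-distribˡ-* a b 4)) eq₂)))
    where
    table : ∀ (j : Fin 4) → (3 * toℕ j) % 4 ≡ 1 → toℕ j ≡ 3
    table = from-yes (all? {n = 4} λ j → ((3 * toℕ j) % 4 ≟ 1) →-dec (toℕ j ≟ 3))

  -- A product is 5 modulo 6 only if one of its factors is, so the factorisation of `n` can be
  -- searched from the front.
  prime-factor-5-mod-6 : ∀ n → n % 6 ≡ 5 → ∃[ p ] Prime p × p % 6 ≡ 5 × p ∣ n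
  prime-factor-5-mod-6 zero ()
  prime-factor-5-mod-6 n@(suc _) eq = subst (λ m → ∃[ p ] Prime p × p % 6 ≡ 5 × p ∣ m) (sym isFactorisation)
    (search factors factorsPrime (trans (cong (_% 6) (sym isFactorisation)) eq))
    where
    open PrimeFactorisation (factorise n)
    search : ∀ ps → All Prime ps → product ps % 6 ≡ 5 → ∃[ p ] Prime p × p % 6 ≡ 5 × p ∣ product ps
    search []       []             ()
    search (p ∷ ps) (p-prime ∷ pr) eq with %6≡5-product p (product ps) eq
    ... | inj₁ p%6≡5 = p , p-prime , p%6≡5 , m∣m*n (product ps)
    ... | inj₂ rest with search ps pr rest
    ...   | q , q-prime , q%6≡5 , q∣ = q , q-prime , q%6≡5 , ∣n⇒∣m*n p q∣

  -- Descent: if t ≡ 3 mod 4 divides x² + 1 with x even and x < t, then so does the cofactor, which is smaller.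
  3-mod-4∤x²+1 : ∀ t x → t % 4 ≡ 3 → ¬ (t ∣ x * x + 1)
  3-mod-4∤x²+1 = <-rec (λ t → ∀ x → t % 4 ≡ 3 → ¬ (t ∣ x * x + 1)) step
    where
    step : ∀ t → (∀ {s} → s < t → ∀ x → s % 4 ≡ 3 → ¬ (s ∣ x * x + 1)) →
      ∀ x → t % 4 ≡ 3 → ¬ (t ∣ x * x + 1)
    step zero _ _ ()
    step t@(suc t-1) rec x t%4≡3 t∣ = reduced (x % t) (m%n<n x t) t∣r²+1
      where
      t∣r²+1 : t ∣ x % t * (x % t) + 1
      t∣r²+1 = m%n≡0⇒n∣m _ t (trans (%-distribˡ-+ (x % t * (x % t)) 1 t) (trans
        (cong (λ z → (z + 1 % t) % t) (sym (%-distribˡ-* x x t))) (trans (sym (%-distribˡ-+ (x * x) 1 t))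
        (n∣m⇒m%n≡0 _ t t∣))))
      -- t - x has the parity opposite to that of x.
      even-reduced : ∀ y → 2 * y < t → ¬ (t ∣ 2 * y * (2 * y) + 1)
      even-reduced y 2y<t (divides s eq) = rec s<t (2 * y) s%4≡3 (divides t (trans eq (*-comm s t)))
        where
        square%4 : (2 * y * (2 * y) + 1) % 4 ≡ 1
        square%4 = trans (cong (_% 4) (reorder y)) ([m+kn]%n≡m%n 1 (y * y) 4)
          where
          reorder : ∀ y → 2 * y * (2 * y) + 1 ≡ 1 + y * y * 4
          reorder = solve-∀
        s%4≡3 : s % 4 ≡ 3
        s%4≡3 = %4≡3-cofactor t s t%4≡3 (trans (cong (_% 4) (trans (*-comm t s) (sym eq))) square%4)
        s<t : s < t
        s<t = *-cancelʳ-< t s t (subst (_< t * t) eq (≤-<-trans (+-monoˡ-≤ 1 (*-mono-≤ 2y≤t-1 2y≤t-1)) (square< t-1 0<t-1)))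
          where
          2y≤t-1 = ≤-pred 2y<t
          0<t-1 : 0 < t-1
          0<t-1 = n≢0⇒n>0 λ { refl → contradiction t%4≡3 λ () }
          square< : ∀ a → 0 < a → a * a + 1 < suc a * suc a
          square< a a>0 = ≤-trans (≤-reflexive (+-comm 1 (a * a + 1)))
            (≤-trans (+-monoʳ-≤ (a * a + 1) (≤-trans a>0 (m≤m+n a a))) (≤-reflexive (reorder a)))
            where
            reorder : ∀ a → a * a + 1 + (a + a) ≡ suc a * suc a
            reorder = solve-∀
      reduced : ∀ r → r < t → ¬ (t ∣ r * r + 1)
      reduced r r<t t∣ with r % 2 in r%2 | m≡m%n+[m/n]*n r 2
      ... | 0 | r≡ = even-reduced (r / 2) (subst (_< t) r≡2* r<t) (subst (λ z → t ∣ z * z + 1) r≡2* t∣)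
        where r≡2* = trans r≡ (*-comm (r / 2) 2)
      ... | 1 | r≡ with 2∣t∸r
        where
        2∣t∸r : 2 ∣ t ∸ r
        2∣t∸r = ∣m+n∣m⇒∣n (divides (2 + t / 4 * 2 + r / 2) (begin
          2 * r + (t ∸ r)                       ≡⟨ cong (_+ (t ∸ r)) (cong (r +_) (+-identityʳ r)) ⟩
          r + r + (t ∸ r)                       ≡⟨ +-assoc r r (t ∸ r) ⟩
          r + (r + (t ∸ r))                     ≡⟨ cong (r +_) (m+[n∸m]≡n (<⇒≤ r<t)) ⟩
          r + t                                 ≡⟨ cong₂ _+_ r≡ (trans (m≡m%n+[m/n]*n t 4) (cong (_+ t / 4 * 4) t%4≡3)) ⟩
          1 + r / 2 * 2 + (3 + t / 4 * 4)       ≡⟨ reorder (r / 2) (t / 4) ⟩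
          (2 + t / 4 * 2 + r / 2) * 2           ∎)) (m∣m*n r)
          where
          open ≡-Reasoning
          reorder : ∀ v u → 1 + v * 2 + (3 + u * 4) ≡ (2 + u * 2 + v) * 2
          reorder = solve-∀
      ...   | divides y t∸r≡ = even-reduced y (subst (_< t) 2y≡ t∸r<t)
              (∣m+n∣m⇒∣n (subst (t ∣_) shifted (∣m∣n⇒∣m+n t∣ (n∣m*n t))) (n∣m*n (2 * r)))
        where
        2y≡ : t ∸ r ≡ 2 * y
        2y≡ = trans t∸r≡ (*-comm y 2)
        t∸r<t : t ∸ r < t
        t∸r<t = ∸-monoʳ-< {t} {r} {0} (subst (0 <_) (sym r≡) z<s) (<⇒≤ r<t)
        shifted : r * r + 1 + t * t ≡ 2 * r * t + (2 * y * (2 * y) + 1)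
        shifted = begin
          r * r + 1 + t * t
            ≡⟨ cong (λ z → r * r + 1 + z * z) t≡ ⟩
          r * r + 1 + (r + 2 * y) * (r + 2 * y)
            ≡⟨ expand r (2 * y) ⟩
          2 * r * (r + 2 * y) + (2 * y * (2 * y) + 1)
            ≡⟨ cong (λ z → 2 * r * z + (2 * y * (2 * y) + 1)) (sym t≡) ⟩
          2 * r * t + (2 * y * (2 * y) + 1) ∎
          where
          open ≡-Reasoning
          t≡ : t ≡ r + 2 * y
          t≡ = trans (sym (m+[n∸m]≡n (<⇒≤ r<t))) (cong (r +_) 2y≡)
          expand : ∀ r d → r * r + 1 + (r + d) * (r + d) ≡ 2 * r * (r + d) + (d * d + 1)
          expand = solve-∀
      reduced r r<t t∣ | suc (suc k) | _ = contradiction (subst (_< 2) r%2 (m%n<n r 2)) λ { (s≤s (s≤s ())) }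

  prime∤⇒coprime : ∀ {p} → Prime p → ∀ {x} → ¬ (p ∣ x) → Coprime x p
  prime∤⇒coprime p-prime p∤x (d∣x , d∣p) with prime⇒irreducible p-prime d∣p
  ... | inj₁ d≡1 = d≡1
  ... | inj₂ refl = contradiction d∣x p∤x

  3-mod-4-prime∣ : ∀ {p} → Prime p → p % 4 ≡ 3 → ∀ x y → p ∣ x * x + y * y → p ∣ x
  3-mod-4-prime∣ {p} p-prime p%4≡3 x y p∣ with p ∣? x
  ... | yes p∣x = p∣x
  ... | no p∤x with coprime-Bézout (prime∤⇒coprime p-prime p∤x)
  ...   | Bézout.+- u v eq = contradiction (∣m+n∣m⇒∣n (subst (p ∣_) expand (∣n⇒∣m*n (u * u) p∣)) (n∣m*n (2 * v + v * p * v)))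
            (3-mod-4∤x²+1 p (u * y) p%4≡3)
    where
    -- u x ≡ 1 modulo p, hence (u y)² + 1 ≡ u² (x² + y²).
    expand : u * u * (x * x + y * y) ≡ (2 * v + v * p * v) * p + (u * y * (u * y) + 1)
    expand = begin
      u * u * (x * x + y * y)                               ≡⟨ regroup u x y ⟩
      (u * x) * (u * x) + u * y * (u * y)                   ≡⟨ cong (λ z → z * z + u * y * (u * y)) (sym eq) ⟩
      (1 + v * p) * (1 + v * p) + u * y * (u * y)           ≡⟨ square v p (u * y * (u * y)) ⟩
      (2 * v + v * p * v) * p + (u * y * (u * y) + 1)       ∎
      where
      open ≡-Reasoning
      regroup : ∀ u x y → u * u * (x * x + y * y) ≡ (u * x) * (u * x) + u * y * (u * y)
      regroup = solve-∀
      square : ∀ v p w → (1 + v * p) * (1 + v * p) + w ≡ (2 * v + v * p * v) * p + (w + 1)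
      square = solve-∀
  ...   | Bézout.-+ u v eq = contradiction (∣m+n∣m⇒∣n (subst (p ∣_) expand (∣m∣n⇒∣m+n (∣n⇒∣m*n (u * u) p∣) (n∣m*n (2 * v))))
            (n∣m*n (v * p * v))) (3-mod-4∤x²+1 p (u * y) p%4≡3)
    where
    -- u x ≡ -1 modulo p.
    expand : u * u * (x * x + y * y) + 2 * v * p ≡ v * p * v * p + (u * y * (u * y) + 1)
    expand = begin
      u * u * (x * x + y * y) + 2 * v * p
        ≡⟨ regroup u x y v p ⟩
      (u * x) * (u * x) + u * y * (u * y) + 2 * (v * p)
        ≡⟨ cong (λ z → (u * x) * (u * x) + u * y * (u * y) + 2 * z) (sym eq) ⟩
      (u * x) * (u * x) + u * y * (u * y) + 2 * (1 + u * x)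
        ≡⟨ square (u * x) (u * y * (u * y)) ⟩
      (1 + u * x) * (1 + u * x) + (u * y * (u * y) + 1)
        ≡⟨ cong (λ z → z * z + (u * y * (u * y) + 1)) eq ⟩
      v * p * (v * p) + (u * y * (u * y) + 1)
        ≡⟨ cong (_+ (u * y * (u * y) + 1)) (sym (*-assoc (v * p) v p)) ⟩
      v * p * v * p + (u * y * (u * y) + 1) ∎
      where
      open ≡-Reasoning
      regroup : ∀ u x y v p → u * u * (x * x + y * y) + 2 * v * p ≡ (u * x) * (u * x) + u * y * (u * y) + 2 * (v * p)
      regroup = solve-∀
      square : ∀ a w → a * a + w + 2 * (1 + a) ≡ (1 + a) * (1 + a) + (w + 1)
      square = solve-∀

  residue-mod-12 : ∀ p → p % 6 ≡ 5 → p % 12 ≡ 5 ⊎ p % 12 ≡ 11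
  residue-mod-12 p eq = subst (λ r → r ≡ 5 ⊎ r ≡ 11) (toℕ-fromℕ< (m%n<n p 12))
    (table (fromℕ< (m%n<n p 12)) (trans (cong (_% 6) (toℕ-fromℕ< (m%n<n p 12)))
      (trans (m∣n⇒o%n%m≡o%m 6 12 p (divides 2 refl)) eq)))
    where
    table : ∀ (r : Fin 12) → toℕ r % 6 ≡ 5 → toℕ r ≡ 5 ⊎ toℕ r ≡ 11
    table = from-yes (all? {n = 12} λ r → (toℕ r % 6 ≟ 5) →-dec ((toℕ r ≟ 5) ⊎-dec (toℕ r ≟ 11)))

  unit-mod-6 : ∀ n → ¬ (2 ∣ n) → ¬ (3 ∣ n) → n % 6 ≡ 1 ⊎ n % 6 ≡ 5
  unit-mod-6 n 2∤n 3∤n = subst (λ r → r ≡ 1 ⊎ r ≡ 5) (toℕ-fromℕ< (m%n<n n 6))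
    (table (fromℕ< (m%n<n n 6)) (nonzero 2 (divides 3 refl) 2∤n) (nonzero 3 (divides 2 refl) 3∤n))
    where
    nonzero : ∀ d .⦃ _ : NonZero d ⦄ → d ∣ 6 → ¬ (d ∣ n) → toℕ (fromℕ< (m%n<n n 6)) % d ≢ 0
    nonzero d d∣6 d∤n eq = d∤n (m%n≡0⇒n∣m n d (trans (sym (m∣n⇒o%n%m≡o%m d 6 n d∣6))
      (trans (cong (_% d) (sym (toℕ-fromℕ< (m%n<n n 6)))) eq)))
    table : ∀ (r : Fin 6) → toℕ r % 2 ≢ 0 → toℕ r % 3 ≢ 0 → toℕ r ≡ 1 ⊎ toℕ r ≡ 5
    table = from-yes (all? {n = 6} λ r →
      (¬? (toℕ r % 2 ≟ 0)) →-dec ((¬? (toℕ r % 3 ≟ 0)) →-dec ((toℕ r ≟ 1) ⊎-dec (toℕ r ≟ 5))))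

  -- If v₂(x² + y²) is odd and β ≡ x² + y² modulo 3, then either the odd part of x² + y² or β is 2 modulo 3.
  special-divisor : ∀ {x y β τ} → x * x + y * y ≡ 2 * τ ⊎ x * x + y * y ≡ 8 * τ →
    ¬ (2 ∣ τ) → ¬ (2 ∣ β) → ¬ (3 ∣ x * x + y * y) → β % 3 ≡ (x * x + y * y) % 3 →
    ∃[ k ] SpecialK k × k ∣ (x * x + y * y) * (β * β)
  special-divisor {x} {y} {β} {τ} N≡ 2∤τ 2∤β 3∤N β≡N = by-τ (unit-mod-6 τ 2∤τ (λ 3∣τ → 3∤N (∣-trans 3∣τ τ∣N)))
    where
    N = x * x + y * y
    τ∣N : τ ∣ N
    τ∣N = [ divides 2 , divides 8 ]′ N≡
    N%3≡2 : τ % 6 ≡ 1 → N % 3 ≡ 2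
    N%3≡2 eq = [ of-multiple 2 , of-multiple 8 ]′ N≡
      where
      τ%3≡1 : τ % 3 ≡ 1
      τ%3≡1 = trans (sym (m∣n⇒o%n%m≡o%m 3 6 τ (divides 2 refl))) (cong (_% 3) eq)
      of-multiple : ∀ c → ⦃ c % 3 ≡ 2 ⦄ → N ≡ c * τ → N % 3 ≡ 2
      of-multiple c ⦃ c%3≡2 ⦄ eq = trans (cong (_% 3) eq) (trans (%-distribˡ-* c τ 3)
        (cong₂ (λ i j → (i * j) % 3) c%3≡2 τ%3≡1))
    by-β : N % 3 ≡ 2 → β % 6 ≡ 1 ⊎ β % 6 ≡ 5 → ∃[ k ] SpecialK k × k ∣ N * (β * β)
    by-β N%3≡2 (inj₁ β%6≡1) = contradiction (trans (sym (trans (sym (m∣n⇒o%n%m≡o%m 3 6 β (divides 2 refl)))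
      (cong (_% 3) β%6≡1))) (trans β≡N N%3≡2)) λ ()
    by-β N%3≡2 (inj₂ β%6≡5) with prime-factor-5-mod-6 β β%6≡5
    ... | p , p-prime , p%6≡5 , p∣β = p * p , (p , p-prime , inj₂ (p%6≡5 , refl)) , ∣n⇒∣m*n N (*-pres-∣ p∣β p∣β)
    by-τ : τ % 6 ≡ 1 ⊎ τ % 6 ≡ 5 → ∃[ k ] SpecialK k × k ∣ N * (β * β)
    by-τ (inj₁ τ%6≡1) = by-β (N%3≡2 τ%6≡1) (unit-mod-6 β 2∤β (λ 3∣β → 3∤N
      (m%n≡0⇒n∣m N 3 (trans (sym β≡N) (n∣m⇒m%n≡0 β 3 3∣β)))))
    by-τ (inj₂ τ%6≡5) with prime-factor-5-mod-6 τ τ%6≡5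
    ... | p , p-prime , p%6≡5 , p∣τ with residue-mod-12 p p%6≡5
    ...   | inj₁ p%12≡5  = p , (p , p-prime , inj₁ (p%12≡5 , refl)) , ∣m⇒∣m*n (β * β) (∣-trans p∣τ τ∣N)
    ...   | inj₂ p%12≡11 = p * p , (p , p-prime , inj₂ (p%6≡5 , refl)) ,
              ∣m⇒∣m*n (β * β) (∣m∣n⇒∣m+n (*-pres-∣ p∣x p∣x) (*-pres-∣ p∣y p∣y))
      where
      p%4≡3 : p % 4 ≡ 3
      p%4≡3 = trans (sym (m∣n⇒o%n%m≡o%m 4 12 p (divides 3 refl))) (cong (_% 4) p%12≡11)
      p∣N = ∣-trans p∣τ τ∣N
      p∣x = 3-mod-4-prime∣ p-prime p%4≡3 x y p∣N
      p∣y = 3-mod-4-prime∣ p-prime p%4≡3 y x (subst (p ∣_) (+-comm (x * x) (y * y)) p∣N)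

  remove-factor : ∀ p n → 1 < p → n ≢ 0 → ∃[ a ] ∃[ r ] n ≡ p ^ a * r × ¬ (p ∣ r)
  remove-factor p n 1<p = <-rec (λ n → n ≢ 0 → ∃[ a ] ∃[ r ] n ≡ p ^ a * r × ¬ (p ∣ r)) step n
    where
    step : ∀ n → (∀ {m} → m < n → m ≢ 0 → ∃[ a ] ∃[ r ] m ≡ p ^ a * r × ¬ (p ∣ r)) →
      n ≢ 0 → ∃[ a ] ∃[ r ] n ≡ p ^ a * r × ¬ (p ∣ r)
    step n rec n≢0 with p ∣? n
    ... | no p∤n = 0 , n , sym (*-identityˡ n) , p∤n
    ... | yes (divides m n≡) with rec m<n m≢0
      where
      m≢0 : m ≢ 0
      m≢0 refl = n≢0 n≡
      m<n : m < n
      m<n = subst (m <_) (sym n≡) (m<m*n m p ⦃ ≢-nonZero m≢0 ⦄ 1<p)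
    ...   | a , r , m≡ , p∤r = suc a , r , trans n≡ (trans (cong (_* p) m≡)
              (trans (*-comm (p ^ a * r) p) (sym (*-assoc p (p ^ a) r)))) , p∤r

  ^-∣⇒≤ : ∀ p i a {r} → 1 < p → ¬ (p ∣ r) → p ^ i ∣ p ^ a * r → i ≤ a
  ^-∣⇒≤ p zero    a       1<p p∤r _ = z≤n
  ^-∣⇒≤ p (suc i) zero {r} 1<p p∤r pᵢ∣ =
    contradiction (∣-trans (m∣m*n (p ^ i)) (subst (p ^ suc i ∣_) (*-identityˡ r) pᵢ∣)) p∤r
  ^-∣⇒≤ p (suc i) (suc a) {r} 1<p p∤r pᵢ∣ = s≤s (^-∣⇒≤ p i a 1<p p∤r
    (*-cancelˡ-∣ p ⦃ >-nonZero (<-trans z<s 1<p) ⦄ (subst (p ^ suc i ∣_) (*-assoc p (p ^ a) r) pᵢ∣)))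

  ≤⇒^-∣ : ∀ p {i a} r → i ≤ a → p ^ i ∣ p ^ a * r
  ≤⇒^-∣ p {i} {a} r i≤a = ∣m⇒∣m*n r (subst (p ^ i ∣_)
    (trans (sym (^-distribˡ-+-* p i (a ∸ i))) (cong (p ^_) (m+[n∸m]≡n i≤a))) (m∣m*n (p ^ (a ∸ i))))

  coprime-power-divisor : ∀ p → Prime p → ∀ a {k o} → Coprime k p → k ∣ p ^ a * o → k ∣ o
  coprime-power-divisor p p-prime zero    {k} {o} cop k∣ = subst (k ∣_) (*-identityˡ o) k∣
  coprime-power-divisor p p-prime (suc a) {k} {o} cop k∣ = coprime-power-divisor p p-prime a cop
    (coprime-divisor cop (subst (k ∣_) (*-assoc p (p ^ a) o) k∣))

  special∤ : ∀ {k} q → Prime q → q ∣ 6 → SpecialK k → Coprime k q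
  special∤ {k} q q-prime q∣6 special = prime∤⇒coprime q-prime (go special)
    where
    q∤ : ∀ p → p % 6 ≡ 5 → ¬ (q ∣ p)
    q∤ p p%6≡5 q∣p = no-common q q-prime q∣6 (∣m+n∣m⇒∣n (subst (q ∣_) (trans (trans (m≡m%n+[m/n]*n p 6)
      (cong (_+ p / 6 * 6) p%6≡5)) (+-comm 5 (p / 6 * 6))) q∣p) (∣-trans q∣6 (n∣m*n (p / 6))))
      where
      no-common : ∀ q → Prime q → q ∣ 6 → ¬ (q ∣ 5)
      no-common q q-prime q∣6 q∣5 = contradiction (∣m+n∣m⇒∣n {q} {5} {1} q∣6 q∣5) λ q∣1 →
        <-irrefl (sym (∣1⇒≡1 q∣1)) (nonTrivial⇒n>1 q ⦃ prime⇒nonTrivial q-prime ⦄)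
    go : ∀ {k} → SpecialK k → ¬ (q ∣ k)
    go (p , _ , inj₁ (p%12≡5 , refl)) =
      q∤ p (trans (sym (m∣n⇒o%n%m≡o%m 6 12 p (divides 2 refl))) (cong (_% 6) p%12≡5))
    go (p , _ , inj₂ (p%6≡5 , refl)) q∣pp = [ q∤ p p%6≡5 , q∤ p p%6≡5 ]′ (euclidsLemma p p q-prime q∣pp)

-- Powers of 2 and 3 in a value of the determinant.

module Necessity where

  open GroupDeterminant using (Triple; ⟨_,_,_⟩; trace; norm; productForm; tripleˢ; tripleˢ′; tripleʷ; tripleʷ′; groupDet-product)
  open Families using (Odd; parity; Unit₃; _≡±_; scale; ≡±-trans)
  open EisensteinNorms using (square≡+; positive-multiple)
  open Weights using (trichotomy₃; ≡±⇒square; multiple-difference⇒∣)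
  open Sufficiency using (multiple⇒∣∣)
  open PrimeDivisors
  open import Data.Fin using (#_)
  import Data.Nat.Coprimality as ℕ
  import Data.Nat.Divisibility as ℕ
  import Data.Nat.DivMod as ℕ
  import Data.Nat.Properties as ℕ
  import Data.Nat.Primality as ℕ
  open import Data.Integer as ℤ using (ℤ; +_; -_; _+_; _*_; _-_; ∣_∣; _◃_)
  open import Data.Integer.Properties
  import Data.Sign as Sign
  open import Data.Integer.Tactic.RingSolver using (solve-∀)
  open import Relation.Nullary.Decidable using (from-no; from-yes)

  Even : ℤ → Set
  Even z = ∃[ k ] z ≡ + 2 * k

  Odd-* : ∀ {a b} → Odd a → Odd b → Odd (a * b)
  Odd-* (i , refl) (j , refl) = + 2 * (i * j) + i + j , expand i j
    where
    expand : ∀ i j → (+ 2 * i + + 1) * (+ 2 * j + + 1) ≡ + 2 * (+ 2 * (i * j) + i + j) + + 1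
    expand = solve-∀

  Odd-+2* : ∀ {a} k → Odd a → Odd (a + + 2 * k)
  Odd-+2* k (i , refl) = i + k , expand i k
    where
    expand : ∀ i k → + 2 * i + + 1 + + 2 * k ≡ + 2 * (i + k) + + 1
    expand = solve-∀

  data SumParity (N : ℤ) : Set where
    odd         : Odd N → SumParity N
    twice-odd   : ∀ t → Odd t → N ≡ + 2 * t → SumParity N
    multiple-4  : ∀ z → N ≡ + 4 * z → SumParity N

  sum-parity : ∀ x y → SumParity (x * x + y * y)
  sum-parity x y = go (parity x) (parity y)
    where
    go : Even x ⊎ Odd x → Even y ⊎ Odd y → SumParity (x * x + y * y)
    go (inj₁ (p , refl)) (inj₁ (q , refl)) = multiple-4 (p * p + q * q) (expand p q)
      where
      expand : ∀ p q → + 2 * p * (+ 2 * p) + + 2 * q * (+ 2 * q) ≡ + 4 * (p * p + q * q)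
      expand = solve-∀
    go (inj₁ (p , refl)) (inj₂ (q , refl)) = odd (+ 2 * (p * p + q * q + q) , expand p q)
      where
      expand : ∀ p q → + 2 * p * (+ 2 * p) + (+ 2 * q + + 1) * (+ 2 * q + + 1) ≡ + 2 * (+ 2 * (p * p + q * q + q)) + + 1
      expand = solve-∀
    go (inj₂ (p , refl)) (inj₁ (q , refl)) = odd (+ 2 * (p * p + p + q * q) , expand p q)
      where
      expand : ∀ p q → (+ 2 * p + + 1) * (+ 2 * p + + 1) + + 2 * q * (+ 2 * q) ≡ + 2 * (+ 2 * (p * p + p + q * q)) + + 1
      expand = solve-∀
    go (inj₂ (p , refl)) (inj₂ (q , refl)) =
      twice-odd (+ 2 * (p * p + p + q * q + q) + + 1) (p * p + p + q * q + q , refl) (expand p q)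
      where
      expand : ∀ p q → (+ 2 * p + + 1) * (+ 2 * p + + 1) + (+ 2 * q + + 1) * (+ 2 * q + + 1) ≡
        + 2 * (+ 2 * (p * p + p + q * q + q) + + 1)
      expand = solve-∀

  pronic-even : ∀ k → Even (k * k + k)
  pronic-even k = go (parity k)
    where
    go : Even k ⊎ Odd k → Even (k * k + k)
    go (inj₁ (j , refl)) = + 2 * (j * j) + j , expand j
      where
      expand : ∀ j → + 2 * j * (+ 2 * j) + + 2 * j ≡ + 2 * (+ 2 * (j * j) + j)
      expand = solve-∀
    go (inj₂ (j , refl)) = + 2 * (j * j) + + 3 * j + + 1 , expand j
      where
      expand : ∀ j → (+ 2 * j + + 1) * (+ 2 * j + + 1) + (+ 2 * j + + 1) ≡ + 2 * (+ 2 * (j * j) + + 3 * j + + 1)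
      expand = solve-∀

  odd-squares-difference : ∀ p q → ∃[ v ] (+ 2 * p + + 1) * (+ 2 * p + + 1) - (+ 2 * q + + 1) * (+ 2 * q + + 1) ≡ + 8 * v
  odd-squares-difference p q = let i , pp+p≡ = pronic-even p ; j , qq+q≡ = pronic-even q in
    i - j , trans (expand p q) (trans (cong₂ (λ s t → + 4 * (s - t)) pp+p≡ qq+q≡) (collect i j))
    where
    expand : ∀ p q → (+ 2 * p + + 1) * (+ 2 * p + + 1) + - ((+ 2 * q + + 1) * (+ 2 * q + + 1)) ≡
      + 4 * (p * p + p + - (q * q + q))
    expand = solve-∀
    collect : ∀ i j → + 4 * (+ 2 * i + - (+ 2 * j)) ≡ + 8 * (i + - j)
    collect = solve-∀

  difference-parity : ∀ x y → Odd (x * x - y * y) ⊎ ∃[ z ] x * x - y * y ≡ + 4 * z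
  difference-parity x y = go (parity x) (parity y)
    where
    go : Even x ⊎ Odd x → Even y ⊎ Odd y → Odd (x * x - y * y) ⊎ ∃[ z ] x * x - y * y ≡ + 4 * z
    go (inj₁ (p , refl)) (inj₁ (q , refl)) = inj₂ (p * p - q * q , expand p q)
      where
      expand : ∀ p q → + 2 * p * (+ 2 * p) + - (+ 2 * q * (+ 2 * q)) ≡ + 4 * (p * p + - (q * q))
      expand = solve-∀
    go (inj₁ (p , refl)) (inj₂ (q , refl)) = inj₁ (+ 2 * (p * p - q * q - q) - + 1 , expand p q)
      where
      expand : ∀ p q → + 2 * p * (+ 2 * p) + - ((+ 2 * q + + 1) * (+ 2 * q + + 1)) ≡
        + 2 * (+ 2 * (p * p + - (q * q) + - q) + - + 1) + + 1
      expand = solve-∀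
    go (inj₂ (p , refl)) (inj₁ (q , refl)) = inj₁ (+ 2 * (p * p + p - q * q) , expand p q)
      where
      expand : ∀ p q → (+ 2 * p + + 1) * (+ 2 * p + + 1) + - (+ 2 * q * (+ 2 * q)) ≡
        + 2 * (+ 2 * (p * p + p + - (q * q))) + + 1
      expand = solve-∀
    go (inj₂ (p , refl)) (inj₂ (q , refl)) = let v , eq = odd-squares-difference p q in inj₂ (+ 2 * v , trans eq (halve v))
      where
      halve : ∀ v → + 8 * v ≡ + 4 * (+ 2 * v)
      halve = solve-∀

  data Squares (N₁ N₂ : ℤ) : Set where
    mixed     : Odd N₁ → Odd N₂ → Squares N₁ N₂
    both-odd  : ∀ v t → N₁ ≡ + 8 * v → Odd t → N₂ ≡ + 2 * t → Squares N₁ N₂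
    both-even : ∀ p q r s → N₁ ≡ + 4 * (r * r - s * s) → N₂ ≡ + 4 * (p * p + q * q) → Squares N₁ N₂

  -- The traces of f(x), g(x) differ from those of f(-x), g(-x) by even numbers, so one distinction
  -- by parity governs N₁ and N₂ together. Two odd squares differ by a multiple of 8 and add up to
  -- twice an odd number.
  squares : ∀ x y e g →
    Squares ((x + + 2 * e) * (x + + 2 * e) - (y + + 2 * g) * (y + + 2 * g)) (x * x + y * y)
  squares x y e g = go (parity x) (parity y)
    where
    go : Even x ⊎ Odd x → Even y ⊎ Odd y →
      Squares ((x + + 2 * e) * (x + + 2 * e) - (y + + 2 * g) * (y + + 2 * g)) (x * x + y * y)
    go (inj₁ (p , refl)) (inj₁ (q , refl)) = both-even p q (p + e) (q + g) (difference p q e g) (sum p q)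
      where
      difference : ∀ p q e g → (+ 2 * p + + 2 * e) * (+ 2 * p + + 2 * e) + - ((+ 2 * q + + 2 * g) * (+ 2 * q + + 2 * g)) ≡
        + 4 * ((p + e) * (p + e) + - ((q + g) * (q + g)))
      difference = solve-∀
      sum : ∀ p q → + 2 * p * (+ 2 * p) + + 2 * q * (+ 2 * q) ≡ + 4 * (p * p + q * q)
      sum = solve-∀
    go (inj₁ (p , refl)) (inj₂ (q , refl)) = mixed
      (+ 2 * ((p + e) * (p + e) - (q + g) * (q + g) - (q + g)) - + 1 , difference p q e g)
      (+ 2 * (p * p + q * q + q) , sum p q)
      where
      difference : ∀ p q e g → (+ 2 * p + + 2 * e) * (+ 2 * p + + 2 * e) +
          - ((+ 2 * q + + 1 + + 2 * g) * (+ 2 * q + + 1 + + 2 * g)) ≡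
        + 2 * (+ 2 * ((p + e) * (p + e) + - ((q + g) * (q + g)) + - (q + g)) + - + 1) + + 1
      difference = solve-∀
      sum : ∀ p q → + 2 * p * (+ 2 * p) + (+ 2 * q + + 1) * (+ 2 * q + + 1) ≡ + 2 * (+ 2 * (p * p + q * q + q)) + + 1
      sum = solve-∀
    go (inj₂ (p , refl)) (inj₁ (q , refl)) = mixed
      (+ 2 * ((p + e) * (p + e) + (p + e) - (q + g) * (q + g)) , difference p q e g)
      (+ 2 * (p * p + p + q * q) , sum p q)
      where
      difference : ∀ p q e g → (+ 2 * p + + 1 + + 2 * e) * (+ 2 * p + + 1 + + 2 * e) +
          - ((+ 2 * q + + 2 * g) * (+ 2 * q + + 2 * g)) ≡
        + 2 * (+ 2 * ((p + e) * (p + e) + (p + e) + - ((q + g) * (q + g)))) + + 1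
      difference = solve-∀
      sum : ∀ p q → (+ 2 * p + + 1) * (+ 2 * p + + 1) + + 2 * q * (+ 2 * q) ≡ + 2 * (+ 2 * (p * p + p + q * q)) + + 1
      sum = solve-∀
    go (inj₂ (p , refl)) (inj₂ (q , refl)) = let v , eq = odd-squares-difference (p + e) (q + g) in
      both-odd v (+ 2 * (p * p + p + q * q + q) + + 1) (trans (rearrange p q e g) eq) (p * p + p + q * q + q , refl) (sum p q)
      where
      rearrange : ∀ p q e g → (+ 2 * p + + 1 + + 2 * e) * (+ 2 * p + + 1 + + 2 * e) +
          - ((+ 2 * q + + 1 + + 2 * g) * (+ 2 * q + + 1 + + 2 * g)) ≡
        (+ 2 * (p + e) + + 1) * (+ 2 * (p + e) + + 1) + - ((+ 2 * (q + g) + + 1) * (+ 2 * (q + g) + + 1))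
      rearrange = solve-∀
      sum : ∀ p q → (+ 2 * p + + 1) * (+ 2 * p + + 1) + (+ 2 * q + + 1) * (+ 2 * q + + 1) ≡
        + 2 * (+ 2 * (p * p + p + q * q + q) + + 1)
      sum = solve-∀

  fourFactors : (N₁ N₂ A B : ℤ) → ℤ
  fourFactors N₁ N₂ A B = N₁ * N₂ * (A * A) * (B * B)

  fourFactors-cong : ∀ {N₁ N₁′ N₂ N₂′ A A′ B B′} → N₁ ≡ N₁′ → N₂ ≡ N₂′ → A ≡ A′ → B ≡ B′ →
    fourFactors N₁ N₂ A B ≡ fourFactors N₁′ N₂′ A′ B′
  fourFactors-cong refl refl refl refl = refl

  Odd-fourFactors : ∀ {a b c d} → Odd a → Odd b → Odd c → Odd d → Odd (fourFactors a b c d)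
  Odd-fourFactors a b c d = Odd-* (Odd-* (Odd-* a b) (Odd-* c c)) (Odd-* d d)

  -- Exact divisibility by 2⁵ is compatible only with `exceptional`, which therefore keeps what the
  -- search for a special factor needs.
  data TwoAdic (n B N₂ : ℤ) : Set where
    odd         : Odd n → TwoAdic n B N₂
    16-odd      : ∀ u → Odd u → n ≡ + 16 * u → TwoAdic n B N₂
    multiple-64 : ∀ u → n ≡ + 64 * u → TwoAdic n B N₂
    exceptional : ∀ u → n ≡ + 16 * u → Odd B → ∀ t → Odd t → N₂ ≡ + 2 * t ⊎ N₂ ≡ + 8 * t → TwoAdic n B N₂

  -- If B is even then so is A, and 16 divides A² B²; any further factor 2 in A or B enters squared,
  -- and even N₁, N₂ contribute at least 16 more. If B is odd then so is A, and the power of 2 comes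
  -- from N₁ N₂.
  twoAdic : ∀ {N₁ N₂} h B → Squares N₁ N₂ → TwoAdic (fourFactors N₁ N₂ (B + + 2 * h) B) B N₂
  twoAdic {N₁} {N₂} h B sq = by-B (parity B)
    where
    A = B + + 2 * h
    n = fourFactors N₁ N₂ A B
    by-B : Even B ⊎ Odd B → TwoAdic n B N₂
    by-B (inj₁ (b , B≡)) = go sq
      where
      a = b + h
      A≡ : A ≡ + 2 * a
      A≡ = trans (cong (_+ + 2 * h) B≡) (sym (*-distribˡ-+ (+ 2) b h))
      go : Squares N₁ N₂ → TwoAdic n B N₂
      go (both-odd v t N₁≡ _ N₂≡) = multiple-64 (+ 4 * (v * t * (a * a) * (b * b)))
        (trans (fourFactors-cong N₁≡ N₂≡ A≡ B≡) (collect v t a b))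
        where
        collect : ∀ v t a b → + 8 * v * (+ 2 * t) * (+ 2 * a * (+ 2 * a)) * (+ 2 * b * (+ 2 * b)) ≡
          + 64 * (+ 4 * (v * t * (a * a) * (b * b)))
        collect = solve-∀
      go (both-even p q r s N₁≡ N₂≡) = multiple-64 (+ 4 * ((r * r - s * s) * (p * p + q * q) * (a * a) * (b * b)))
        (trans (fourFactors-cong N₁≡ N₂≡ A≡ B≡) (collect (r * r - s * s) (p * p + q * q) a b))
        where
        collect : ∀ v t a b → + 4 * v * (+ 4 * t) * (+ 2 * a * (+ 2 * a)) * (+ 2 * b * (+ 2 * b)) ≡
          + 64 * (+ 4 * (v * t * (a * a) * (b * b)))
        collect = solve-∀
      go (mixed oddN₁ oddN₂) = by-ab (parity a) (parity b)
        where
        by-ab : Even a ⊎ Odd a → Even b ⊎ Odd b → TwoAdic n B N₂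
        by-ab (inj₂ odd-a) (inj₂ odd-b) = 16-odd (fourFactors N₁ N₂ a b) (Odd-fourFactors oddN₁ oddN₂ odd-a odd-b)
          (trans (fourFactors-cong {N₁} {_} {N₂} refl refl A≡ B≡) (collect N₁ N₂ a b))
          where
          collect : ∀ v t a b → v * t * (+ 2 * a * (+ 2 * a)) * (+ 2 * b * (+ 2 * b)) ≡
            + 16 * (v * t * (a * a) * (b * b))
          collect = solve-∀
        by-ab (inj₁ (c , a≡)) _ = multiple-64 (fourFactors N₁ N₂ c b)
          (trans (fourFactors-cong {N₁} {_} {N₂} refl refl (trans A≡ (cong (+ 2 *_) a≡)) B≡) (collect N₁ N₂ c b))
          where
          collect : ∀ v t c b → v * t * (+ 2 * (+ 2 * c) * (+ 2 * (+ 2 * c))) * (+ 2 * b * (+ 2 * b)) ≡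
            + 64 * (v * t * (c * c) * (b * b))
          collect = solve-∀
        by-ab (inj₂ _) (inj₁ (c , b≡)) = multiple-64 (fourFactors N₁ N₂ a c)
          (trans (fourFactors-cong {N₁} {_} {N₂} refl refl A≡ (trans B≡ (cong (+ 2 *_) b≡))) (collect N₁ N₂ a c))
          where
          collect : ∀ v t a c → v * t * (+ 2 * a * (+ 2 * a)) * (+ 2 * (+ 2 * c) * (+ 2 * (+ 2 * c))) ≡
            + 64 * (v * t * (a * a) * (c * c))
          collect = solve-∀
    by-B (inj₂ odd-B) = go sq
      where
      odd-A : Odd A
      odd-A = Odd-+2* h odd-B
      go : Squares N₁ N₂ → TwoAdic n B N₂
      go (mixed oddN₁ oddN₂) = odd (Odd-fourFactors oddN₁ oddN₂ odd-A odd-B)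
      go (both-odd v t N₁≡ odd-t N₂≡) = exceptional (fourFactors v t A B)
        (trans (fourFactors-cong {A = A} {B = B} N₁≡ N₂≡ refl refl) (collect v t A B)) odd-B t odd-t (inj₁ N₂≡)
        where
        collect : ∀ v t a b → + 8 * v * (+ 2 * t) * (a * a) * (b * b) ≡ + 16 * (v * t * (a * a) * (b * b))
        collect = solve-∀
      go (both-even p q r s N₁≡ N₂≡) = by-sum (sum-parity p q)
        where
        v = r * r - s * s
        w = p * p + q * q
        n≡16 : n ≡ + 16 * fourFactors v w A B
        n≡16 = trans (fourFactors-cong {A = A} {B = B} N₁≡ N₂≡ refl refl) (collect v w A B)
          where
          collect : ∀ v t a b → + 4 * v * (+ 4 * t) * (a * a) * (b * b) ≡ + 16 * (v * t * (a * a) * (b * b))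
          collect = solve-∀
        by-sum : SumParity w → TwoAdic n B N₂
        by-sum (twice-odd t odd-t w≡) = exceptional (fourFactors v w A B) n≡16 odd-B t odd-t
          (inj₂ (trans N₂≡ (trans (cong (+ 4 *_) w≡) (collect t))))
          where
          collect : ∀ t → + 4 * (+ 2 * t) ≡ + 8 * t
          collect = solve-∀
        by-sum (multiple-4 z w≡) = multiple-64 (fourFactors v z A B)
          (trans n≡16 (trans (cong (λ w → + 16 * fourFactors v w A B) w≡) (collect v z A B)))
          where
          collect : ∀ v z a b → + 16 * (v * (+ 4 * z) * (a * a) * (b * b)) ≡ + 64 * (v * z * (a * a) * (b * b))
          collect = solve-∀
        -- A difference of two squares is never 2 modulo 4, so no single further factor 2 can come
        -- from N₁.
        by-sum (odd odd-w) = by-difference (difference-parity r s)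
          where
          by-difference : Odd v ⊎ ∃[ z ] v ≡ + 4 * z → TwoAdic n B N₂
          by-difference (inj₁ odd-v) = 16-odd (fourFactors v w A B) (Odd-fourFactors odd-v odd-w odd-A odd-B) n≡16
          by-difference (inj₂ (z , v≡)) = multiple-64 (fourFactors z w A B)
            (trans n≡16 (trans (cong (λ v → + 16 * fourFactors v w A B) v≡) (collect z w A B)))
            where
            collect : ∀ z w a b → + 16 * (+ 4 * z * w * (a * a) * (b * b)) ≡ + 64 * (z * w * (a * a) * (b * b))
            collect = solve-∀

  Unit₃-* : ∀ {a b} → Unit₃ a → Unit₃ b → Unit₃ (a * b)
  Unit₃-* {a} {b} (i , a≡) (j , b≡) = + 3 * (i * j) + i + j , ≡±-trans (scale a b≡)
    (subst (_≡± (+ 3 * (+ 3 * (i * j) + i + j) + + 1)) (*-comm (+ 3 * j + + 1) a)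
      (≡±-trans (scale (+ 3 * j + + 1) a≡) (inj₁ (expand i j))))
    where
    expand : ∀ i j → (+ 3 * j + + 1) * (+ 3 * i + + 1) ≡ + 3 * (+ 3 * (i * j) + i + j) + + 1
    expand = solve-∀

  Unit₃-+3* : ∀ {a} k → Unit₃ a → Unit₃ (a + + 3 * k)
  Unit₃-+3* k (i , inj₁ refl) = i + k , inj₁ (expand i k)
    where
    expand : ∀ i k → + 3 * i + + 1 + + 3 * k ≡ + 3 * (i + k) + + 1
    expand = solve-∀
  Unit₃-+3* {a} k (i , inj₂ -a≡) = i - k , inj₂ (trans (neg-distrib-+ a (+ 3 * k))
    (trans (cong (_+ - (+ 3 * k)) -a≡) (expand i k)))
    where
    expand : ∀ i k → + 3 * i + + 1 + - (+ 3 * k) ≡ + 3 * (i + - k) + + 1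
    expand = solve-∀

  Unit₃-fourFactors : ∀ {a b c d} → Unit₃ a → Unit₃ b → Unit₃ c → Unit₃ d → Unit₃ (fourFactors a b c d)
  Unit₃-fourFactors a b c d = Unit₃-* (Unit₃-* (Unit₃-* a b) (Unit₃-* c c)) (Unit₃-* d d)

  -- As -1 is not a square modulo 3, the sum is divisible by 3 only when both terms are.
  sum-mod-3 : ∀ x y → Unit₃ (x * x + y * y) ⊎ ∃[ p ] ∃[ q ] x * x + y * y ≡ + 9 * (p * p + q * q)
  sum-mod-3 x y = go (trichotomy₃ x) (trichotomy₃ y)
    where
    go : (∃[ j ] x ≡ + 3 * j) ⊎ Unit₃ x → (∃[ j ] y ≡ + 3 * j) ⊎ Unit₃ y →
      Unit₃ (x * x + y * y) ⊎ ∃[ p ] ∃[ q ] x * x + y * y ≡ + 9 * (p * p + q * q)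
    go (inj₁ (p , refl)) (inj₁ (q , refl)) = inj₂ (p , q , expand p q)
      where
      expand : ∀ p q → + 3 * p * (+ 3 * p) + + 3 * q * (+ 3 * q) ≡ + 9 * (p * p + q * q)
      expand = solve-∀
    go (inj₁ (p , refl)) (inj₂ (q , y≡)) = inj₁ (+ 3 * (p * p + q * q) + + 2 * q ,
      inj₁ (trans (cong (_+_ (+ 3 * p * (+ 3 * p))) (≡±⇒square y≡)) (expand p q)))
      where
      expand : ∀ p q → + 3 * p * (+ 3 * p) + (+ 3 * q + + 1) * (+ 3 * q + + 1) ≡
        + 3 * (+ 3 * (p * p + q * q) + + 2 * q) + + 1
      expand = solve-∀
    go (inj₂ (p , x≡)) (inj₁ (q , refl)) = inj₁ (+ 3 * (p * p + q * q) + + 2 * p ,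
      inj₁ (trans (cong (_+ + 3 * q * (+ 3 * q)) (≡±⇒square x≡)) (expand p q)))
      where
      expand : ∀ p q → (+ 3 * p + + 1) * (+ 3 * p + + 1) + + 3 * q * (+ 3 * q) ≡
        + 3 * (+ 3 * (p * p + q * q) + + 2 * p) + + 1
      expand = solve-∀
    go (inj₂ (p , x≡)) (inj₂ (q , y≡)) = inj₁ (- (+ 3 * (p * p + q * q) + + 2 * (p + q) + + 1) ,
      inj₂ (trans (cong -_ (cong₂ _+_ (≡±⇒square x≡) (≡±⇒square y≡))) (expand p q)))
      where
      expand : ∀ p q → - ((+ 3 * p + + 1) * (+ 3 * p + + 1) + (+ 3 * q + + 1) * (+ 3 * q + + 1)) ≡
        + 3 * - (+ 3 * (p * p + q * q) + + 2 * (p + q) + + 1) + + 1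
      expand = solve-∀

  -- The first two cases record that 3 does not divide N₂, which the argument for a special factor
  -- uses. The other two already force the exponent to be 4 or at least 6.
  data ThreeAdic (n N₂ : ℤ) : Set where
    unit         : Unit₃ n → Unit₃ N₂ → ThreeAdic n N₂
    multiple-27  : ∀ u → n ≡ + 27 * u → Unit₃ N₂ → ThreeAdic n N₂
    81-unit      : ∀ u → Unit₃ u → n ≡ + 81 * u → ThreeAdic n N₂
    multiple-729 : ∀ u → n ≡ + 729 * u → ThreeAdic n N₂

  -- If 3 divides N₁ it divides A, so 27 divides N₁ A². If 3 divides N₂ then 9 does, and 3 divides
  -- B, so 81 divides N₂ B². In the latter case, when N₁ is prime to 3, a further 3 in B enters
  -- squared and a further 3 in the sum of squares N₂ brings another, so the exponent 5 is skipped.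
  threeAdic : ∀ N₁ x y k l → let N₂ = x * x + y * y in
    ThreeAdic (fourFactors N₁ N₂ (N₁ + + 3 * k) (N₂ + + 3 * l)) N₂
  threeAdic N₁ x y k l = go (sum-mod-3 x y) (trichotomy₃ N₁)
    where
    N₂ = x * x + y * y
    A = N₁ + + 3 * k
    B = N₂ + + 3 * l
    n = fourFactors N₁ N₂ A B
    go : Unit₃ N₂ ⊎ (∃[ p ] ∃[ q ] N₂ ≡ + 9 * (p * p + q * q)) → (∃[ v ] N₁ ≡ + 3 * v) ⊎ Unit₃ N₁ → ThreeAdic n N₂
    go (inj₁ unitN₂) (inj₂ unitN₁) =
      unit (Unit₃-fourFactors unitN₁ unitN₂ (Unit₃-+3* k unitN₁) (Unit₃-+3* l unitN₂)) unitN₂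
    go (inj₁ unitN₂) (inj₁ (v , N₁≡)) = multiple-27 (fourFactors v N₂ (v + k) B)
      (trans (cong (λ z → fourFactors z N₂ (z + + 3 * k) B) N₁≡) (collect v k N₂ B)) unitN₂
      where
      collect : ∀ v k w b → + 3 * v * w * ((+ 3 * v + + 3 * k) * (+ 3 * v + + 3 * k)) * (b * b) ≡
        + 27 * (v * w * ((v + k) * (v + k)) * (b * b))
      collect = solve-∀
    go (inj₂ (p , q , N₂≡)) (inj₁ (v , N₁≡)) = multiple-729 (+ 3 * fourFactors v w (v + k) (+ 3 * w + l))
      (trans (cong₂ (λ z u → fourFactors z u (z + + 3 * k) (u + + 3 * l)) N₁≡ N₂≡) (collect v k w l))
      where
      w = p * p + q * q
      collect : ∀ v k w l → + 3 * v * (+ 9 * w) * ((+ 3 * v + + 3 * k) * (+ 3 * v + + 3 * k)) *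
          ((+ 9 * w + + 3 * l) * (+ 9 * w + + 3 * l)) ≡
        + 729 * (+ 3 * (v * w * ((v + k) * (v + k)) * ((+ 3 * w + l) * (+ 3 * w + l))))
      collect = solve-∀
    go (inj₂ (p , q , N₂≡)) (inj₂ unitN₁) = by-zw (trichotomy₃ z) (sum-mod-3 p q)
      where
      w = p * p + q * q
      z = + 3 * w + l
      n≡81 : n ≡ + 81 * fourFactors N₁ w A z
      n≡81 = trans (cong (λ u → fourFactors N₁ u A (u + + 3 * l)) N₂≡) (collect N₁ A w l)
        where
        collect : ∀ n a w l → n * (+ 9 * w) * (a * a) * ((+ 9 * w + + 3 * l) * (+ 9 * w + + 3 * l)) ≡
          + 81 * (n * w * (a * a) * ((+ 3 * w + l) * (+ 3 * w + l)))
        collect = solve-∀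
      by-zw : (∃[ j ] z ≡ + 3 * j) ⊎ Unit₃ z → Unit₃ w ⊎ (∃[ r ] ∃[ s ] w ≡ + 9 * (r * r + s * s)) → ThreeAdic n N₂
      by-zw (inj₁ (j , z≡)) _ = multiple-729 (fourFactors N₁ w A j)
        (trans n≡81 (trans (cong (λ t → + 81 * fourFactors N₁ w A t) z≡) (collect N₁ A w j)))
        where
        collect : ∀ n a w j → + 81 * (n * w * (a * a) * (+ 3 * j * (+ 3 * j))) ≡ + 729 * (n * w * (a * a) * (j * j))
        collect = solve-∀
      by-zw (inj₂ unit-z) (inj₁ unit-w) = 81-unit (fourFactors N₁ w A z)
        (Unit₃-fourFactors unitN₁ unit-w (Unit₃-+3* k unitN₁) unit-z) n≡81
      by-zw (inj₂ _) (inj₂ (r , s , w≡)) = multiple-729 (fourFactors N₁ (r * r + s * s) A z)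
        (trans n≡81 (trans (cong (λ t → + 81 * (N₁ * t * (A * A) * (z * z))) w≡) (collect N₁ (A * A) (r * r + s * s) (z * z))))
        where
        collect : ∀ n a w z → + 81 * (n * (+ 9 * w) * a * z) ≡ + 729 * (n * w * a * z)
        collect = solve-∀

  ∣⇒ℤ : ∀ {d z} → d ℕ.∣ ∣ z ∣ → ∃[ c ] z ≡ + d * c
  ∣⇒ℤ {d} {z} (ℕ.divides q eq) = ℤ.sign z ◃ q , (begin
    z                                ≡⟨ sym (◃-inverse z) ⟩
    ℤ.sign z ◃ ∣ z ∣                    ≡⟨ cong (ℤ.sign z ◃_) (trans eq (ℕ.*-comm q d)) ⟩
    ℤ.sign z ◃ (d ℕ.* q)               ≡⟨ ◃-distrib-* Sign.+ (ℤ.sign z) d q ⟩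
    (Sign.+ ◃ d) * (ℤ.sign z ◃ q)      ≡⟨ cong (_* (ℤ.sign z ◃ q)) (+◃n≡+n d) ⟩
    + d * (ℤ.sign z ◃ q)               ∎)
    where open ≡-Reasoning

  Odd⇒2∤ : ∀ {z} → Odd z → ¬ (2 ℕ.∣ ∣ z ∣)
  Odd⇒2∤ (k , z≡) 2∣z = let c , z≡2c = ∣⇒ℤ 2∣z in from-no (2 ℕ.∣? 1)
    (multiple-difference⇒∣ 2 (+ 1) 1 k c (trans (reorder k) (trans (sym z≡) z≡2c)))
    where
    reorder : ∀ k → + 1 + k * + 2 ≡ + 2 * k + + 1
    reorder = solve-∀

  Unit₃⇒3∤ : ∀ {z} → Unit₃ z → ¬ (3 ℕ.∣ ∣ z ∣)
  Unit₃⇒3∤ (k , z≡) 3∣z = let c , z≡3c = ∣⇒ℤ 3∣z in go c z≡3c z≡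
    where
    reorder : ∀ k → + 1 + k * + 3 ≡ + 3 * k + + 1
    reorder = solve-∀
    absurd : ∀ c → + 3 * k + + 1 ≡ + 3 * c → ⊥
    absurd c eq = from-no (3 ℕ.∣? 1) (multiple-difference⇒∣ 3 (+ 1) 1 k c (trans (reorder k) eq))
    go : ∀ {z} c → z ≡ + 3 * c → z ≡± (+ 3 * k + + 1) → ⊥
    go c refl (inj₁ eq) = absurd c (sym eq)
    go c refl (inj₂ eq) = absurd (- c) (trans (sym eq) (neg-distribʳ-* (+ 3) c))

  -- Twice the norm is the sum of the squares of the three differences of entries.
  norm-natural : ∀ v → ∃[ k ] norm v ≡ + k
  norm-natural ⟨ a , b , c ⟩ = positive-multiple 2 (norm ⟨ a , b , c ⟩)
    (∣ a - b ∣ ℕ.* ∣ a - b ∣ ℕ.+ ∣ b - c ∣ ℕ.* ∣ b - c ∣ ℕ.+ ∣ c - a ∣ ℕ.* ∣ c - a ∣)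
    (trans (three-squares a b c) (cong₂ _+_ (cong₂ _+_ (square≡+ (a - b)) (square≡+ (b - c))) (square≡+ (c - a))))
    where
    three-squares : ∀ a b c → + 2 * (a * a + b * b + c * c + - (a * b) + - (b * c) + - (c * a)) ≡
      (a + - b) * (a + - b) + (b + - c) * (b + - c) + (c + - a) * (c + - a)
    three-squares = solve-∀

  -- Modulo the prime 1 - ω above 3 the values at ω and at 1 agree; this is the source of the
  -- congruences modulo 3.
  norm-trace : ∀ v → ∃[ k ] norm v ≡ trace v * trace v + + 3 * k
  norm-trace ⟨ a , b , c ⟩ = - (a * b + b * c + c * a) , expand a b c
    where
    expand : ∀ a b c → a * a + b * b + c * c + - (a * b) + - (b * c) + - (c * a) ≡
      (a + b + c) * (a + b + c) + + 3 * - (a * b + b * c + c * a)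
    expand = solve-∀

  sum-difference-trace : ∀ a b c d e f →
    trace ⟨ a + d , b + e , c + f ⟩ ≡ trace ⟨ a - d , e - b , c - f ⟩ + + 2 * (d + b + f)
  sum-difference-trace = expand
    where
    expand : ∀ a b c d e f → a + d + (b + e) + (c + f) ≡ a + - d + (e + - b) + (c + - f) + + 2 * (d + b + f)
    expand = solve-∀

  -- The two triples agree entrywise modulo 2, as those of f(x) and f(-x) do.
  sum-difference-norm : ∀ a b c d e f → ∃[ h ]
    norm ⟨ a + d , b + e , c + f ⟩ ≡ norm ⟨ a - d , e - b , c - f ⟩ + + 2 * h
  sum-difference-norm a b c d e f =
    + 2 * (a * d + b * e + c * f) - a * b - d * e - b * c - e * f - c * d - f * a , expand a b c d e f
    where
    expand : ∀ a b c d e f →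
      (a + d) * (a + d) + (b + e) * (b + e) + (c + f) * (c + f) +
        - ((a + d) * (b + e)) + - ((b + e) * (c + f)) + - ((c + f) * (a + d)) ≡
      (a + - d) * (a + - d) + (e + - b) * (e + - b) + (c + - f) * (c + - f) +
        - ((a + - d) * (e + - b)) + - ((e + - b) * (c + - f)) + - ((c + - f) * (a + - d)) +
      + 2 * (+ 2 * (a * d + b * e + c * f) + - (a * b) + - (d * e) + - (b * c) + - (e * f) + - (c * d) + - (f * a))
    expand = solve-∀

  -- From a value of the determinant to one of the three forms.

  -- The congruences between the four factors as explicit witnesses: `x` and `y` are f(-1) and
  -- g(-1), `e` and `g` lead to f(1) and g(1), `k` and `l` are the quotients modulo 3 and `h` is the
  -- one modulo 2. `β` records that B, a sum of two norms, is not negative.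
  record Factorisation (n : ℤ) : Set where
    field
      x y e g h k l : ℤ
      β             : ℕ
    N₁ = (x + + 2 * e) * (x + + 2 * e) - (y + + 2 * g) * (y + + 2 * g)
    N₂ = x * x + y * y
    A = N₁ + + 3 * k
    B = N₂ + + 3 * l
    field
      n≡ : n ≡ fourFactors N₁ N₂ A B
      A≡ : A ≡ B + + 2 * h
      B≡ : B ≡ + β

  module _ (s s′ w w′ : Triple) {e g h h′ : ℤ}
    (es : trace s ≡ trace w + + 2 * e) (es′ : trace s′ ≡ trace w′ + + 2 * g)
    (ns : norm s ≡ norm w + + 2 * h) (ns′ : norm s′ ≡ norm w′ + + 2 * h′) where

    factorise-productForm : Factorisation (productForm s s′ w w′)
    factorise-productForm =
      let k , k≡ = norm-trace s ; k′ , k′≡ = norm-trace s′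
          l , l≡ = norm-trace w ; l′ , l′≡ = norm-trace w′
          i , i≡ = norm-natural w ; j , j≡ = norm-natural w′
          N₁≡ = cong₂ (λ a b → a * a - b * b) es es′
          A≡ = trans (cong₂ _-_ k≡ k′≡) (trans (collect- (trace s * trace s) (trace s′ * trace s′) k k′)
                 (cong (_+ + 3 * (k - k′)) N₁≡))
          B≡ = trans (cong₂ _+_ l≡ l′≡) (collect+ (trace w * trace w) (trace w′ * trace w′) l l′)
      in record
      { x = trace w ; y = trace w′ ; e = e ; g = g ; h = h - h′ - norm w′ ; k = k - k′ ; l = l + l′ ; β = i ℕ.+ j
      ; n≡ = fourFactors-cong {N₂ = trace w * trace w + trace w′ * trace w′} N₁≡ refl A≡ B≡
      ; A≡ = trans (sym A≡) (trans (cong₂ _-_ ns ns′) (trans (collect-2 (norm w) (norm w′) h h′)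
               (cong (_+ + 2 * (h - h′ - norm w′)) B≡)))
      ; B≡ = trans (sym B≡) (cong₂ _+_ i≡ j≡)
      }
      where
      collect- : ∀ a b k k′ → a + + 3 * k + - (b + + 3 * k′) ≡ a + - b + + 3 * (k + - k′)
      collect- = solve-∀
      collect+ : ∀ a b k k′ → a + + 3 * k + (b + + 3 * k′) ≡ a + b + + 3 * (k + k′)
      collect+ = solve-∀
      collect-2 : ∀ a b h h′ → a + + 2 * h + - (b + + 2 * h′) ≡ a + b + + 2 * (h + - h′ + - b)
      collect-2 = solve-∀

  factorisation : ∀ f → Factorisation (productForm (tripleˢ f) (tripleˢ′ f) (tripleʷ f) (tripleʷ′ f))
  factorisation f = factorise-productForm (tripleˢ f) (tripleˢ′ f) (tripleʷ f) (tripleʷ′ f)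
    (sum-difference-trace (X (# 0)) (X (# 1)) (X (# 2)) (X (# 3)) (X (# 4)) (X (# 5)))
    (sum-difference-trace (X (# 6)) (X (# 7)) (X (# 8)) (X (# 9)) (X (# 10)) (X (# 11)))
    (proj₂ (sum-difference-norm (X (# 0)) (X (# 1)) (X (# 2)) (X (# 3)) (X (# 4)) (X (# 5))))
    (proj₂ (sum-difference-norm (X (# 6)) (X (# 7)) (X (# 8)) (X (# 9)) (X (# 10)) (X (# 11))))
    where X = f ∘ Q12-enum

  InS⇒Factorisation : ∀ {n} → InS-Q12 n → Factorisation n
  InS⇒Factorisation (f , eq) = subst Factorisation (trans (sym (groupDet-product f)) eq) (factorisation f)

  module Classification {n : ℤ} (n≢0 : ¬ (n ≡ + 0)) (φ : Factorisation n) where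
    open Factorisation φ

    twoAdic-n : TwoAdic n B N₂
    twoAdic-n = subst (λ z → TwoAdic z B N₂)
      (sym (trans n≡ (cong (λ a → fourFactors N₁ N₂ a B) A≡))) (twoAdic h B (squares x y e g))

    threeAdic-n : ThreeAdic n N₂
    threeAdic-n = subst (λ z → ThreeAdic z N₂) (sym n≡) (threeAdic N₁ x y k l)

    Exceptional : Set
    Exceptional = Odd B × ∃[ t ] Odd t × (N₂ ≡ + 2 * t ⊎ N₂ ≡ + 8 * t)

    -- Both N₂ and B are natural numbers, here `M` and `β`, so `special-divisor` applies to them;
    -- the factor it finds divides M β², which divides `n`.
    special-factor : Exceptional → Unit₃ N₂ → ∃[ κ ] SpecialK κ × κ ℕ.∣ ∣ n ∣
    special-factor (odd-B , t , odd-t , N₂≡) unitN₂ =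
      let τ , t≡ = t-natural N₂≡
          κ , special , κ∣ = special-divisor {∣ x ∣} {∣ y ∣} {β} {τ} (twice t≡ N₂≡)
            (λ 2∣τ → Odd⇒2∤ odd-t (subst (λ z → 2 ℕ.∣ ∣ z ∣) (sym t≡) 2∣τ))
            (λ 2∣β → Odd⇒2∤ odd-B (subst (λ z → 2 ℕ.∣ ∣ z ∣) (sym B≡) 2∣β))
            (λ 3∣M → Unit₃⇒3∤ unitN₂ (subst (λ z → 3 ℕ.∣ ∣ z ∣) (sym N₂≡M) 3∣M)) β%3≡M%3
      in κ , special , ℕ.∣-trans κ∣ (multiple⇒∣∣ (M ℕ.* (β ℕ.* β)) {N₁ * (A * A)} n≡M)
      where
      M = ∣ x ∣ ℕ.* ∣ x ∣ ℕ.+ ∣ y ∣ ℕ.* ∣ y ∣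
      N₂≡M : N₂ ≡ + M
      N₂≡M = cong₂ _+_ (square≡+ x) (square≡+ y)
      t-natural : N₂ ≡ + 2 * t ⊎ N₂ ≡ + 8 * t → ∃[ τ ] t ≡ + τ
      t-natural (inj₁ eq) = positive-multiple 2 t M (trans (sym eq) N₂≡M)
      t-natural (inj₂ eq) = positive-multiple 8 t M (trans (sym eq) N₂≡M)
      twice : ∀ {τ} → t ≡ + τ → N₂ ≡ + 2 * t ⊎ N₂ ≡ + 8 * t → M ≡ 2 ℕ.* τ ⊎ M ≡ 8 ℕ.* τ
      twice {τ} t≡ (inj₁ eq) = inj₁ (+-injective (trans (sym N₂≡M) (trans eq (trans (cong (+ 2 *_) t≡) (sym (pos-* 2 τ))))))
      twice {τ} t≡ (inj₂ eq) = inj₂ (+-injective (trans (sym N₂≡M) (trans eq (trans (cong (+ 8 *_) t≡) (sym (pos-* 8 τ))))))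
      β≡M+3l : + β ≡ + M + + 3 * l
      β≡M+3l = trans (sym B≡) (cong (_+ + 3 * l) N₂≡M)
      β%3≡M%3 : β ℕ.% 3 ≡ M ℕ.% 3
      β%3≡M%3 = congruent-mod-3 β M l β≡M+3l
        where
        congruent-mod-3 : ∀ a b l → + a ≡ + b + + 3 * l → a ℕ.% 3 ≡ b ℕ.% 3
        congruent-mod-3 a b (+ c) eq = trans
          (cong (ℕ._% 3) (+-injective (trans eq (trans (cong (_+_ (+ b)) (sym (pos-* 3 c)))
            (cong (λ z → + (b ℕ.+ z)) (ℕ.*-comm 3 c))))))
          (ℕ.[m+kn]%n≡m%n b c 3)
        congruent-mod-3 a b l@(ℤ.-[1+ c ]) eq = sym (trans
          (cong (ℕ._% 3) (+-injective (trans (move (+ a) (+ b) l eq) (cong (λ z → + (a ℕ.+ z)) (ℕ.*-comm 3 (suc c))))))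
          (ℕ.[m+kn]%n≡m%n a (suc c) 3))
          where
          move : ∀ a b l → a ≡ b + + 3 * l → b ≡ a + + 3 * - l
          move a b l refl = cancel b l
            where
            cancel : ∀ b l → b ≡ b + + 3 * l + + 3 * - l
            cancel = solve-∀
      n≡M : n ≡ + (M ℕ.* (β ℕ.* β)) * (N₁ * (A * A))
      n≡M = trans n≡ (trans (cong₂ (λ u v → N₁ * u * (A * A) * (v * v)) N₂≡M B≡)
        (trans (regroup N₁ (+ M) (A * A) (+ β))
          (cong (_* (N₁ * (A * A))) (sym (trans (pos-* M (β ℕ.* β)) (cong (+ M *_) (pos-* β β)))))))
        where
        regroup : ∀ n m a b → n * m * a * (b * b) ≡ m * (b * b) * (n * a)
        regroup = solve-∀

    ∣n∣≢0 : ∣ n ∣ ≢ 0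
    ∣n∣≢0 eq = n≢0 (∣i∣≡0⇒i≡0 eq)

    module Exponents {a b s : ℕ} (∣n∣≡ : ∣ n ∣ ≡ 2 ℕ.^ a ℕ.* (3 ℕ.^ b ℕ.* s))
      (2∤r : ¬ (2 ℕ.∣ 3 ℕ.^ b ℕ.* s)) (3∤s : ¬ (3 ℕ.∣ s)) where

      coprime-3-2 : ℕ.Coprime 3 2
      coprime-3-2 = from-yes (ℕ.coprime? 3 2)

      2∤s : ¬ (2 ℕ.∣ s)
      2∤s 2∣s = 2∤r (ℕ.∣n⇒∣m*n (3 ℕ.^ b) 2∣s)

      ∣n∣≡3 : ∣ n ∣ ≡ 3 ℕ.^ b ℕ.* (2 ℕ.^ a ℕ.* s)
      ∣n∣≡3 = trans ∣n∣≡ (trans (sym (ℕ.*-assoc (2 ℕ.^ a) (3 ℕ.^ b) s))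
        (trans (cong (ℕ._* s) (ℕ.*-comm (2 ℕ.^ a) (3 ℕ.^ b))) (ℕ.*-assoc (3 ℕ.^ b) (2 ℕ.^ a) s)))

      3∤r : ¬ (3 ℕ.∣ 2 ℕ.^ a ℕ.* s)
      3∤r 3∣ = 3∤s (coprime-power-divisor 2 ℕ.prime[2] a coprime-3-2 3∣)

      2^∣⇒≤ : ∀ i {u} → n ≡ + (2 ℕ.^ i) * u → i ℕ.≤ a
      2^∣⇒≤ i eq = ^-∣⇒≤ 2 i a (ℕ.s≤s (ℕ.s≤s ℕ.z≤n)) 2∤r (subst (2 ℕ.^ i ℕ.∣_) ∣n∣≡ (multiple⇒∣∣ (2 ℕ.^ i) eq))

      ≤⇒2^∣ : ∀ {i} → i ℕ.≤ a → 2 ℕ.^ i ℕ.∣ ∣ n ∣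
      ≤⇒2^∣ {i} i≤a = subst (2 ℕ.^ i ℕ.∣_) (sym ∣n∣≡) (≤⇒^-∣ 2 {i} {a} _ i≤a)

      3^∣⇒≤ : ∀ i {u} → n ≡ + (3 ℕ.^ i) * u → i ℕ.≤ b
      3^∣⇒≤ i eq = ^-∣⇒≤ 3 i b (ℕ.s≤s (ℕ.s≤s ℕ.z≤n)) 3∤r (subst (3 ℕ.^ i ℕ.∣_) ∣n∣≡3 (multiple⇒∣∣ (3 ℕ.^ i) eq))

      ≤⇒3^∣ : ∀ {i} → i ℕ.≤ b → 3 ℕ.^ i ℕ.∣ ∣ n ∣
      ≤⇒3^∣ {i} i≤b = subst (3 ℕ.^ i ℕ.∣_) (sym ∣n∣≡3) (≤⇒^-∣ 3 {i} {b} _ i≤b)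

      ∣n∣≡* : ∀ c {u} → n ≡ + c * u → ∣ n ∣ ≡ c ℕ.* ∣ u ∣
      ∣n∣≡* c {u} eq = trans (cong ∣_∣ eq) (abs-* (+ c) u)

      squeeze : ∀ {i j} → i ℕ.≤ j → ¬ (suc i ℕ.≤ j) → j ≡ i
      squeeze i≤j i≮j = ℕ.≤-antisym (ℕ.≮⇒≥ i≮j) i≤j

      -- In the exceptional case only 16 is known to divide `n`. The exponents 4 and at least 6 are
      -- allowed anyway, and the exponent 5 keeps the exceptional data.
      exponent-2 : (a ≡ 0 ⊎ a ≡ 4 ⊎ 6 ℕ.≤ a) ⊎ (a ≡ 5 × Exceptional)
      exponent-2 = go twoAdic-n
        where
        go : TwoAdic n B N₂ → (a ≡ 0 ⊎ a ≡ 4 ⊎ 6 ℕ.≤ a) ⊎ (a ≡ 5 × Exceptional)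
        go (odd odd-n) = inj₁ (inj₁ (squeeze ℕ.z≤n (λ 1≤a → Odd⇒2∤ odd-n (≤⇒2^∣ 1≤a))))
        go (16-odd u odd-u n≡16u) = inj₁ (inj₂ (inj₁ (squeeze (2^∣⇒≤ 4 n≡16u) (λ 5≤a →
          Odd⇒2∤ odd-u (ℕ.*-cancelˡ-∣ 16 (subst (32 ℕ.∣_) (∣n∣≡* 16 n≡16u) (≤⇒2^∣ 5≤a)))))))
        go (multiple-64 u n≡64u) = inj₁ (inj₂ (inj₂ (2^∣⇒≤ 6 n≡64u)))
        go (exceptional u n≡16u odd-B t odd-t N₂≡) = by-a (ℕ.m≤n⇒m<n∨m≡n (2^∣⇒≤ 4 n≡16u))
          where
          by-5 : 5 ℕ.< a ⊎ 5 ≡ a → (a ≡ 0 ⊎ a ≡ 4 ⊎ 6 ℕ.≤ a) ⊎ (a ≡ 5 × Exceptional)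
          by-5 (inj₁ 6≤a) = inj₁ (inj₂ (inj₂ 6≤a))
          by-5 (inj₂ 5≡a) = inj₂ (sym 5≡a , odd-B , t , odd-t , N₂≡)
          by-a : 4 ℕ.< a ⊎ 4 ≡ a → (a ≡ 0 ⊎ a ≡ 4 ⊎ 6 ℕ.≤ a) ⊎ (a ≡ 5 × Exceptional)
          by-a (inj₁ 5≤a) = by-5 (ℕ.m≤n⇒m<n∨m≡n 5≤a)
          by-a (inj₂ 4≡a) = inj₁ (inj₂ (inj₁ (sym 4≡a)))

      exponent-3 : ((b ≡ 0 ⊎ 3 ℕ.≤ b) × Unit₃ N₂) ⊎ (b ≡ 4 ⊎ 6 ℕ.≤ b)
      exponent-3 = go threeAdic-n
        where
        go : ThreeAdic n N₂ → ((b ≡ 0 ⊎ 3 ℕ.≤ b) × Unit₃ N₂) ⊎ (b ≡ 4 ⊎ 6 ℕ.≤ b)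
        go (unit unit-n unitN₂) =
          inj₁ (inj₁ (squeeze ℕ.z≤n (λ 1≤b → Unit₃⇒3∤ unit-n (≤⇒3^∣ 1≤b))) , unitN₂)
        go (multiple-27 u n≡27u unitN₂) = inj₁ (inj₂ (3^∣⇒≤ 3 n≡27u) , unitN₂)
        go (81-unit u unit-u n≡81u) = inj₂ (inj₁ (squeeze (3^∣⇒≤ 4 n≡81u) (λ 5≤b →
          Unit₃⇒3∤ unit-u (ℕ.*-cancelˡ-∣ 81 (subst (243 ℕ.∣_) (∣n∣≡* 81 n≡81u) (≤⇒3^∣ 5≤b))))))
        go (multiple-729 u n≡729u) = inj₂ (inj₂ (3^∣⇒≤ 6 n≡729u))

      divisor-coprime-to-6 : ∀ σ {c} → c ℕ.∣ s → CoprimeTo6 (σ ◃ c)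
      divisor-coprime-to-6 σ {c} c∣s {i} (i∣ , i∣6) = prime∤⇒coprime prime[3] 3∤s (i∣s ,
        ℕ.coprime-divisor {o = 3} i-coprime-2 i∣6)
        where
        prime[3] : ℕ.Prime 3
        prime[3] = from-yes (ℕ.prime? 3)
        i∣s : i ℕ.∣ s
        i∣s = ℕ.∣-trans (subst (i ℕ.∣_) (abs-◃ σ c) i∣) c∣s
        i-coprime-2 : ℕ.Coprime i 2
        i-coprime-2 (d∣i , d∣2) = prime∤⇒coprime ℕ.prime[2] 2∤s (ℕ.∣-trans d∣i i∣s , d∣2)

      σ = ℤ.sign n

      ◃-* : ∀ c d → σ ◃ (c ℕ.* d) ≡ + c * (σ ◃ d)
      ◃-* c d = trans (◃-distrib-* Sign.+ σ c d) (cong (_* (σ ◃ d)) (+◃n≡+n c))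

      n≡powers : n ≡ pow 2 a * pow 3 b * (σ ◃ s)
      n≡powers = begin
        n                                       ≡⟨ sym (◃-inverse n) ⟩
        σ ◃ ∣ n ∣                                ≡⟨ cong (σ ◃_) ∣n∣≡ ⟩
        σ ◃ (2 ℕ.^ a ℕ.* (3 ℕ.^ b ℕ.* s))       ≡⟨ ◃-* (2 ℕ.^ a) (3 ℕ.^ b ℕ.* s) ⟩
        pow 2 a * (σ ◃ (3 ℕ.^ b ℕ.* s))         ≡⟨ cong (pow 2 a *_) (◃-* (3 ℕ.^ b) s) ⟩
        pow 2 a * (pow 3 b * (σ ◃ s))           ≡⟨ sym (*-assoc (pow 2 a) (pow 3 b) (σ ◃ s)) ⟩
        pow 2 a * pow 3 b * (σ ◃ s)             ∎
        where open ≡-Reasoning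

      formI : a ≡ 0 ⊎ a ≡ 4 ⊎ 6 ℕ.≤ a → b ≡ 0 ⊎ 3 ℕ.≤ b → FormI n
      formI a∈ b∈ = (σ ◃ s) , a , b , divisor-coprime-to-6 σ {s} ℕ.∣-refl , a∈ , b∈ , n≡powers

      formII : a ≡ 5 → b ≡ 4 ⊎ 6 ℕ.≤ b → FormII n
      formII a≡5 b∈ = (σ ◃ s) , b , divisor-coprime-to-6 σ {s} ℕ.∣-refl , b∈ ,
        trans n≡powers (cong (λ a → pow 2 a * pow 3 b * (σ ◃ s)) a≡5)

      -- A special factor is prime to 6, so it divides the part `s` of `n` prime to 6; the cofactor
      -- in `s`, with the sign of `n`, is the required `m`.
      formIII : a ≡ 5 → Exceptional → Unit₃ N₂ → b ≡ 0 ⊎ b ≡ 3 ⊎ b ≡ 5 → FormIII n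
      formIII a≡5 exc unitN₂ b∈ =
        let κ , special , κ∣n = special-factor exc unitN₂
            ℕ.divides c s≡cκ = κ∣s special κ∣n
        in (σ ◃ c) , b , κ , divisor-coprime-to-6 σ {c} (ℕ.divides κ (trans s≡cκ (ℕ.*-comm c κ))) , b∈ , special ,
          trans n≡powers (trans (cong₂ (λ a m → pow 2 a * pow 3 b * m) a≡5
            (trans (cong (σ ◃_) (trans s≡cκ (ℕ.*-comm c κ))) (◃-* κ c)))
            (regroup (pow 2 5) (pow 3 b) (+ κ) (σ ◃ c)))
        where
        regroup : ∀ p q k m → p * q * (k * m) ≡ p * q * m * k
        regroup = solve-∀
        κ∣s : ∀ {κ} → SpecialK κ → κ ℕ.∣ ∣ n ∣ → κ ℕ.∣ s
        κ∣s {κ} special κ∣n =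
          coprime-power-divisor 3 prime[3] b (special∤ 3 prime[3] (ℕ.divides 2 refl) special)
            (coprime-power-divisor 2 ℕ.prime[2] a (special∤ 2 ℕ.prime[2] (ℕ.divides 3 refl) special)
              (subst (κ ℕ.∣_) ∣n∣≡ κ∣n))
          where
          prime[3] : ℕ.Prime 3
          prime[3] = from-yes (ℕ.prime? 3)

      classify : FormI n ⊎ FormII n ⊎ FormIII n
      classify = go exponent-2 exponent-3
        where
        Answer = FormI n ⊎ FormII n ⊎ FormIII n
        4⊎6≤⇒3≤ : b ≡ 4 ⊎ 6 ℕ.≤ b → 3 ℕ.≤ b
        4⊎6≤⇒3≤ (inj₁ b≡4) = subst (3 ℕ.≤_) (sym b≡4) (ℕ.m≤m+n 3 1)
        4⊎6≤⇒3≤ (inj₂ 6≤b) = ℕ.≤-trans (ℕ.m≤m+n 3 3) 6≤b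
        by-b : a ≡ 5 → Exceptional → Unit₃ N₂ → 3 ℕ.≤ b → Answer
        by-b a≡5 exc unitN₂ 3≤b = by-3 (ℕ.m≤n⇒m<n∨m≡n 3≤b)
          where
          by-5 : 5 ℕ.< b ⊎ 5 ≡ b → Answer
          by-5 (inj₁ 6≤b) = inj₂ (inj₁ (formII a≡5 (inj₂ 6≤b)))
          by-5 (inj₂ 5≡b) = inj₂ (inj₂ (formIII a≡5 exc unitN₂ (inj₂ (inj₂ (sym 5≡b)))))
          by-4 : 4 ℕ.< b ⊎ 4 ≡ b → Answer
          by-4 (inj₁ 5≤b) = by-5 (ℕ.m≤n⇒m<n∨m≡n 5≤b)
          by-4 (inj₂ 4≡b) = inj₂ (inj₁ (formII a≡5 (inj₁ (sym 4≡b))))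
          by-3 : 3 ℕ.< b ⊎ 3 ≡ b → Answer
          by-3 (inj₁ 4≤b) = by-4 (ℕ.m≤n⇒m<n∨m≡n 4≤b)
          by-3 (inj₂ 3≡b) = inj₂ (inj₂ (formIII a≡5 exc unitN₂ (inj₂ (inj₁ (sym 3≡b)))))
        go : (a ≡ 0 ⊎ a ≡ 4 ⊎ 6 ℕ.≤ a) ⊎ (a ≡ 5 × Exceptional) →
          ((b ≡ 0 ⊎ 3 ℕ.≤ b) × Unit₃ N₂) ⊎ (b ≡ 4 ⊎ 6 ℕ.≤ b) → Answer
        go (inj₁ a∈)          (inj₁ (b∈ , _))             = inj₁ (formI a∈ b∈)
        go (inj₁ a∈)          (inj₂ b∈)                   = inj₁ (formI a∈ (inj₂ (4⊎6≤⇒3≤ b∈)))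
        go (inj₂ (a≡5 , _))   (inj₂ b∈)                   = inj₂ (inj₁ (formII a≡5 b∈))
        go (inj₂ (a≡5 , exc)) (inj₁ (inj₁ b≡0 , unitN₂))  = inj₂ (inj₂ (formIII a≡5 exc unitN₂ (inj₁ b≡0)))
        go (inj₂ (a≡5 , exc)) (inj₁ (inj₂ 3≤b , unitN₂))  = by-b a≡5 exc unitN₂ 3≤b

    classification : FormI n ⊎ FormII n ⊎ FormIII n
    classification =
      let a , r , ∣n∣≡ , 2∤r = remove-factor 2 ∣ n ∣ (ℕ.s≤s (ℕ.s≤s ℕ.z≤n)) ∣n∣≢0
          b , s , r≡ , 3∤s = remove-factor 3 r (ℕ.s≤s (ℕ.s≤s ℕ.z≤n)) (λ r≡0 → 2∤r (subst (2 ℕ.∣_) (sym r≡0) (2 ℕ.∣0)))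
      in Exponents.classify {a} {b} {s} (trans ∣n∣≡ (cong (2 ℕ.^ a ℕ.*_) r≡)) (subst (λ r → ¬ (2 ℕ.∣ r)) r≡ 2∤r) 3∤s

open import Data.Integer using (ℤ; +_)
open Sufficiency using (InS-FormI; InS-FormII; InS-FormIII)
open Necessity using (InS⇒Factorisation; module Classification)

-- The integer 0 is a value, at the zero assignment, but has none of the three forms, since a number
-- coprime to 6 is not 0. Hence the equivalence is stated for nonzero `n`.
theorem5p1 : (n : ℤ) → ¬ (n ≡ + 0) →
    (InS-Q12 n → FormI n ⊎ FormII n ⊎ FormIII n) × (FormI n ⊎ FormII n ⊎ FormIII n → InS-Q12 n)
theorem5p1 n n≢0 =
  (λ h → Classification.classification n≢0 (InS⇒Factorisation h)) ,
  [ InS-FormI , [ InS-FormII , InS-FormIII ]′ ]′
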